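{- There is a $0.337$-selectable OCRS for matching in general graphs with edge arrivals. That is, for every finite simple (not necessarily bipartite) graph $G=(V,E)$ and every $\mathbf{x}=(x_e)_{e\in E}\in\mathcal{F}$, where $\mathcal{F}=\{\mathbf{y}\in\mathbb{R}^E:\ y_e\ge0\ \forall e\in E,\ \sum_{u:(uv)\in E}y_{uv}\le 1\ \forall v\in V\}$, there is an online algorithm which, for every arrival order of the edges, selects a set $I\subseteq R$ that is a matching and satisfies $\Pr[e\in I\mid e\in R]\ge 0.337$ for every $e\in E$ with $x_e>0$, where $R$ is the random set containing each $e\in E$ independently with probability $x_e$.
   Context: Edge arrival model: the edges of $G$ arrive one at a time in an order unknown to the algorithm, fixed by an oblivious adversary (independently of the realization of $R$ and the algorithm's randomness). When $e$ arrives, the algorithm learns whether $e\in R$, and must irrevocably decide whether to include $e$ in $I$ (allowed only if $e\in R$ and $I$ stays a matching). The (possibly randomized) decision may depend on $G$, $\mathbf{x}$, the order of edges arrived so far, which of them are in $R$, previous decisions, and internal randomness. -}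

module Defs where

open import Level using (Level; _⊔_) renaming (suc to lsuc)
open import Algebra.Bundles using (CommutativeRing)
import Algebra.Definitions.RawMonoid as RawMonoidDefs
open import Data.Bool using (Bool; true; false; if_then_else_; _∧_)
open import Data.Fin using (Fin; zero; suc)
open import Data.Fin.Properties using (all?) renaming (_≟_ to _≟ᶠ_)
open import Data.Fin.Subset using (Subset; _∈_; _⊆_; _∪_; ⁅_⁆; ⊥)
open import Data.Fin.Subset.Properties using (_∈?_)
open import Data.List using (List; []; _∷_)
open import Data.Nat using (ℕ; zero; suc) renaming (_≤_ to _≤ℕ_)
open import Data.Product using (∃-syntax; _×_; _,_)
open import Data.Sum using (_⊎_)
open import Data.Vec using ([]; _∷_)
open import Function using (_∘_)
open import Relation.Binary.Core using (Rel)
open import Relation.Binary.Definitions using (Cotransitive)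
open import Relation.Binary.PropositionalEquality using (_≡_; _≢_)
open import Relation.Binary.Structures using (IsStrictPartialOrder)
open import Relation.Nullary using (¬_; Dec; does)
open import Relation.Nullary.Decidable using (_⊎-dec_; _→-dec_)

-- The real numbers, axiomatically: an Archimedean, Cauchy-complete ordered
-- field.  Classically this determines ℝ up to isomorphism.  The order axioms
-- are the constructive ones (strict order primitive, cotransitive instead of
-- trichotomous), so that no instance of excluded middle is presupposed.
record RealNumbers (c ℓ₁ ℓ₂ : Level) : Set (lsuc (c ⊔ ℓ₁ ⊔ ℓ₂)) where
  field
    commutativeRing : CommutativeRing c ℓ₁

  open CommutativeRing commutativeRing public hiding (zero)
  open RawMonoidDefs +-rawMonoid public using (sum) renaming (_×_ to _·_)

  infix 4 _<_ _≤_

  field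
    _<_                  : Rel Carrier ℓ₂
    isStrictPartialOrder : IsStrictPartialOrder _≈_ _<_
    <-cotrans            : Cotransitive _<_
    <-tight              : ∀ {x y} → ¬ (x < y) → ¬ (y < x) → x ≈ y
    0<1                  : 0# < 1#
    +-monoˡ-<            : ∀ {x y} z → x < y → x + z < y + z
    *-pos                : ∀ {x y} → 0# < x → 0# < y → 0# < x * y
    recip                : ∀ x → 0# < x → Carrier
    *-recipʳ             : ∀ x (0<x : 0# < x) → x * recip x 0<x ≈ 1#
    archimedean          : ∀ x → ∃[ n ] x < n · 1#

  _≤_ : Rel Carrier ℓ₂
  x ≤ y = ¬ (y < x)

  IsCauchy : (ℕ → Carrier) → Set (c ⊔ ℓ₂)
  IsCauchy s = ∀ ε → 0# < ε →
    ∃[ N ] (∀ m n → N ≤ℕ m → N ≤ℕ n → s m < s n + ε)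

  _ConvergesTo_ : (ℕ → Carrier) → Carrier → Set (c ⊔ ℓ₂)
  s ConvergesTo l = ∀ ε → 0# < ε →
    ∃[ N ] (∀ n → N ≤ℕ n → (s n < l + ε) × (l < s n + ε))

  field
    complete : ∀ s → IsCauchy s → ∃[ l ] s ConvergesTo l

  open IsStrictPartialOrder isStrictPartialOrder public
    using (<-respʳ-≈; <-respˡ-≈) renaming (irrefl to <-irrefl; trans to <-trans)

  0<suc : ∀ n → 0# < suc n · 1#
  0<suc zero    = <-respʳ-≈ (sym (+-identityʳ 1#)) 0<1
  0<suc (suc n) = <-trans (0<suc n)
    (<-respˡ-≈ (+-identityˡ _) (+-monoˡ-< (suc n · 1#) 0<1))

  0·337 : Carrier
  0·337 = (337 · 1#) * recip (1000 · 1#) (0<suc 999)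

-- Vertices are Fin #V and edges are Fin #E.  The names src and tgt carry no
-- orientation: only the incidence relation _∈ₑ_ is ever used.
record SimpleGraph : Set where
  field
    #V #E   : ℕ
    src tgt : Fin #E → Fin #V

  Vertex : Set
  Vertex = Fin #V

  Edge : Set
  Edge = Fin #E

  infix 4 _∈ₑ_ _∈ₑ?_

  _∈ₑ_ : Vertex → Edge → Set
  v ∈ₑ e = v ≡ src e ⊎ v ≡ tgt e

  field
    loopless    : ∀ e → src e ≢ tgt e
    no-parallel : ∀ e f → src f ∈ₑ e → tgt f ∈ₑ e → e ≡ f

  _∈ₑ?_ : ∀ v e → Dec (v ∈ₑ e)
  v ∈ₑ? e = (v ≟ᶠ src e) ⊎-dec (v ≟ᶠ tgt e)

  IsMatching : Subset #E → Set
  IsMatching M = ∀ e f v → e ∈ M → f ∈ M → v ∈ₑ e → v ∈ₑ f → e ≡ f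

  isMatching? : ∀ M → Dec (IsMatching M)
  isMatching? M = all? λ e → all? λ f → all? λ v →
    (e ∈? M) →-dec ((f ∈? M) →-dec
      ((v ∈ₑ? e) →-dec ((v ∈ₑ? f) →-dec (e ≟ᶠ f))))

module Probability {c ℓ₁ ℓ₂} (ℝ : RealNumbers c ℓ₁ ℓ₂) where
  open RealNumbers ℝ

  -- Finite random experiments built from independent biased coin flips;
  -- coin p k continues with k true with probability p and with k false with
  -- probability 1 - p.  Biases are not forced to lie in [0,1] here: this is
  -- required where the biases are supplied (_∈𝓕 and OnlineAlgorithm below).
  data Random (A : Set) : Set c where
    return : A → Random A
    coin   : Carrier → (Bool → Random A) → Random A

  infixl 1 _>>=_
  _>>=_ : ∀ {A B} → Random A → (A → Random B) → Random B
  return a >>= f = f a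
  coin p k >>= f = coin p (λ b → k b >>= f)

  Pr : ∀ {A} → Random A → (A → Bool) → Carrier
  Pr (return a) P = if P a then 1# else 0#
  Pr (coin p k) P = p * Pr (k true) P + (1# - p) * Pr (k false) P

  Pr[_∣_] : ∀ {A} (P Q : A → Bool) (X : Random A) → 0# < Pr X Q → Carrier
  Pr[ P ∣ Q ] X 0<q = Pr X (λ a → P a ∧ Q a) * recip (Pr X Q) 0<q

  Surely : ∀ {A} → (A → Set) → Random A → Set
  Surely P (return a) = P a
  Surely P (coin p k) = ∀ b → Surely P (k b)

  randomSubset : ∀ {n} → (Fin n → Carrier) → Random (Subset n)
  randomSubset {zero}  x = return []
  randomSubset {suc n} x =
    coin (x zero) λ b → randomSubset (x ∘ suc) >>= λ S → return (b ∷ S)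

module OCRS {c ℓ₁ ℓ₂} (ℝ : RealNumbers c ℓ₁ ℓ₂) (G : SimpleGraph) where
  open RealNumbers ℝ
  open SimpleGraph G
  open Probability ℝ

  _∈𝓕 : (Edge → Carrier) → Set ℓ₂
  y ∈𝓕 = (∀ e → 0# ≤ y e)
       × (∀ v → sum (λ e → if does (v ∈ₑ? e) then y e else 0#) ≤ 1#)

  record Arrival : Set where
    constructor arrival
    field
      edge     : Edge
      active   : Bool    -- whether the edge belongs to R
      selected : Bool    -- whether the algorithm put it into I

  History : Set
  History = List Arrival    -- most recent arrival first

  -- accept h e is the probability of selecting the arriving edge e after the
  -- history h, given that e ∈ R and that e can be added to the matching (the
  -- only case in which there is a decision to make).  Since the history
  -- includes all previous decisions, conditioning on it captures arbitrary
  -- internal randomness.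
  record OnlineAlgorithm : Set (c ⊔ ℓ₂) where
    field
      accept   : History → Edge → Carrier
      accept≥0 : ∀ h e → 0# ≤ accept h e
      accept≤1 : ∀ h e → accept h e ≤ 1#

  module _ (𝒜 : OnlineAlgorithm) where
    open OnlineAlgorithm 𝒜

    -- The final set I, when R is the realization, h the history, I the set
    -- selected so far, and the listed edges are still to arrive.
    run : (R : Subset #E) → History → (I : Subset #E) → List Edge →
          Random (Subset #E)
    run R h I []       = return I
    run R h I (e ∷ es) =
      if does (e ∈? R) ∧ does (isMatching? (I ∪ ⁅ e ⁆))
      then coin (accept h e) (λ b →
             run R (arrival e true b ∷ h) (if b then I ∪ ⁅ e ⁆ else I) es)
      else run R (arrival e (does (e ∈? R)) false ∷ h) I es

    -- The joint outcome (R , I) for the activation probabilities x and the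
    -- arrival order σ.
    outcome : (x : Edge → Carrier) (σ : List Edge) →
              Random (Subset #E × Subset #E)
    outcome x σ = randomSubset x >>= λ R →
                  run R [] ⊥ σ >>= λ I → return (R , I)

  ∈R ∈I : Edge → Subset #E × Subset #E → Bool
  ∈R e (R , I) = does (e ∈? R)
  ∈I e (R , I) = does (e ∈? I)

{-# OPTIONS --safe #-}

-- Let an arriving edge e = uv that is active and can be added be accepted with
-- probability γ / P(e), where γ = 0.337 and P(e) is the probability that u and
-- v are both still unmatched.  Then every edge e is selected with probability
-- exactly γ x_e, provided that always P(e) ≥ γ.  Write a, b ≤ 1 for the x-mass
-- that has arrived at u and at v.  By inclusion-exclusion
--   P(e) = 1 - γ a - γ b + Pr[u and v both matched],
-- so for a = b = 1 the last term has to be at least 3γ - 1 = 0.011.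
--
-- For it, let every edge decide independently, with its own acceptance rate,
-- whether it "would be selected".  Two edges f = uw and g = vz with w ≠ z are
-- both selected if f and g are the first such edges at u and at v, and no such
-- edge joins w or z to a vertex other than u and v.  The bounds
--   1 - γ - γ (mass at an endpoint) ≤ P ≤ 1 - γ (mass at an endpoint)
-- on the rates make the probability of "f is the first at u" at least
-- γ (1-γ) x_f, and that of "nothing at w" at least
-- (1-2γ)(1+γ+γ²)(1 + s_w/2), with s_w the x-mass between w and {u, v}.  The
-- factors 1 + s_w/2 pay for the excluded pairs w = z, and the sum over f and g
-- comes out as (γ (1-2γ)(1-γ³))² > 0.011.

module Submission where

open import Defs
import Algebra.Properties.AbelianGroup as AbelianGroupProperties
import Algebra.Properties.CommutativeMonoid.Sum as CommutativeMonoidSum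
import Algebra.Properties.Monoid.Mult as MonoidMult
import Algebra.Properties.Ring as RingProperties
import Algebra.Properties.Semiring.Mult as SemiringMult
import Algebra.Properties.Semiring.Sum as SemiringSum
import Algebra.Solver.Ring as RingSolver
open import Algebra.Solver.Ring.AlmostCommutativeRing
  using (fromCommutativeRing; _-Raw-AlmostCommutative⟶_)
open import Data.Bool using (Bool; true; false; if_then_else_; _∧_)
open import Data.Empty using (⊥-elim)
open import Data.Fin using (Fin; zero; suc)
open import Data.Fin.Properties using (all?; any?; ≡-setoid) renaming (_≟_ to _≟ᶠ_)
open import Data.Fin.Subset using (Subset; _∈_; _∉_; _⊆_; _∪_; ⁅_⁆; ⊥)
open import Data.Fin.Subset.Properties
  using (_∈?_; x∈p∪q⁺; x∈p∪q⁻; x∈⁅x⁆; x∈⁅y⁆⇒x≡y; ∉⊥)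
open import Data.Integer as ℤ using (ℤ; +_; -[1+_]; _⊖_)
import Data.Integer.Properties as ℤₚ
open import Data.List using (List; []; _∷_; map; allFin; reverse; _ʳ++_)
open import Data.List.Membership.DecPropositional using () renaming (_∈?_ to member?)
open import Data.List.Membership.Propositional using () renaming (_∈_ to _∈ₗ_; _∉_ to _∉ₗ_)
open import Data.List.Membership.Propositional.Properties using (∈-allFin)
open import Data.List.Relation.Binary.Permutation.Propositional
  using (_↭_; ↭-sym; ↭-trans; ↭⇒↭ₛ)
open import Data.List.Relation.Binary.Permutation.Propositional.Properties
  using (∈-resp-↭; ↭-reverse)
import Data.List.Relation.Binary.Permutation.Setoid.Properties as SetoidPermutation
import Data.List.Relation.Unary.All as All
import Data.List.Relation.Unary.AllPairs as AllPairs
open import Data.List.Relation.Unary.Any using (here; there)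
import Data.List.Relation.Unary.Unique.DecPropositional as DecUnique
open import Data.List.Relation.Unary.Unique.Propositional using (Unique; []; _∷_)
open import Data.List.Relation.Unary.Unique.Propositional.Properties using (allFin⁺)
open import Data.Maybe as Maybe using (Maybe)
import Data.Nat as ℕ
open import Data.Nat using (ℕ; zero; suc)
import Data.Nat.Properties as ℕₚ
open import Data.Product using (∃; Σ-syntax; _×_; _,_; proj₁; proj₂)
open import Data.Sum using (_⊎_; inj₁; inj₂; [_,_]′)
open import Data.Unit using (⊤; tt)
open import Data.Vec using ([]; _∷_; _[_]≔_)
open import Data.Vec.Properties
  using ([]≔-updates; []=-injective; lookup∘update′; []=⇒lookup; lookup⇒[]=)
open import Function using (_∘_; id; mk⇔)
open import Level using (Level)
open import Relation.Binary.Bundles using (Poset)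
open import Relation.Binary.PropositionalEquality as ≡ using (_≡_; _≢_)
import Relation.Binary.Reasoning.PartialOrder as PosetReasoning
import Relation.Binary.Reasoning.Setoid as SetoidReasoning
open import Relation.Nullary using (¬_; Dec; yes; no; does; contradiction)
open import Relation.Nullary.Decidable
  using (_→-dec_; _×-dec_; _⊎-dec_; ¬?; dec-true; dec-false; dec⇒maybe; does-⇔)

-- Without the term for "both matched" the argument stops at γ = 1/3, so all the gain beyond 1/3
-- comes from that term. No correlation inequality can supply it: edges at u and at v compete for
-- common neighbours, and in a triangle u and v are never both matched when the third edge arrives.
-- Hence the explicit count over pairs with w ≠ z, in which the constraint at each w limits what the
-- excluded pairs can cost. The argument is circular at first sight: the rate of e is defined by
-- P(e), and P(e) is bounded through the rates of earlier edges. So the process is defined for every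
-- list, with a default where P(e) might be too small, and P(e) ≥ γ is then proved by induction on
-- the list (`Valid`, `admissible`). The independent choices are never built as a probability space.
-- Only their product probabilities `κ` and `ψ` occur, compared with the actual process by induction
-- along the list. Masses below 1 are no worse than full ones: each missing unit raises 1 - γ a - γ
-- b by γ and lowers the bound on the last term by 2θ², which is at most γ.

-- Integer coefficients for the ring solver.

module IntegerCoefficients {c ℓ₁ ℓ₂} (ℝ : RealNumbers c ℓ₁ ℓ₂) where
  open RealNumbers ℝ

  open RingProperties ring using (-0#≈0#; -‿distribˡ-*; -‿distribʳ-*; -‿involutive)
  open AbelianGroupProperties +-abelianGroup using (⁻¹-∙-comm)
  open MonoidMult +-monoid using (×-homo-+)
  open SemiringMult semiring using (×1-homo-*)

  -- Agrees with n · 1#, except that 1 is sent to 1# itself and not to 1# + 0#.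
  fromℕ : ℕ → Carrier
  fromℕ 0               = 0#
  fromℕ 1               = 1#
  fromℕ n@(suc (suc _)) = n · 1#

  fromℤ : ℤ → Carrier
  fromℤ (+ n)    = fromℕ n
  fromℤ -[1+ n ] = - fromℕ (suc n)

  fromℕ≈·1 : ∀ n → fromℕ n ≈ n · 1#
  fromℕ≈·1 0             = refl
  fromℕ≈·1 1             = sym (+-identityʳ 1#)
  fromℕ≈·1 (suc (suc n)) = refl

  2# : Carrier
  2# = 2 · 1#

  open SetoidReasoning setoid

  private
    fromℕ-+ : ∀ m n → fromℕ (m ℕ.+ n) ≈ fromℕ m + fromℕ n
    fromℕ-+ m n = begin
      fromℕ (m ℕ.+ n)     ≈⟨ fromℕ≈·1 (m ℕ.+ n) ⟩
      (m ℕ.+ n) · 1#      ≈⟨ ×-homo-+ 1# m n ⟩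
      m · 1# + n · 1#     ≈⟨ +-cong (fromℕ≈·1 m) (fromℕ≈·1 n) ⟨
      fromℕ m + fromℕ n   ∎

    fromℕ-* : ∀ m n → fromℕ (m ℕ.* n) ≈ fromℕ m * fromℕ n
    fromℕ-* m n = begin
      fromℕ (m ℕ.* n)     ≈⟨ fromℕ≈·1 (m ℕ.* n) ⟩
      (m ℕ.* n) · 1#      ≈⟨ ×1-homo-* m n ⟩
      m · 1# * n · 1#     ≈⟨ *-cong (fromℕ≈·1 m) (fromℕ≈·1 n) ⟨
      fromℕ m * fromℕ n   ∎

    a+x-[a+y]≈x-y : ∀ a x y → (a + x) + - (a + y) ≈ x + - y
    a+x-[a+y]≈x-y a x y = begin
      (a + x) + - (a + y)       ≈⟨ +-congˡ (⁻¹-∙-comm a y) ⟨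
      (a + x) + (- a + - y)     ≈⟨ +-assoc (a + x) (- a) (- y) ⟨
      ((a + x) + - a) + - y     ≈⟨ +-congʳ (+-assoc a x (- a)) ⟩
      (a + (x + - a)) + - y     ≈⟨ +-congʳ (+-congˡ (+-comm x (- a))) ⟩
      (a + (- a + x)) + - y     ≈⟨ +-congʳ (+-assoc a (- a) x) ⟨
      ((a + - a) + x) + - y     ≈⟨ +-congʳ (+-congʳ (-‿inverseʳ a)) ⟩
      (0# + x) + - y            ≈⟨ +-congʳ (+-identityˡ x) ⟩
      x + - y                   ∎

    fromℤ-⊖ : ∀ m n → fromℤ (m ⊖ n) ≈ fromℕ m + - fromℕ n
    fromℤ-⊖ zero    zero    = sym (-‿inverseʳ 0#)
    fromℤ-⊖ zero    (suc n) = sym (+-identityˡ _)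
    fromℤ-⊖ (suc m) zero    = sym (trans (+-congˡ -0#≈0#) (+-identityʳ _))
    fromℤ-⊖ (suc m) (suc n) = begin
      fromℤ (suc m ⊖ suc n)                     ≡⟨ ≡.cong fromℤ (ℤₚ.[1+m]⊖[1+n]≡m⊖n m n) ⟩
      fromℤ (m ⊖ n)                             ≈⟨ fromℤ-⊖ m n ⟩
      fromℕ m + - fromℕ n                       ≈⟨ a+x-[a+y]≈x-y 1# (fromℕ m) (fromℕ n) ⟨
      (1# + fromℕ m) + - (1# + fromℕ n)         ≈⟨ +-cong (fromℕ-+ 1 m) (-‿cong (fromℕ-+ 1 n)) ⟨
      fromℕ (suc m) + - fromℕ (suc n)           ∎

    fromℤ-neg : ∀ i → fromℤ (ℤ.- i) ≈ - fromℤ i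
    fromℤ-neg (+ zero)  = sym -0#≈0#
    fromℤ-neg (+ suc n) = refl
    fromℤ-neg -[1+ n ]  = sym (-‿involutive _)

    fromℤ-+ : ∀ i j → fromℤ (i ℤ.+ j) ≈ fromℤ i + fromℤ j
    fromℤ-+ (+ m)    (+ n)    = fromℕ-+ m n
    fromℤ-+ (+ m)    -[1+ n ] = fromℤ-⊖ m (suc n)
    fromℤ-+ -[1+ m ] (+ n)    = trans (fromℤ-⊖ n (suc m)) (+-comm _ _)
    fromℤ-+ -[1+ m ] -[1+ n ] = begin
      - fromℕ (suc (suc (m ℕ.+ n)))         ≡⟨ ≡.cong (λ k → - fromℕ k) (ℕₚ.+-suc (suc m) n) ⟨
      - fromℕ (suc m ℕ.+ suc n)             ≈⟨ -‿cong (fromℕ-+ (suc m) (suc n)) ⟩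
      - (fromℕ (suc m) + fromℕ (suc n))     ≈⟨ ⁻¹-∙-comm _ _ ⟨
      - fromℕ (suc m) + - fromℕ (suc n)     ∎

    fromℤ-pos-* : ∀ m j → fromℤ (+ m ℤ.* j) ≈ fromℕ m * fromℤ j
    fromℤ-pos-* m (+ n) = begin
      fromℤ (+ m ℤ.* + n)     ≡⟨ ≡.cong fromℤ (ℤₚ.pos-* m n) ⟨
      fromℕ (m ℕ.* n)         ≈⟨ fromℕ-* m n ⟩
      fromℕ m * fromℕ n       ∎
    fromℤ-pos-* m -[1+ n ] = begin
      fromℤ (+ m ℤ.* (ℤ.- (+ suc n)))   ≡⟨ ≡.cong fromℤ (ℤₚ.neg-distribʳ-* (+ m) (+ suc n)) ⟨
      fromℤ (ℤ.- (+ m ℤ.* + suc n))     ≈⟨ fromℤ-neg (+ m ℤ.* + suc n) ⟩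
      - fromℤ (+ m ℤ.* + suc n)         ≈⟨ -‿cong (fromℤ-pos-* m (+ suc n)) ⟩
      - (fromℕ m * fromℕ (suc n))       ≈⟨ -‿distribʳ-* _ _ ⟩
      fromℕ m * - fromℕ (suc n)         ∎

    fromℤ-* : ∀ i j → fromℤ (i ℤ.* j) ≈ fromℤ i * fromℤ j
    fromℤ-* (+ m)    j = fromℤ-pos-* m j
    fromℤ-* -[1+ m ] j = begin
      fromℤ (ℤ.- (+ suc m) ℤ.* j)     ≡⟨ ≡.cong fromℤ (ℤₚ.neg-distribˡ-* (+ suc m) j) ⟨
      fromℤ (ℤ.- (+ suc m ℤ.* j))     ≈⟨ fromℤ-neg (+ suc m ℤ.* j) ⟩
      - fromℤ (+ suc m ℤ.* j)         ≈⟨ -‿cong (fromℤ-pos-* (suc m) j) ⟩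
      - (fromℕ (suc m) * fromℤ j)     ≈⟨ -‿distribˡ-* _ _ ⟩
      - fromℕ (suc m) * fromℤ j       ∎

    -- The carrier has no decidable equality, so the solver compares coefficients in ℤ, where large
    -- numerals are also evaluated by built-in arithmetic. The special case in `fromℕ` makes the
    -- coefficient 1 denote the `1#` that occurs in goals.
    fromℤ-morphism : ℤ.+-*-rawRing -Raw-AlmostCommutative⟶ fromCommutativeRing commutativeRing
    fromℤ-morphism = record
      { ⟦_⟧    = fromℤ
      ; +-homo = fromℤ-+
      ; *-homo = fromℤ-*
      ; -‿homo = fromℤ-neg
      ; 0-homo = refl
      ; 1-homo = refl
      }

  module Solver = RingSolver ℤ.+-*-rawRing (fromCommutativeRing commutativeRing) fromℤ-morphism
    (λ i j → Maybe.map (λ i≡j → reflexive (≡.cong fromℤ i≡j)) (dec⇒maybe (i ℤ.≟ j)))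
  open Solver using (con; Polynomial)

  one : ∀ {n} → Polynomial n
  one = con (+ 1)

  two : ∀ {n} → Polynomial n
  two = con (+ 2)

-- Order arithmetic in a constructive ordered field.

module OrderedField {c ℓ₁ ℓ₂} (ℝ : RealNumbers c ℓ₁ ℓ₂) where
  open RealNumbers ℝ
  open IntegerCoefficients ℝ
  open Solver using (solve; _:+_; _:*_; _:-_; :-_; _:=_; con)

  <⇒≤ : ∀ {x y} → x < y → x ≤ y
  <⇒≤ x<y y<x = <-irrefl refl (<-trans x<y y<x)

  ≤-reflexive : ∀ {x y} → x ≈ y → x ≤ y
  ≤-reflexive x≈y = <-irrefl (sym x≈y)

  ≤-refl : ∀ {x} → x ≤ x
  ≤-refl = ≤-reflexive refl

  <-≤-trans : ∀ {x y z} → x < y → y ≤ z → x < z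
  <-≤-trans {z = z} x<y y≤z with <-cotrans x<y z
  ... | inj₁ x<z = x<z
  ... | inj₂ z<y = ⊥-elim (y≤z z<y)

  ≤-<-trans : ∀ {x y z} → x ≤ y → y < z → x < z
  ≤-<-trans {x} x≤y y<z with <-cotrans y<z x
  ... | inj₁ y<x = ⊥-elim (x≤y y<x)
  ... | inj₂ x<z = x<z

  ≤-trans : ∀ {x y z} → x ≤ y → y ≤ z → x ≤ z
  ≤-trans x≤y y≤z z<x = x≤y (≤-<-trans y≤z z<x)

  ≤-antisym : ∀ {x y} → x ≤ y → y ≤ x → x ≈ y
  ≤-antisym x≤y y≤x = <-tight y≤x x≤y

  ≤-poset : Poset _ _ _
  ≤-poset = record
    { isPartialOrder = record
      { isPreorder = record
        { isEquivalence = isEquivalence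
        ; reflexive     = ≤-reflexive
        ; trans         = ≤-trans
        }
      ; antisym = ≤-antisym
      }
    }

  module ≤-Reasoning = PosetReasoning ≤-poset
  open ≤-Reasoning

  +-monoˡ-≤ : ∀ {x y} z → x ≤ y → x + z ≤ y + z
  +-monoˡ-≤ {x} {y} z x≤y y+z<x+z = x≤y
    (<-respˡ-≈ (cancel y z) (<-respʳ-≈ (cancel x z) (+-monoˡ-< (- z) y+z<x+z)))
    where
    cancel : ∀ a b → a + b + - b ≈ a
    cancel = solve 2 (λ a b → a :+ b :+ :- b := a) refl

  +-mono-≤ : ∀ {x y u v} → x ≤ y → u ≤ v → x + u ≤ y + v
  +-mono-≤ {x} {y} {u} {v} x≤y u≤v = begin
    x + u   ≤⟨ +-monoˡ-≤ u x≤y ⟩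
    y + u   ≈⟨ +-comm y u ⟩
    u + y   ≤⟨ +-monoˡ-≤ y u≤v ⟩
    v + y   ≈⟨ +-comm v y ⟩
    y + v   ∎

  +-nonneg : ∀ {x y} → 0# ≤ x → 0# ≤ y → 0# ≤ x + y
  +-nonneg 0≤x 0≤y = ≤-trans (≤-reflexive (sym (+-identityˡ 0#))) (+-mono-≤ 0≤x 0≤y)

  ≤-by : ∀ {x y d} → 0# ≤ d → y ≈ x + d → x ≤ y
  ≤-by {x} {y} {d} 0≤d y≈x+d = begin
    x        ≈⟨ +-identityʳ x ⟨
    x + 0#   ≤⟨ +-mono-≤ ≤-refl 0≤d ⟩
    x + d    ≈⟨ y≈x+d ⟨
    y        ∎

  0≤y-x : ∀ {x y} → x ≤ y → 0# ≤ y - x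
  0≤y-x {x} {y} x≤y = begin
    0#      ≈⟨ -‿inverseʳ x ⟨
    x - x   ≤⟨ +-monoˡ-≤ (- x) x≤y ⟩
    y - x   ∎

  -- As _≤_ is a negation, its proofs may split on the sign of a real.
  *-nonneg : ∀ {x y} → 0# ≤ x → 0# ≤ y → 0# ≤ x * y
  *-nonneg {x} {y} 0≤x 0≤y xy<0 = ¬0<x λ 0<x → ¬0<y 0<x λ 0<y →
    <-irrefl refl (<-trans (*-pos 0<x 0<y) xy<0)
    where
    ¬0<y : 0# < x → ¬ ¬ (0# < y)
    ¬0<y _ y≤0 = <-irrefl (trans (*-congˡ (≤-antisym y≤0 0≤y)) (zeroʳ x)) xy<0
    ¬0<x : ¬ ¬ (0# < x)
    ¬0<x x≤0 = <-irrefl (trans (*-congʳ (≤-antisym x≤0 0≤x)) (zeroˡ y)) xy<0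

  0≤x² : ∀ x → 0# ≤ x * x
  0≤x² x x²<0 = x≤0 (λ x<0 → *-nonneg (0≤-x x<0) (0≤-x x<0) (<-respˡ-≈ -x²≈ x²<0))
    where
    0≤-x : x < 0# → 0# ≤ - x
    0≤-x x<0 = ≤-trans (0≤y-x (<⇒≤ x<0)) (≤-reflexive (+-identityˡ (- x)))
    -x²≈ : x * x ≈ - x * - x
    -x²≈ = solve 1 (λ a → a :* a := :- a :* :- a) refl x
    x≤0 : ¬ (0# ≤ x)
    x≤0 0≤x = *-nonneg 0≤x 0≤x x²<0

  *-monoˡ-≤ : ∀ {x y z} → 0# ≤ z → x ≤ y → x * z ≤ y * z
  *-monoˡ-≤ {x} {y} {z} 0≤z x≤y = ≤-by (*-nonneg (0≤y-x x≤y) 0≤z)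
    (solve 3 (λ x y z → y :* z := x :* z :+ (y :- x) :* z) refl x y z)

  *-monoʳ-≤ : ∀ {x y z} → 0# ≤ z → x ≤ y → z * x ≤ z * y
  *-monoʳ-≤ {x} {y} {z} 0≤z x≤y = ≤-by (*-nonneg 0≤z (0≤y-x x≤y))
    (solve 3 (λ x y z → z :* y := z :* x :+ z :* (y :- x)) refl x y z)

  *-mono-≤ : ∀ {x y u v} → 0# ≤ u → 0# ≤ y → x ≤ y → u ≤ v → x * u ≤ y * v
  *-mono-≤ 0≤u 0≤y x≤y u≤v = ≤-trans (*-monoˡ-≤ 0≤u x≤y) (*-monoʳ-≤ 0≤y u≤v)

  *-cancelʳ-nonneg : ∀ {x z} → 0# < z → 0# ≤ x * z → 0# ≤ x
  *-cancelʳ-nonneg {x} {z} 0<z 0≤xz x<0 = 0≤xz (<-respʳ-≈ (zeroˡ z)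
    (<-respˡ-≈ xz≈ (+-cancel (*-pos 0<-x 0<z))))
    where
    0<-x : 0# < - x
    0<-x = <-respˡ-≈ (-‿inverseʳ x) (<-respʳ-≈ (+-identityˡ (- x)) (+-monoˡ-< (- x) x<0))
    xz≈ : 0# + x * z ≈ x * z
    xz≈ = +-identityˡ (x * z)
    +-cancel : 0# < - x * z → 0# + x * z < 0# * z
    +-cancel 0<-xz = <-respʳ-≈
      (solve 2 (λ x z → :- x :* z :+ x :* z := con (+ 0) :* z) refl x z)
      (+-monoˡ-< (x * z) 0<-xz)

  *-cancelʳ-≤ : ∀ {x y z} → 0# < z → x * z ≤ y * z → x ≤ y
  *-cancelʳ-≤ {x} {y} {z} 0<z xz≤yz = ≤-by
    (*-cancelʳ-nonneg 0<z (≤-trans (0≤y-x xz≤yz)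
      (≤-reflexive (solve 3 (λ x y z → y :* z :- x :* z := (y :- x) :* z) refl x y z))))
    (solve 2 (λ x y → y := x :+ (y :- x)) refl x y)

  0≤1 : 0# ≤ 1#
  0≤1 = <⇒≤ 0<1

  0≤fromℕ : ∀ n → 0# ≤ n · 1#
  0≤fromℕ zero    = ≤-refl
  0≤fromℕ (suc n) = <⇒≤ (0<suc n)

-- Numerical facts about γ = 0.337.

module Constants {c ℓ₁ ℓ₂} (ℝ : RealNumbers c ℓ₁ ℓ₂) where
  open RealNumbers ℝ
  open IntegerCoefficients ℝ
  open OrderedField ℝ
  open Solver using (solve; _:+_; _:*_; _:-_; _:=_; con)
  open MonoidMult +-monoid using (×-congʳ)
  open SemiringMult semiring using (×-comm-*)
  open ≤-Reasoning

  private
    ι : ℕ → Carrier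
    ι n = fromℤ (+ n)

    0<ι : ∀ n → 0# < ι (suc n)
    0<ι n = <-respʳ-≈ (sym (fromℕ≈·1 (suc n))) (0<suc n)

    0≤ι : ∀ n → 0# ≤ ι n
    0≤ι n = ≤-trans (0≤fromℕ n) (≤-reflexive (sym (fromℕ≈·1 n)))

    -- Without trichotomy the sign of `x` is found by cotransitivity: comparing `x` with 0 < x + n x
    -- leaves either 0 < x or 0 < n x.
    0<n·x⇒0<x : ∀ n {x} → 0# < n · x → 0# < x
    0<n·x⇒0<x zero    0<0 = ⊥-elim (<-irrefl refl 0<0)
    0<n·x⇒0<x (suc n) {x} 0<x+nx with <-cotrans 0<x+nx x
    ... | inj₁ 0<x    = 0<x
    ... | inj₂ x<x+nx = 0<n·x⇒0<x n (<-respˡ-≈ (-‿inverseʳ x)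
      (<-respʳ-≈ (solve 2 (λ x y → x :+ y :- x := y) refl x (n · x)) (+-monoˡ-< (- x) x<x+nx)))

  abstract
    -- Abstract, so that the fraction never unfolds during type checking and the solver sees an
    -- atom; `γ≡0·337` is the only way back to the numeral.
    γ : Carrier
    γ = 0·337

    γ≡0·337 : γ ≡ 0·337
    γ≡0·337 = ≡.refl

  -- γ (1 - 2γ)(1 - γ³), about 0.10566; its square just exceeds 3γ - 1 = 0.011.
  θ : Carrier
  θ = γ * (1# - 2# * γ) * (1# - γ * γ * γ)

  private
    γ·1000 : γ * ι 1000 ≈ ι 337
    γ·1000 = trans (*-congʳ (reflexive γ≡0·337)) (trans
      (solve 3 (λ a r b → a :* r :* b := a :* (b :* r)) refl _ _ _)
      (trans (*-congˡ (*-recipʳ (1000 · 1#) (0<suc 999))) (*-identityʳ _)))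

    -- Multiplication by a power of ten turns a claim about `γ` into an identity between integers,
    -- by `γ·1000` and the solver; `n` is the slack that remains. The scale is passed as its
    -- predecessor, hence 999 for 1000.
    scaled : ∀ {x} k n → x * ι (suc k) ≈ ι n → 0# ≤ x
    scaled k n eq = *-cancelʳ-nonneg (0<ι k) (≤-trans (0≤ι n) (≤-reflexive (sym eq)))

    difference : ∀ {x y} → 0# ≤ y - x → x ≤ y
    difference {x} {y} 0≤y-x = ≤-by 0≤y-x (solve 2 (λ x y → y := x :+ (y :- x)) refl x y)

    θ·10¹⁵ : θ * ι 1000000000000000 ≈ ι 105657278809914
    θ·10¹⁵ = trans
      (solve 1 (λ g → g :* (one :- two :* g) :* (one :- g :* g :* g) :* con (+ 1000000000000000)
         := g :* con (+ 1000) :* (con (+ 1000) :- two :* (g :* con (+ 1000)))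
            :* (con (+ 1000000000) :- g :* con (+ 1000) :* (g :* con (+ 1000)) :* (g :* con (+ 1000)))) refl γ)
      (trans (*-cong (*-cong γ·1000 (+-congˡ (-‿cong (*-congˡ γ·1000))))
                     (+-congˡ (-‿cong (*-cong (*-cong γ·1000 γ·1000) γ·1000))))
        (solve 0 (con (+ 337) :* (con (+ 1000) :- two :* con (+ 337))
            :* (con (+ 1000000000) :- con (+ 337) :* con (+ 337) :* con (+ 337)) := con (+ 105657278809914)) refl))

  abstract
    0<γ : 0# < γ
    0<γ = 0<n·x⇒0<x 1000 (<-respʳ-≈ (sym 1000γ) (0<ι 336))
      where
      1000γ : 1000 · γ ≈ ι 337
      1000γ = trans (×-congʳ 1000 (sym (*-identityʳ γ)))
        (trans (sym (×-comm-* 1000 γ 1#)) γ·1000)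

    0≤γ : 0# ≤ γ
    0≤γ = <⇒≤ 0<γ

    -- For `κ-part-lower`: the relative slope γ / (1 - γ) of 1 / (1 - γ - γ s) at s = 0 reaches the
    -- 1/2 in the factor 1 + s/2 exactly when γ ≥ 1/3.
    1≤3γ : 1# ≤ (1# + 2#) * γ
    1≤3γ = difference (scaled 999 11 (trans
      (solve 1 (λ g → ((one :+ two) :* g :- one) :* con (+ 1000) := (one :+ two) :* (g :* con (+ 1000)) :- con (+ 1000)) refl γ)
      (trans (+-congʳ (*-congˡ γ·1000))
        (solve 0 ((one :+ two) :* con (+ 337) :- con (+ 1000) := con (+ 11)) refl))))

    -- This is (1 - γ)³ ≤ 1 - 2γ divided by γ, the case m = 1 of `affine-bound`.
    γ[3-γ]≤1 : γ * (1# + 2# - γ) ≤ 1#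
    γ[3-γ]≤1 = difference (scaled 999999 102569 (trans
      (solve 1 (λ g → (one :- g :* (one :+ two :- g)) :* con (+ 1000000)
         := con (+ 1000000) :- g :* con (+ 1000) :* (con (+ 3000) :- g :* con (+ 1000))) refl γ)
      (trans (+-congˡ (-‿cong (*-cong γ·1000 (+-congˡ (-‿cong γ·1000)))))
        (solve 0 (con (+ 1000000) :- con (+ 337) :* (con (+ 3000) :- con (+ 337)) := con (+ 102569)) refl))))

    -- `scaled` yields weak inequalities only, so strictness is borrowed from `0<γ`. As 3γ > 1, a
    -- single copy of 1 - 2γ lies below γ; two copies exceed it.
    0<1-2γ : 0# < 1# - 2# * γ
    0<1-2γ = 0<n·x⇒0<x 2 (<-≤-trans 0<γ (difference (scaled 999 315 (trans
      (solve 1 (λ g → (one :- two :* g :+ (one :- two :* g :+ con (+ 0)) :- g) :* con (+ 1000)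
         := con (+ 2000) :- con (+ 5) :* (g :* con (+ 1000))) refl γ)
      (trans (+-congˡ (-‿cong (*-congˡ γ·1000)))
        (solve 0 (con (+ 2000) :- con (+ 5) :* con (+ 337) := con (+ 315)) refl))))))

    -- The numerical fact that limits `γ`: the slack is about 0.00016, and with 0.338 in place of
    -- 0.337 the inequality fails.
    3γ-1≤θ² : (1# + 2#) * γ - 1# ≤ θ * θ
    3γ-1≤θ² = difference (scaled 999999999999999999999999999999 163460565515901964144687396 (trans
      (solve 2 (λ t g → (t :* t :- ((one :+ two) :* g :- one)) :* con (+ 1000000000000000000000000000000)
         := t :* con (+ 1000000000000000) :* (t :* con (+ 1000000000000000))
            :- con (+ 1000000000000000000000000000) :* ((one :+ two) :* (g :* con (+ 1000)) :- con (+ 1000))) refl θ γ)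
      (trans (+-cong (*-cong θ·10¹⁵ θ·10¹⁵) (-‿cong (*-congˡ (+-congʳ (*-congˡ γ·1000)))))
        (solve 0 (con (+ 105657278809914) :* con (+ 105657278809914) :- con (+ 1000000000000000000000000000) :* ((one :+ two) :* con (+ 337) :- con (+ 1000))
           := con (+ 163460565515901964144687396)) refl))))

    -- The exchange rate for missing mass at an endpoint: a unit gains `γ` in the linear terms of
    -- P(e) and costs 2θ² in the bound on the joint term.
    2θ²≤γ : 2# * (θ * θ) ≤ γ
    2θ²≤γ = difference (scaled 999999999999999999999999999999 314673078868968196071710625208 (trans
      (solve 2 (λ t g → (g :- two :* (t :* t)) :* con (+ 1000000000000000000000000000000)
         := con (+ 1000000000000000000000000000) :* (g :* con (+ 1000))
            :- two :* (t :* con (+ 1000000000000000) :* (t :* con (+ 1000000000000000)))) refl θ γ)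
      (trans (+-cong (*-congˡ γ·1000) (-‿cong (*-congˡ (*-cong θ·10¹⁵ θ·10¹⁵))))
        (solve 0 (con (+ 1000000000000000000000000000) :* con (+ 337) :- two :* (con (+ 105657278809914) :* con (+ 105657278809914))
           := con (+ 314673078868968196071710625208)) refl))))

-- Finite sums and indicators of decidable events.

module Indicators {c ℓ₁ ℓ₂} (ℝ : RealNumbers c ℓ₁ ℓ₂) where
  open RealNumbers ℝ
  open OrderedField ℝ
  open CommutativeMonoidSum +-commutativeMonoid using (sum-cong-≋; ∑-distrib-+; ∑-comm; sum-replicate-zero) public
  open SemiringSum semiring using (*-distribˡ-sum; *-distribʳ-sum) public

  private
    variable
      p q : Level
      P : Set p
      Q : Set q

  module _ {a} {A : Set a} {x y : A} where
    if-yes : (d : Dec P) → P → (if does d then x else y) ≡ x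
    if-yes d h rewrite dec-true d h = ≡.refl

    if-no : (d : Dec P) → ¬ P → (if does d then x else y) ≡ y
    if-no d h rewrite dec-false d h = ≡.refl

  sum-mono : ∀ {n} {f g : Fin n → Carrier} → (∀ i → f i ≤ g i) → sum f ≤ sum g
  sum-mono {zero}  f≤g = ≤-refl
  sum-mono {suc n} f≤g = +-mono-≤ (f≤g zero) (sum-mono (f≤g ∘ suc))

  sum-0 : ∀ {n} {f : Fin n → Carrier} → (∀ i → f i ≈ 0#) → sum f ≈ 0#
  sum-0 {n} f≈0 = trans (sum-cong-≋ f≈0) (sum-replicate-zero n)

  sum-nonneg : ∀ {n} {f : Fin n → Carrier} → (∀ i → 0# ≤ f i) → 0# ≤ sum f
  sum-nonneg {n} 0≤f = ≤-trans (≤-reflexive (sym (sum-0 {n} (λ _ → refl)))) (sum-mono 0≤f)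

  sum-single : ∀ {n} (f : Fin n → Carrier) k → (∀ i → i ≢ k → f i ≈ 0#) → sum f ≈ f k
  sum-single {suc n} f zero    f≈0 = trans (+-congˡ (sum-0 (λ i → f≈0 (suc i) λ ()))) (+-identityʳ _)
  sum-single {suc n} f (suc k) f≈0 = trans (+-congʳ (f≈0 zero λ ()))
    (trans (+-identityˡ _) (sum-single (f ∘ suc) k (λ i i≢k → f≈0 (suc i) λ { ≡.refl → i≢k ≡.refl })))

  𝟙 : Dec P → Carrier
  𝟙 d = if does d then 1# else 0#

  𝟙-yes : (d : Dec P) → P → 𝟙 d ≈ 1#
  𝟙-yes d h = reflexive (if-yes d h)

  𝟙-no : (d : Dec P) → ¬ P → 𝟙 d ≈ 0#
  𝟙-no d h = reflexive (if-no d h)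

  0≤𝟙 : (d : Dec P) → 0# ≤ 𝟙 d
  0≤𝟙 d with does d
  ... | true  = 0≤1
  ... | false = ≤-refl

  𝟙≤1 : (d : Dec P) → 𝟙 d ≤ 1#
  𝟙≤1 d with does d
  ... | true  = ≤-refl
  ... | false = 0≤1

  𝟙-× : (d : Dec P) (e : Dec Q) → 𝟙 (d ×-dec e) ≈ 𝟙 d * 𝟙 e
  𝟙-× d e with does d
  ... | true  = sym (*-identityˡ _)
  ... | false = sym (zeroˡ _)

  𝟙-⇔ : (d : Dec P) (e : Dec Q) → (P → Q) → (Q → P) → 𝟙 d ≈ 𝟙 e
  𝟙-⇔ (yes h) e f g = sym (𝟙-yes e (f h))
  𝟙-⇔ (no ¬h) e f g = sym (𝟙-no e (¬h ∘ g))

  ≤𝟙-by : (d : Dec P) (e : Dec Q) → (P → Q) → 𝟙 d ≤ 𝟙 e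
  ≤𝟙-by (yes h) e f = ≤-reflexive (sym (𝟙-yes e (f h)))
  ≤𝟙-by (no ¬h) e f = 0≤𝟙 e

-- Free vertices and addable edges.

module Matchings (G : SimpleGraph) where
  open SimpleGraph G

  Free : Vertex → Subset #E → Set
  Free v I = ∀ f → f ∈ I → ¬ v ∈ₑ f

  Free? : ∀ v I → Dec (Free v I)
  Free? v I = all? λ f → (f ∈? I) →-dec ¬? (v ∈ₑ? f)

  Addable : Edge → Subset #E → Set
  Addable e I = IsMatching (I ∪ ⁅ e ⁆)

  Addable? : ∀ e I → Dec (Addable e I)
  Addable? e I = isMatching? (I ∪ ⁅ e ⁆)

  ∈-∪⁅⁆⁻ : ∀ {I : Subset #E} {e f} → f ∈ I ∪ ⁅ e ⁆ → f ∈ I ⊎ f ≡ e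
  ∈-∪⁅⁆⁻ {I} {e} f∈ with x∈p∪q⁻ I ⁅ e ⁆ f∈
  ... | inj₁ f∈I = inj₁ f∈I
  ... | inj₂ f∈e = inj₂ (x∈⁅y⁆⇒x≡y e f∈e)

  e∈∪⁅e⁆ : ∀ {I : Subset #E} e → e ∈ I ∪ ⁅ e ⁆
  e∈∪⁅e⁆ e = x∈p∪q⁺ (inj₂ (x∈⁅x⁆ e))

  ∈-∪⁅⁆⁺ : ∀ {I : Subset #E} {e f} → f ∈ I → f ∈ I ∪ ⁅ e ⁆
  ∈-∪⁅⁆⁺ f∈I = x∈p∪q⁺ (inj₁ f∈I)

  ⊥-matching : IsMatching ⊥
  ⊥-matching e f v e∈⊥ = contradiction e∈⊥ ∉⊥

  free⇒addable : ∀ {I e} → IsMatching I → Free (src e) I → Free (tgt e) I → Addable e I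
  free⇒addable {I} {e} I-matching free-src free-tgt f g v f∈ g∈ v∈f v∈g
    with ∈-∪⁅⁆⁻ f∈ | ∈-∪⁅⁆⁻ g∈
  ... | inj₁ f∈I    | inj₁ g∈I    = I-matching f g v f∈I g∈I v∈f v∈g
  ... | inj₂ ≡.refl | inj₂ ≡.refl = ≡.refl
  ... | inj₂ ≡.refl | inj₁ g∈I    = contradiction v∈g (free v∈f g g∈I)
    where
    free : ∀ {v} → v ∈ₑ e → Free v I
    free (inj₁ ≡.refl) = free-src
    free (inj₂ ≡.refl) = free-tgt
  ... | inj₁ f∈I    | inj₂ ≡.refl = contradiction v∈f (free v∈g f f∈I)
    where
    free : ∀ {v} → v ∈ₑ e → Free v I
    free (inj₁ ≡.refl) = free-src
    free (inj₂ ≡.refl) = free-tgt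

  addable⇒free : ∀ {I e v} → e ∉ I → Addable e I → v ∈ₑ e → Free v I
  addable⇒free {e = e} e∉I addable v∈e f f∈I v∈f
    with addable f e _ (∈-∪⁅⁆⁺ f∈I) (e∈∪⁅e⁆ e) v∈f v∈e
  ... | ≡.refl = e∉I f∈I

  Free-∪ : ∀ {I e v} → Free v I → ¬ v ∈ₑ e → Free v (I ∪ ⁅ e ⁆)
  Free-∪ free v∉e f f∈ with ∈-∪⁅⁆⁻ f∈
  ... | inj₁ f∈I    = free f f∈I
  ... | inj₂ ≡.refl = v∉e

  -- For `v` not on `e` the value `src e` is a default; all uses either assume `v ∈ₑ e` or carry the
  -- indicator of it as a factor.
  other : Vertex → Edge → Vertex
  other v e = if does (v ≟ᶠ src e) then tgt e else src e

  other∈ : ∀ {v e} → v ∈ₑ e → other v e ∈ₑ e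
  other∈ {v} {e} v∈e with v ≟ᶠ src e
  ... | yes _ = inj₂ ≡.refl
  ... | no  _ = inj₁ ≡.refl

  ∈-other : ∀ {v e w} → v ∈ₑ e → w ∈ₑ e → w ≡ v ⊎ w ≡ other v e
  ∈-other {v} {e} v∈e w∈e with v ≟ᶠ src e | v∈e | w∈e
  ... | yes ≡.refl | _           | inj₁ ≡.refl = inj₁ ≡.refl
  ... | yes ≡.refl | _           | inj₂ ≡.refl = inj₂ ≡.refl
  ... | no v≢src   | inj₁ ≡.refl | _           = contradiction ≡.refl v≢src
  ... | no v≢src   | inj₂ ≡.refl | inj₁ ≡.refl = inj₂ ≡.refl
  ... | no v≢src   | inj₂ ≡.refl | inj₂ ≡.refl = inj₁ ≡.refl

  same-ends : ∀ {u v e f} → u ≢ v → u ∈ₑ e → v ∈ₑ e → u ∈ₑ f → v ∈ₑ f → e ≡ f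
  same-ends u≢v u∈e v∈e (inj₁ ≡.refl) (inj₁ ≡.refl) = contradiction ≡.refl u≢v
  same-ends u≢v u∈e v∈e (inj₁ ≡.refl) (inj₂ ≡.refl) = no-parallel _ _ u∈e v∈e
  same-ends u≢v u∈e v∈e (inj₂ ≡.refl) (inj₁ ≡.refl) = no-parallel _ _ v∈e u∈e
  same-ends u≢v u∈e v∈e (inj₂ ≡.refl) (inj₂ ≡.refl) = contradiction ≡.refl u≢v

-- The attenuated greedy process and the mass of the arrived edges.

module Greedy {c ℓ₁ ℓ₂} (ℝ : RealNumbers c ℓ₁ ℓ₂) (G : SimpleGraph)
  (x : SimpleGraph.Edge G → RealNumbers.Carrier ℝ) (x∈𝓕 : OCRS._∈𝓕 ℝ G x) where
  open RealNumbers ℝ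
  open IntegerCoefficients ℝ
  open OrderedField ℝ
  open Constants ℝ
  open Indicators ℝ
  open SimpleGraph G
  open Matchings G
  open Solver using (solve; _:+_; _:*_; _:-_; :-_; _:=_)
  open ≤-Reasoning

  0≤x : ∀ e → 0# ≤ x e
  0≤x = proj₁ x∈𝓕

  -- γ / p whenever γ ≤ p; the other branch is a junk value.
  γ/ : Carrier → Carrier
  γ/ p with <-cotrans 0<γ p
  ... | inj₁ 0<p = γ * recip p 0<p
  ... | inj₂ _   = 0#

  γ/p*p : ∀ {p} → γ ≤ p → γ/ p * p ≈ γ
  γ/p*p {p} γ≤p with <-cotrans 0<γ p
  ... | inj₁ 0<p = trans (solve 3 (λ g r p → g :* r :* p := g :* (p :* r)) refl γ (recip p 0<p) p)
                     (trans (*-congˡ (*-recipʳ p 0<p)) (*-identityʳ γ))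
  ... | inj₂ p<γ = contradiction p<γ γ≤p

  0≤γ/p : ∀ {p} → γ ≤ p → 0# ≤ γ/ p
  0≤γ/p γ≤p = *-cancelʳ-nonneg (<-≤-trans 0<γ γ≤p) (≤-trans 0≤γ (≤-reflexive (sym (γ/p*p γ≤p))))

  γ/p≤1 : ∀ {p} → γ ≤ p → γ/ p ≤ 1#
  γ/p≤1 {p} γ≤p = *-cancelʳ-≤ (<-≤-trans 0<γ γ≤p) (begin
    γ/ p * p   ≈⟨ γ/p*p γ≤p ⟩
    γ          ≤⟨ γ≤p ⟩
    p          ≈⟨ *-identityˡ p ⟨
    1# * p     ∎)

  State : Set
  State = Subset #E

  mix : Carrier → Bool → Carrier → Carrier → Carrier
  mix y b s r = if b then y * s + (1# - y) * r else r

  mix-cong : ∀ {y z} b {s s′ r r′} → y ≈ z → s ≈ s′ → r ≈ r′ → mix y b s r ≈ mix z b s′ r′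
  mix-cong true  y≈z s≈s′ r≈r′ = +-cong (*-cong y≈z s≈s′) (*-cong (+-congˡ (-‿cong y≈z)) r≈r′)
  mix-cong false y≈z s≈s′ r≈r′ = r≈r′

  mix-+ : ∀ y b s r s′ r′ → mix y b (s + s′) (r + r′) ≈ mix y b s r + mix y b s′ r′
  mix-+ y true  = solve 5 (λ y s r s′ r′ → y :* (s :+ s′) :+ (one :- y) :* (r :+ r′)
    := (y :* s :+ (one :- y) :* r) :+ (y :* s′ :+ (one :- y) :* r′)) refl y
  mix-+ y false s r s′ r′ = refl

  mix-* : ∀ y b k s r → mix y b (k * s) (k * r) ≈ k * mix y b s r
  mix-* y true  = solve 4 (λ y k s r → y :* (k :* s) :+ (one :- y) :* (k :* r)
    := k :* (y :* s :+ (one :- y) :* r)) refl y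
  mix-* y false k s r = refl

  mix-const : ∀ y b k → mix y b k k ≈ k
  mix-const y true  = solve 2 (λ y k → y :* k :+ (one :- y) :* k := k) refl y
  mix-const y false k = refl

  mix-mono : ∀ {y} b {s s′ r r′} → 0# ≤ y → y ≤ 1# → (b ≡ true → s ≤ s′) → r ≤ r′ → mix y b s r ≤ mix y b s′ r′
  mix-mono true  0≤y y≤1 s≤s′ r≤r′ = +-mono-≤ (*-monoʳ-≤ 0≤y (s≤s′ ≡.refl)) (*-monoʳ-≤ (0≤y-x y≤1) r≤r′)
  mix-mono false 0≤y y≤1 s≤s′ r≤r′ = r≤r′

  step : Carrier → Edge → (State → Carrier) → State → Carrier
  step y e F I = mix y (does (Addable? e I)) (F (I ∪ ⁅ e ⁆)) (F I)

  -- 𝔼 l F is the expectation of F at the matching reached once the edges of l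
  -- (latest first) have arrived, when an edge that can be added is both active
  -- and accepted with the probability given by rate.
  𝔼 : List Edge → (State → Carrier) → Carrier
  attenuation rate : List Edge → Edge → Carrier

  𝔼 []      F = F ⊥
  𝔼 (e ∷ l) F = 𝔼 l (step (rate l e) e F)

  attenuation l e = γ/ (𝔼 l (λ I → 𝟙 (Addable? e I)))
  rate l e = x e * attenuation l e

  ℙ : ∀ {p} → List Edge → {P : State → Set p} → (∀ I → Dec (P I)) → Carrier
  ℙ l P? = 𝔼 l (λ I → 𝟙 (P? I))

  if-cases : ∀ {p r} {P : Set p} {A : Set c} (R : A → Set r) {a b : A} (d : Dec P) →
    (P → R a) → (¬ P → R b) → R (if does d then a else b)
  if-cases R (yes h) f g = f h
  if-cases R (no ¬h) f g = g ¬h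

  𝔼-cong : ∀ l {F H} → (∀ I → F I ≈ H I) → 𝔼 l F ≈ 𝔼 l H
  𝔼-cong []      F≈H = F≈H ⊥
  𝔼-cong (e ∷ l) F≈H = 𝔼-cong l (λ I → mix-cong (does (Addable? e I)) refl (F≈H (I ∪ ⁅ e ⁆)) (F≈H I))

  𝔼-+ : ∀ l F H → 𝔼 l (λ I → F I + H I) ≈ 𝔼 l F + 𝔼 l H
  𝔼-+ []      F H = refl
  𝔼-+ (e ∷ l) F H = trans
    (𝔼-cong l (λ I → mix-+ (rate l e) (does (Addable? e I)) (F (I ∪ ⁅ e ⁆)) (F I) (H (I ∪ ⁅ e ⁆)) (H I)))
    (𝔼-+ l (step (rate l e) e F) (step (rate l e) e H))

  𝔼-* : ∀ l k F → 𝔼 l (λ I → k * F I) ≈ k * 𝔼 l F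
  𝔼-* []      k F = refl
  𝔼-* (e ∷ l) k F = trans
    (𝔼-cong l (λ I → mix-* (rate l e) (does (Addable? e I)) k (F (I ∪ ⁅ e ⁆)) (F I)))
    (𝔼-* l k (step (rate l e) e F))

  𝔼-const : ∀ l k → 𝔼 l (λ _ → k) ≈ k
  𝔼-const []      k = refl
  𝔼-const (e ∷ l) k = trans
    (𝔼-cong l (λ I → mix-const (rate l e) (does (Addable? e I)) k))
    (𝔼-const l k)

  𝔼-sum : ∀ l {n} (F : Fin n → State → Carrier) → 𝔼 l (λ I → sum (λ i → F i I)) ≈ sum (λ i → 𝔼 l (F i))
  𝔼-sum l {zero}  F = 𝔼-const l 0#
  𝔼-sum l {suc n} F = trans (𝔼-+ l _ _) (+-congˡ (𝔼-sum l (F ∘ suc)))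

  -- `attenuation` is defined before its denominator is known to be at least `γ`. These two
  -- conditions make it a probability with the intended value; `admissible` establishes them
  -- inductively.
  record Admissible (e : Edge) (l : List Edge) : Set ℓ₂ where
    field
      new : e ∉ₗ l
      γ≤ℙ : γ ≤ ℙ l (Addable? e)

  -- The orders in which the attenuation is at most 1 throughout.
  data Valid : List Edge → Set ℓ₂ where
    []  : Valid []
    _∷_ : ∀ {e l} → Admissible e l → Valid l → Valid (e ∷ l)

  Reachable : List Edge → State → Set
  Reachable l I = IsMatching I × (∀ {f} → f ∈ I → f ∈ₗ l)

  load : (Edge → Carrier) → Vertex → Carrier
  load w v = sum (λ f → 𝟙 (v ∈ₑ? f) * w f)

  _∈ₗ?_ : ∀ (e : Edge) l → Dec (e ∈ₗ l)
  _∈ₗ?_ = member? _≟ᶠ_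

  _↾_ : (Edge → Carrier) → List Edge → Edge → Carrier
  (w ↾ l) f = 𝟙 (f ∈ₗ? l) * w f

  mass : List Edge → Vertex → Carrier
  mass l = load (x ↾ l)

  ↾-nonneg : ∀ l f → 0# ≤ (x ↾ l) f
  ↾-nonneg l f = *-nonneg (0≤𝟙 (f ∈ₗ? l)) (0≤x f)

  ↾-outside : ∀ {l f} → f ∉ₗ l → (x ↾ l) f ≈ 0#
  ↾-outside {l} {f} f∉l = trans (*-congʳ (𝟙-no (f ∈ₗ? l) f∉l)) (zeroˡ (x f))

  ↾-here : ∀ {l e} → (x ↾ (e ∷ l)) e ≈ x e
  ↾-here {l} {e} = trans (*-congʳ (𝟙-yes (e ∈ₗ? (e ∷ l)) (here ≡.refl))) (*-identityˡ (x e))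

  ↾-there : ∀ {l e f} → f ≢ e → (x ↾ (e ∷ l)) f ≈ (x ↾ l) f
  ↾-there {l} {e} {f} f≢e = *-congʳ (𝟙-⇔ (f ∈ₗ? (e ∷ l)) (f ∈ₗ? l)
    (λ { (here f≡e) → contradiction f≡e f≢e ; (there f∈l) → f∈l }) there)

  weighted-∷ : ∀ (a : Edge → Carrier) {e l} → e ∉ₗ l →
    sum (λ f → a f * (x ↾ (e ∷ l)) f) ≈ sum (λ f → a f * (x ↾ l) f) + a e * x e
  weighted-∷ a {e} {l} e∉l = trans (sum-cong-≋ split) (trans (∑-distrib-+ old new)
    (+-congˡ (trans (sum-single new e new-0) new-e)))
    where
    old new : Edge → Carrier
    old f = a f * (x ↾ l) f
    new f = a f * (𝟙 (f ≟ᶠ e) * x e)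
    new-0 : ∀ f → f ≢ e → new f ≈ 0#
    new-0 f f≢e = trans (*-congˡ (trans (*-congʳ (𝟙-no (f ≟ᶠ e) f≢e)) (zeroˡ (x e)))) (zeroʳ (a f))
    new-e : new e ≈ a e * x e
    new-e = *-congˡ (trans (*-congʳ (𝟙-yes (e ≟ᶠ e) ≡.refl)) (*-identityˡ (x e)))
    cases : ∀ f → Dec (f ≡ e) → a f * (x ↾ (e ∷ l)) f ≈ old f + new f
    cases f (yes ≡.refl) = trans (*-congˡ (↾-here {l})) (sym (trans
      (+-cong (trans (*-congˡ (↾-outside {l} e∉l)) (zeroʳ (a e))) new-e) (+-identityˡ _)))
    cases f (no f≢e) = trans (*-congˡ (↾-there {l} f≢e))
      (sym (trans (+-congˡ (new-0 f f≢e)) (+-identityʳ _)))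
    split : ∀ f → a f * (x ↾ (e ∷ l)) f ≈ old f + new f
    split f = cases f (f ≟ᶠ e)

  mass-∷ : ∀ {e l} v → e ∉ₗ l → mass (e ∷ l) v ≈ mass l v + 𝟙 (v ∈ₑ? e) * x e
  mass-∷ v e∉l = weighted-∷ (λ f → 𝟙 (v ∈ₑ? f)) e∉l

  if≈𝟙* : ∀ (b : Bool) t → (if b then t else 0#) ≈ (if b then 1# else 0#) * t
  if≈𝟙* true  t = sym (*-identityˡ t)
  if≈𝟙* false t = sym (zeroˡ t)

  mass≤1 : ∀ l v → mass l v ≤ 1#
  mass≤1 l v = ≤-trans (sum-mono bound) (proj₂ x∈𝓕 v)
    where
    bound : ∀ f → 𝟙 (v ∈ₑ? f) * (x ↾ l) f ≤ (if does (v ∈ₑ? f) then x f else 0#)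
    bound f = begin
      𝟙 (v ∈ₑ? f) * (x ↾ l) f                  ≤⟨ *-monoʳ-≤ (0≤𝟙 (v ∈ₑ? f)) (≤-trans
                                                    (*-monoˡ-≤ (0≤x f) (𝟙≤1 (f ∈ₗ? l))) (≤-reflexive (*-identityˡ (x f)))) ⟩
      𝟙 (v ∈ₑ? f) * x f                        ≈⟨ if≈𝟙* (does (v ∈ₑ? f)) (x f) ⟨
      (if does (v ∈ₑ? f) then x f else 0#)     ∎

  mass-nonneg : ∀ l v → 0# ≤ mass l v
  mass-nonneg l v = sum-nonneg (λ f → *-nonneg (0≤𝟙 (v ∈ₑ? f)) (↾-nonneg l f))

  mass+x≤1 : ∀ {e l v} → e ∉ₗ l → v ∈ₑ e → mass l v + x e ≤ 1#
  mass+x≤1 {e} {l} {v} e∉l v∈e = begin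
    mass l v + x e                      ≈⟨ +-congˡ (*-identityˡ (x e)) ⟨
    mass l v + 1# * x e                 ≈⟨ +-congˡ (*-congʳ (𝟙-yes (v ∈ₑ? e) v∈e)) ⟨
    mass l v + 𝟙 (v ∈ₑ? e) * x e        ≈⟨ mass-∷ v e∉l ⟨
    mass (e ∷ l) v                      ≤⟨ mass≤1 (e ∷ l) v ⟩
    1#                                  ∎

  x≤1 : ∀ e → x e ≤ 1#
  x≤1 e = begin
    x e                    ≈⟨ +-identityˡ (x e) ⟨
    0# + x e               ≤⟨ +-monoˡ-≤ (x e) (mass-nonneg [] (src e)) ⟩
    mass [] (src e) + x e  ≤⟨ mass+x≤1 {l = []} (λ ()) (inj₁ ≡.refl) ⟩
    1#                     ∎

-- Monotone expectations and the marginal γ x_e of each edge.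

module Marginals {c ℓ₁ ℓ₂} (ℝ : RealNumbers c ℓ₁ ℓ₂) (G : SimpleGraph)
  (x : SimpleGraph.Edge G → RealNumbers.Carrier ℝ) (x∈𝓕 : OCRS._∈𝓕 ℝ G x) where
  open RealNumbers ℝ
  open IntegerCoefficients ℝ
  open OrderedField ℝ
  open Constants ℝ
  open Indicators ℝ
  open SimpleGraph G
  open Matchings G
  open Greedy ℝ G x x∈𝓕
  open Solver using (solve; _:+_; _:*_; _:-_; :-_; _:=_; con)
  open ≤-Reasoning

  does-true : ∀ {p} {P : Set p} (d : Dec P) → does d ≡ true → P
  does-true (yes h) _ = h

  module _ {e : Edge} {l : List Edge} (adm : Admissible e l) where
    open Admissible adm

    rate-nonneg : 0# ≤ rate l e
    rate-nonneg = *-nonneg (0≤x e) (0≤γ/p γ≤ℙ)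

    rate≤1 : rate l e ≤ 1#
    rate≤1 = ≤-trans (*-mono-≤ (0≤γ/p γ≤ℙ) 0≤1 (x≤1 e) (γ/p≤1 γ≤ℙ)) (≤-reflexive (*-identityˡ 1#))

    rate*ℙ : rate l e * ℙ l (Addable? e) ≈ γ * x e
    rate*ℙ = begin-equality
      x e * attenuation l e * ℙ l (Addable? e)     ≈⟨ *-assoc (x e) _ _ ⟩
      x e * (attenuation l e * ℙ l (Addable? e))   ≈⟨ *-congˡ (γ/p*p γ≤ℙ) ⟩
      x e * γ                                      ≈⟨ *-comm (x e) γ ⟩
      γ * x e                                      ∎

    rate*≤ : ∀ {t} → t ≤ ℙ l (Addable? e) → rate l e * t ≤ γ * x e
    rate*≤ t≤P = ≤-trans (*-monoʳ-≤ rate-nonneg t≤P) (≤-reflexive rate*ℙ)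

    ≤rate* : ∀ {t} → ℙ l (Addable? e) ≤ t → γ * x e ≤ rate l e * t
    ≤rate* P≤t = ≤-trans (≤-reflexive (sym rate*ℙ)) (*-monoʳ-≤ rate-nonneg P≤t)

  reach-weaken : ∀ {e l I} → Reachable l I → Reachable (e ∷ l) I
  reach-weaken (m , I⊆l) = m , there ∘ I⊆l

  reach-add : ∀ {e l I} → Reachable l I → Addable e I → Reachable (e ∷ l) (I ∪ ⁅ e ⁆)
  reach-add (_ , I⊆l) addable = addable ,
    λ f∈ → [ there ∘ I⊆l , here ]′ (∈-∪⁅⁆⁻ f∈)

  -- Validity makes all rates lie between 0 and 1, so every step is a convex combination. The
  -- comparison is asked for at reachable states only, because addability means that both endpoints
  -- are free only while the arriving edge is not yet in the state.
  𝔼-mono : ∀ {l F H} → Valid l → (∀ I → Reachable l I → F I ≤ H I) → 𝔼 l F ≤ 𝔼 l H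
  𝔼-mono [] F≤H = F≤H ⊥ (⊥-matching , λ f∈⊥ → contradiction f∈⊥ ∉⊥)
  𝔼-mono {e ∷ l} (adm ∷ v) F≤H = 𝔼-mono v λ I r →
    mix-mono (does (Addable? e I)) (rate-nonneg adm) (rate≤1 adm)
      (λ add → F≤H (I ∪ ⁅ e ⁆) (reach-add r (does-true (Addable? e I) add)))
      (F≤H I (reach-weaken r))

  𝔼-cong-reach : ∀ {l F H} → Valid l → (∀ I → Reachable l I → F I ≈ H I) → 𝔼 l F ≈ 𝔼 l H
  𝔼-cong-reach v F≈H = ≤-antisym (𝔼-mono v (λ I r → ≤-reflexive (F≈H I r)))
    (𝔼-mono v (λ I r → ≤-reflexive (sym (F≈H I r))))

  𝔼-nonneg : ∀ {l F} → Valid l → (∀ I → Reachable l I → 0# ≤ F I) → 0# ≤ 𝔼 l F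
  𝔼-nonneg {l} v 0≤F = ≤-trans (≤-reflexive (sym (𝔼-const l 0#))) (𝔼-mono v 0≤F)

  mix-decay : ∀ {y} b {s r} → 0# ≤ y → 0# ≤ s → 0# ≤ r → (1# - y) * r ≤ mix y b s r
  mix-decay {y} true  {s} {r} 0≤y 0≤s 0≤r = ≤-by (*-nonneg 0≤y 0≤s)
    (+-comm (y * s) ((1# - y) * r))
  mix-decay {y} false {s} {r} 0≤y 0≤s 0≤r = ≤-by (*-nonneg 0≤y 0≤r)
    (solve 2 (λ y r → r := (one :- y) :* r :+ y :* r) refl y r)

  mix-select : ∀ {y} b {s r} → b ≡ true → y ≤ 1# → 0# ≤ r → y * s ≤ mix y b s r
  mix-select true ≡.refl y≤1 0≤r = ≤-by (*-nonneg (0≤y-x y≤1) 0≤r) refl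

  module _ {p} {P : State → Set p} (P? : ∀ I → Dec (P I))
    {e : Edge} {l : List Edge} (v : Valid l) (adm : Admissible e l) where
    private
      y = rate l e

    ℙ-stay : (∀ I → Reachable l I → P I → Addable e I → P (I ∪ ⁅ e ⁆)) → ℙ l P? ≤ ℙ (e ∷ l) P?
    ℙ-stay stays = 𝔼-mono v λ I r → begin
      𝟙 (P? I)                                                    ≈⟨ mix-const y (does (Addable? e I)) (𝟙 (P? I)) ⟨
      mix y (does (Addable? e I)) (𝟙 (P? I)) (𝟙 (P? I))           ≤⟨ mix-mono (does (Addable? e I)) (rate-nonneg adm) (rate≤1 adm)
                                                                       (λ add → after I r (P? I) (does-true (Addable? e I) add)) ≤-refl ⟩
      step y e (λ J → 𝟙 (P? J)) I                                 ∎
      where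
      after : ∀ I → Reachable l I → (d : Dec (P I)) → Addable e I → 𝟙 d ≤ 𝟙 (P? (I ∪ ⁅ e ⁆))
      after I r d add = ≤𝟙-by d (P? (I ∪ ⁅ e ⁆)) (λ h → stays I r h add)

    -- The arriving edge is taken with probability at most its rate, and otherwise the state does
    -- not change.
    ℙ-decay : (1# - y) * ℙ l P? ≤ ℙ (e ∷ l) P?
    ℙ-decay = ≤-trans (≤-reflexive (sym (𝔼-* l (1# - y) (λ I → 𝟙 (P? I))))) (𝔼-mono v λ I r →
      mix-decay (does (Addable? e I)) (rate-nonneg adm) (0≤𝟙 (P? (I ∪ ⁅ e ⁆))) (0≤𝟙 (P? I)))

    ℙ-select : ∀ {q} {Q : State → Set q} (Q? : ∀ I → Dec (Q I)) →
      (∀ I → Reachable l I → P I → Addable e I × Q (I ∪ ⁅ e ⁆)) → y * ℙ l P? ≤ ℙ (e ∷ l) Q?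
    ℙ-select Q? selects = ≤-trans (≤-reflexive (sym (𝔼-* l y (λ I → 𝟙 (P? I))))) (𝔼-mono v λ I r → bound I r (P? I))
      where
      bound : ∀ I → Reachable l I → (d : Dec (P I)) → y * 𝟙 d ≤ step y e (λ J → 𝟙 (Q? J)) I
      bound I r (yes h) = ≤-trans
        (*-monoʳ-≤ (rate-nonneg adm) (≤-reflexive (sym (𝟙-yes (Q? (I ∪ ⁅ e ⁆)) (proj₂ (selects I r h))))))
        (mix-select (does (Addable? e I)) (dec-true (Addable? e I) (proj₁ (selects I r h))) (rate≤1 adm) (0≤𝟙 (Q? I)))
      bound I r (no _) = ≤-trans (≤-reflexive (trans (zeroʳ y) (sym (mix-const y (does (Addable? e I)) 0#))))
        (mix-mono (does (Addable? e I)) (rate-nonneg adm) (rate≤1 adm) (λ _ → 0≤𝟙 (Q? (I ∪ ⁅ e ⁆))) (0≤𝟙 (Q? I)))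

  mix-1-0 : ∀ y b → mix y b 1# 0# ≈ y * (if b then 1# else 0#)
  mix-1-0 y true  = solve 1 (λ y → y :* one :+ (one :- y) :* con (+ 0) := y :* one) refl y
  mix-1-0 y false = sym (zeroʳ y)

  -- Membership of `f` is settled when `f` arrives: there the denominator of the attenuation cancels
  -- the probability that `f` can be added, leaving γ x_f. Later arrivals do not affect it.
  ℙ-∈ : ∀ {l} → Valid l → ∀ f → ℙ l (f ∈?_) ≈ γ * (x ↾ l) f
  ℙ-∈ [] f = trans (𝟙-no (f ∈? ⊥) ∉⊥) (sym (trans (*-congˡ (↾-outside {[]} (λ ()))) (zeroʳ γ)))
  ℙ-∈ {e ∷ l} (adm ∷ v) f = cases (f ≟ᶠ e)
    where
    y = rate l e
    cases : Dec (f ≡ e) → ℙ (e ∷ l) (f ∈?_) ≈ γ * (x ↾ (e ∷ l)) f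
    cases (yes ≡.refl) = begin-equality
      ℙ (e ∷ l) (e ∈?_)                          ≈⟨ 𝔼-cong-reach v newly ⟩
      𝔼 l (λ I → y * 𝟙 (Addable? e I))           ≈⟨ 𝔼-* l y (λ I → 𝟙 (Addable? e I)) ⟩
      y * ℙ l (Addable? e)                       ≈⟨ rate*ℙ adm ⟩
      γ * x e                                    ≈⟨ *-congˡ (↾-here {l}) ⟨
      γ * (x ↾ (e ∷ l)) e                        ∎
      where
      newly : ∀ I → Reachable l I → step y e (λ J → 𝟙 (e ∈? J)) I ≈ y * 𝟙 (Addable? e I)
      newly I (_ , I⊆l) = trans
        (mix-cong (does (Addable? e I)) refl (𝟙-yes (e ∈? (I ∪ ⁅ e ⁆)) (e∈∪⁅e⁆ e)) (𝟙-no (e ∈? I) (Admissible.new adm ∘ I⊆l)))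
        (mix-1-0 y (does (Addable? e I)))
    cases (no f≢e) = begin-equality
      ℙ (e ∷ l) (f ∈?_)        ≈⟨ 𝔼-cong l unaffected ⟩
      ℙ l (f ∈?_)              ≈⟨ ℙ-∈ v f ⟩
      γ * (x ↾ l) f            ≈⟨ *-congˡ (↾-there {l} f≢e) ⟨
      γ * (x ↾ (e ∷ l)) f      ∎
      where
      unaffected : ∀ I → step y e (λ J → 𝟙 (f ∈? J)) I ≈ 𝟙 (f ∈? I)
      unaffected I = trans
        (mix-cong (does (Addable? e I)) refl (𝟙-⇔ (f ∈? (I ∪ ⁅ e ⁆)) (f ∈? I)
          (λ f∈ → [ id , (λ f≡e → contradiction f≡e f≢e) ]′ (∈-∪⁅⁆⁻ f∈)) ∈-∪⁅⁆⁺) refl)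
        (mix-const y (does (Addable? e I)) (𝟙 (f ∈? I)))

-- Inclusion-exclusion for P(e), and products over independent choices.

module Survival {c ℓ₁ ℓ₂} (ℝ : RealNumbers c ℓ₁ ℓ₂) (G : SimpleGraph)
  (x : SimpleGraph.Edge G → RealNumbers.Carrier ℝ) (x∈𝓕 : OCRS._∈𝓕 ℝ G x) where
  open RealNumbers ℝ
  open IntegerCoefficients ℝ
  open OrderedField ℝ
  open Constants ℝ
  open Indicators ℝ
  open SimpleGraph G
  open Matchings G
  open Greedy ℝ G x x∈𝓕
  open Marginals ℝ G x x∈𝓕
  open Solver using (solve; _:+_; _:*_; _:-_; :-_; _:=_; con)
  open ≤-Reasoning

  matched : Vertex → State → Carrier
  matched v I = load (λ f → 𝟙 (f ∈? I)) v

  -- A matching has at most one edge at `v`, so the count `matched` is 0 or 1. Being a sum over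
  -- edges, it makes expectations linear in the marginals.
  𝟙-free : ∀ {I} v → IsMatching I → 𝟙 (Free? v I) ≈ 1# - matched v I
  𝟙-free {I} v I-matching = cases (any? λ f → (f ∈? I) ×-dec (v ∈ₑ? f))
    where
    term : Edge → Carrier
    term f = 𝟙 (v ∈ₑ? f) * 𝟙 (f ∈? I)
    term-0 : ∀ f → ¬ (f ∈ I × v ∈ₑ f) → Dec (f ∈ I) → term f ≈ 0#
    term-0 f ¬both (yes f∈I) = trans (*-congʳ (𝟙-no (v ∈ₑ? f) (λ v∈f → ¬both (f∈I , v∈f)))) (zeroˡ (𝟙 (f ∈? I)))
    term-0 f ¬both (no f∉I)  = trans (*-congˡ (𝟙-no (f ∈? I) f∉I)) (zeroʳ (𝟙 (v ∈ₑ? f)))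
    1-_≈ : ∀ {s t} → s ≈ t → 1# - s ≈ 1# - t
    1-_≈ s≈t = +-congˡ (-‿cong s≈t)
    cases : Dec (∃ λ f → f ∈ I × v ∈ₑ f) → 𝟙 (Free? v I) ≈ 1# - matched v I
    cases (yes (f , f∈I , v∈f)) = begin-equality
      𝟙 (Free? v I)        ≈⟨ 𝟙-no (Free? v I) (λ free → free f f∈I v∈f) ⟩
      0#                   ≈⟨ -‿inverseʳ 1# ⟨
      1# - 1#              ≈⟨ 1-_≈ (trans (*-cong (𝟙-yes (v ∈ₑ? f) v∈f) (𝟙-yes (f ∈? I) f∈I)) (*-identityˡ 1#)) ⟨
      1# - term f          ≈⟨ 1-_≈ (sum-single term f (λ g g≢f → term-0 g
                                (λ (g∈I , v∈g) → g≢f (I-matching g f v g∈I f∈I v∈g v∈f)) (g ∈? I))) ⟨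
      1# - matched v I     ∎
    cases (no ¬∃) = begin-equality
      𝟙 (Free? v I)        ≈⟨ 𝟙-yes (Free? v I) (λ f f∈I v∈f → ¬∃ (f , f∈I , v∈f)) ⟩
      1#                   ≈⟨ solve 0 (one := one :- con (+ 0)) refl ⟩
      1# - 0#              ≈⟨ 1-_≈ (sum-0 (λ f → term-0 f (λ both → ¬∃ (f , both)) (f ∈? I))) ⟨
      1# - matched v I     ∎

  𝟙-addable : ∀ {e l I} → e ∉ₗ l → Reachable l I →
    𝟙 (Addable? e I) ≈ 𝟙 (Free? (src e) I) * 𝟙 (Free? (tgt e) I)
  𝟙-addable {e} {l} {I} e∉l (I-matching , I⊆l) = trans
    (𝟙-⇔ (Addable? e I) (Free? (src e) I ×-dec Free? (tgt e) I)
      (λ a → addable⇒free (e∉l ∘ I⊆l) a (inj₁ ≡.refl) , addable⇒free (e∉l ∘ I⊆l) a (inj₂ ≡.refl))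
      (λ (fs , ft) → free⇒addable I-matching fs ft))
    (𝟙-× (Free? (src e) I) (Free? (tgt e) I))

  𝔼-load : ∀ {l} → Valid l → ∀ v → 𝔼 l (matched v) ≈ γ * mass l v
  𝔼-load {l} valid v = begin-equality
    𝔼 l (matched v)                                            ≈⟨ 𝔼-sum l (λ f I → 𝟙 (v ∈ₑ? f) * 𝟙 (f ∈? I)) ⟩
    sum (λ f → 𝔼 l (λ I → 𝟙 (v ∈ₑ? f) * 𝟙 (f ∈? I)))         ≈⟨ sum-cong-≋ term ⟩
    sum (λ f → γ * (𝟙 (v ∈ₑ? f) * (x ↾ l) f))                 ≈⟨ *-distribˡ-sum γ (λ f → 𝟙 (v ∈ₑ? f) * (x ↾ l) f) ⟨
    γ * mass l v                                               ∎
    where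
    term : ∀ f → 𝔼 l (λ I → 𝟙 (v ∈ₑ? f) * 𝟙 (f ∈? I)) ≈ γ * (𝟙 (v ∈ₑ? f) * (x ↾ l) f)
    term f = trans (𝔼-* l (𝟙 (v ∈ₑ? f)) (λ I → 𝟙 (f ∈? I))) (trans (*-congˡ (ℙ-∈ valid f))
      (solve 3 (λ i g y → i :* (g :* y) := g :* (i :* y)) refl (𝟙 (v ∈ₑ? f)) γ ((x ↾ l) f)))

  both-matched : List Edge → Vertex → Vertex → Carrier
  both-matched l u v = 𝔼 l (λ I → matched u I * matched v I)

  ℙ-addable : ∀ {e l} → Valid l → e ∉ₗ l → ℙ l (Addable? e) ≈
    1# - γ * mass l (src e) - γ * mass l (tgt e) + both-matched l (src e) (tgt e)
  ℙ-addable {e} {l} valid e∉l = begin-equality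
    ℙ l (Addable? e)                                           ≈⟨ 𝔼-cong-reach valid pointwise ⟩
    𝔼 l (λ I → 1# + - 1# * A I + - 1# * B I + A I * B I)      ≈⟨ 𝔼-+ l (λ I → 1# + - 1# * A I + - 1# * B I) (λ I → A I * B I) ⟩
    𝔼 l (λ I → 1# + - 1# * A I + - 1# * B I) + J              ≈⟨ +-congʳ (𝔼-+ l (λ I → 1# + - 1# * A I) (λ I → - 1# * B I)) ⟩
    𝔼 l (λ I → 1# + - 1# * A I) + 𝔼 l (λ I → - 1# * B I) + J ≈⟨ +-congʳ (+-cong (𝔼-+ l (λ _ → 1#) (λ I → - 1# * A I)) (neg B)) ⟩
    𝔼 l (λ _ → 1#) + 𝔼 l (λ I → - 1# * A I) + - 𝔼 l B + J    ≈⟨ +-congʳ (+-congʳ (+-cong (𝔼-const l 1#) (neg A))) ⟩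
    1# - 𝔼 l A - 𝔼 l B + J                                    ≈⟨ +-congʳ (+-cong (+-congˡ (-‿cong (𝔼-load valid (src e)))) (-‿cong (𝔼-load valid (tgt e)))) ⟩
    1# - γ * mass l (src e) - γ * mass l (tgt e) + J           ∎
    where
    A B : State → Carrier
    A = matched (src e)
    B = matched (tgt e)
    J = both-matched l (src e) (tgt e)
    neg : ∀ F → 𝔼 l (λ I → - 1# * F I) ≈ - 𝔼 l F
    neg F = trans (𝔼-* l (- 1#) F) (solve 1 (λ t → :- one :* t := :- t) refl (𝔼 l F))
    pointwise : ∀ I → Reachable l I → 𝟙 (Addable? e I) ≈ 1# + - 1# * A I + - 1# * B I + A I * B I
    pointwise I r = trans (𝟙-addable e∉l r) (trans
      (*-cong (𝟙-free (src e) (proj₁ r)) (𝟙-free (tgt e) (proj₁ r)))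
      (solve 2 (λ a b → (one :- a) :* (one :- b) := one :+ :- one :* a :+ :- one :* b :+ a :* b) refl (A I) (B I)))

  matched-nonneg : ∀ v I → 0# ≤ matched v I
  matched-nonneg v I = sum-nonneg (λ f → *-nonneg (0≤𝟙 (v ∈ₑ? f)) (0≤𝟙 (f ∈? I)))

  both-matched-nonneg : ∀ {l} → Valid l → ∀ u v → 0# ≤ both-matched l u v
  both-matched-nonneg valid u v = 𝔼-nonneg valid (λ I _ → *-nonneg (matched-nonneg u I) (matched-nonneg v I))

  module _ {e : Edge} {l : List Edge} (valid : Valid l) (e∉l : e ∉ₗ l) where
    private
      union-bound : ∀ {s t} → s + x e ≤ 1# → t ≤ s → ∀ m {J} → 0# ≤ J →
        1# - γ - γ * m + γ * x e ≤ 1# - γ * m - γ * t + J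
      union-bound {s} {t} s+x≤1 t≤s m {J} 0≤J = ≤-by
        (+-nonneg (*-nonneg 0≤γ (+-nonneg (0≤y-x s+x≤1) (0≤y-x t≤s))) 0≤J)
        (solve 6 (λ g m s t X J → one :- g :* m :- g :* t :+ J
          := (one :- g :- g :* m :+ g :* X) :+ (g :* ((one :- (s :+ X)) :+ (s :- t)) :+ J)) refl γ m s t (x e) J)

    -- The joint term is nonnegative, and the endpoint of `e` other than `v` has mass at most 1 -
    -- x_e, since `e` itself has not arrived.
    ℙ-addable-lower : ∀ {v} → v ∈ₑ e → 1# - γ - γ * mass l v + γ * x e ≤ ℙ l (Addable? e)
    ℙ-addable-lower (inj₁ ≡.refl) = ≤-trans
      (union-bound (mass+x≤1 e∉l (inj₂ ≡.refl)) ≤-refl (mass l (src e)) (both-matched-nonneg valid (src e) (tgt e)))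
      (≤-reflexive (sym (ℙ-addable valid e∉l)))
    ℙ-addable-lower (inj₂ ≡.refl) = ≤-trans
      (union-bound (mass+x≤1 e∉l (inj₁ ≡.refl)) ≤-refl (mass l (tgt e)) (both-matched-nonneg valid (src e) (tgt e)))
      (≤-reflexive (trans
        (solve 4 (λ g a b J → one :- g :* b :- g :* a :+ J := one :- g :* a :- g :* b :+ J) refl
          γ (mass l (src e)) (mass l (tgt e)) (both-matched l (src e) (tgt e)))
        (sym (ℙ-addable valid e∉l))))

    ℙ-addable-upper : ∀ {v} → v ∈ₑ e → ℙ l (Addable? e) ≤ 1# - γ * mass l v
    ℙ-addable-upper {v} v∈e = begin
      ℙ l (Addable? e)                          ≤⟨ 𝔼-mono valid pointwise ⟩
      𝔼 l (λ I → 1# + - 1# * matched v I)       ≈⟨ 𝔼-+ l (λ _ → 1#) (λ I → - 1# * matched v I) ⟩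
      𝔼 l (λ _ → 1#) + 𝔼 l (λ I → - 1# * matched v I)
                                                ≈⟨ +-cong (𝔼-const l 1#) (𝔼-* l (- 1#) (matched v)) ⟩
      1# + - 1# * 𝔼 l (matched v)               ≈⟨ +-congˡ (*-congˡ (𝔼-load valid v)) ⟩
      1# + - 1# * (γ * mass l v)                ≈⟨ +-congˡ (solve 1 (λ t → :- one :* t := :- t) refl (γ * mass l v)) ⟩
      1# - γ * mass l v                         ∎
      where
      pointwise : ∀ I → Reachable l I → 𝟙 (Addable? e I) ≤ 1# + - 1# * matched v I
      pointwise I (I-matching , I⊆l) = begin
        𝟙 (Addable? e I)             ≤⟨ ≤𝟙-by (Addable? e I) (Free? v I) (λ a → addable⇒free (e∉l ∘ I⊆l) a v∈e) ⟩
        𝟙 (Free? v I)                ≈⟨ 𝟙-free v I-matching ⟩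
        1# - matched v I             ≈⟨ +-congˡ (solve 1 (λ t → :- t := :- one :* t) refl (matched v I)) ⟩
        1# + - 1# * matched v I      ∎

  factor : Carrier → Bool → Carrier
  factor y b = if b then 1# - y else 1#

  -- The probability that no edge of l satisfying C would be selected if all
  -- edges made their random choices independently.
  κ : ∀ {p} {C : Edge → Set p} → List Edge → (∀ e → Dec (C e)) → Carrier
  κ []      C? = 1#
  κ (e ∷ l) C? = factor (rate l e) (does (C? e)) * κ l C?

  factor-nonneg : ∀ {y} b → y ≤ 1# → 0# ≤ factor y b
  factor-nonneg true  y≤1 = 0≤y-x y≤1
  factor-nonneg false y≤1 = 0≤1

  factor≤1 : ∀ {y} b → 0# ≤ y → factor y b ≤ 1#
  factor≤1 {y} true  0≤y = ≤-by 0≤y (solve 1 (λ y → one := one :- y :+ y) refl y)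
  factor≤1     false 0≤y = ≤-refl

  κ-nonneg : ∀ {p} {C : Edge → Set p} (C? : ∀ e → Dec (C e)) {l} → Valid l → 0# ≤ κ l C?
  κ-nonneg C? []                = 0≤1
  κ-nonneg C? {e ∷ l} (adm ∷ v) = *-nonneg (factor-nonneg (does (C? e)) (rate≤1 adm)) (κ-nonneg C? v)

  module _ {p} {C : Edge → Set p} (C? : ∀ e → Dec (C e)) {e : Edge} {l : List Edge} where
    κ-∷-yes : C e → κ (e ∷ l) C? ≈ (1# - rate l e) * κ l C?
    κ-∷-yes h = *-congʳ (reflexive (if-yes (C? e) h))

    κ-∷-no : ¬ C e → κ (e ∷ l) C? ≈ κ l C?
    κ-∷-no h = trans (*-congʳ (reflexive (if-no (C? e) h))) (*-identityˡ (κ l C?))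

    κ-∷-≤ : Admissible e l → Valid l → κ (e ∷ l) C? ≤ κ l C?
    κ-∷-≤ adm v = ≤-trans (*-monoˡ-≤ (κ-nonneg C? v) (factor≤1 (does (C? e)) (rate-nonneg adm)))
      (≤-reflexive (*-identityˡ (κ l C?)))

  -- Each edge of `C` is paid for by a factor of `D` or of `D′`. An edge in both is paid for twice,
  -- which only lowers the left side because all factors are at most 1.
  κ-∪ : ∀ {p q r} {C : Edge → Set p} {D : Edge → Set q} {D′ : Edge → Set r}
    (C? : ∀ e → Dec (C e)) (D? : ∀ e → Dec (D e)) (D′? : ∀ e → Dec (D′ e)) → ∀ {l} → Valid l →
    (∀ e → e ∈ₗ l → C e → D e ⊎ D′ e) → κ l D? * κ l D′? ≤ κ l C?
  κ-∪ C? D? D′? [] C⊆ = ≤-reflexive (*-identityˡ 1#)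
  κ-∪ C? D? D′? {e ∷ l} (adm ∷ v) C⊆ = begin
    a * κ l D? * (b * κ l D′?)       ≈⟨ solve 4 (λ a k b k′ → a :* k :* (b :* k′) := a :* b :* (k :* k′)) refl a (κ l D?) b (κ l D′?) ⟩
    a * b * (κ l D? * κ l D′?)       ≤⟨ *-mono-≤ (*-nonneg (κ-nonneg D? v) (κ-nonneg D′? v)) (factor-nonneg (does (C? e)) (rate≤1 adm))
                                          (pointwise (C? e) (D? e) (D′? e) (C⊆ e (here ≡.refl)))
                                          (κ-∪ C? D? D′? v (λ f f∈l → C⊆ f (there f∈l))) ⟩
    factor y (does (C? e)) * κ l C?  ∎
    where
    y = rate l e
    a = factor y (does (D? e))
    b = factor y (does (D′? e))
    ab≤a : ∀ {s t} → 0# ≤ s → t ≤ 1# → s * t ≤ s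
    ab≤a {s} 0≤s t≤1 = ≤-trans (*-monoʳ-≤ 0≤s t≤1) (≤-reflexive (*-identityʳ s))
    nonneg : ∀ b → 0# ≤ factor y b
    nonneg b = factor-nonneg b (rate≤1 adm)
    ≤1 : ∀ b → factor y b ≤ 1#
    ≤1 b = factor≤1 b (rate-nonneg adm)
    pointwise : ∀ {p q r} {P : Set p} {Q : Set q} {R : Set r} (d : Dec P) (d′ : Dec Q) (d″ : Dec R) → (P → Q ⊎ R) →
      factor y (does d′) * factor y (does d″) ≤ factor y (does d)
    pointwise (no _)  d′      d″      _ = ≤-trans (ab≤a (nonneg (does d′)) (≤1 (does d″))) (≤1 (does d′))
    pointwise (yes h) (yes _) d″      _ = ab≤a (nonneg true) (≤1 (does d″))
    pointwise (yes h) (no _)  (yes _) _ = ≤-reflexive (*-identityˡ _)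
    pointwise (yes h) (no ¬q) (no ¬r) f = ⊥-elim ([ ¬q , ¬r ]′ (f h))

-- Bounds on the independent-choice probabilities at a vertex.

module SurvivalBounds {c ℓ₁ ℓ₂} (ℝ : RealNumbers c ℓ₁ ℓ₂) (G : SimpleGraph)
  (x : SimpleGraph.Edge G → RealNumbers.Carrier ℝ) (x∈𝓕 : OCRS._∈𝓕 ℝ G x) where
  open RealNumbers ℝ
  open IntegerCoefficients ℝ
  open OrderedField ℝ
  open Constants ℝ
  open Indicators ℝ
  open SimpleGraph G
  open Matchings G
  open Greedy ℝ G x x∈𝓕
  open Marginals ℝ G x x∈𝓕
  open Survival ℝ G x x∈𝓕
  open Solver using (solve; _:+_; _:*_; _:-_; :-_; _:=_; con)
  open ≤-Reasoning

  0≤1-2γ : 0# ≤ 1# - 2# * γ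
  0≤1-2γ = <⇒≤ 0<1-2γ

  0<1-γ : 0# < 1# - γ
  0<1-γ = <-≤-trans 0<1-2γ (≤-by 0≤γ (solve 1 (λ g → one :- g := one :- two :* g :+ g) refl γ))

  0≤1-γ : 0# ≤ 1# - γ
  0≤1-γ = <⇒≤ 0<1-γ

  1-2γ≤ : ∀ {m} → m ≤ 1# → 1# - 2# * γ ≤ 1# - γ - γ * m
  1-2γ≤ {m} m≤1 = ≤-by (*-nonneg 0≤γ (0≤y-x m≤1))
    (solve 2 (λ g m → one :- g :- g :* m := one :- two :* g :+ g :* (one :- m)) refl γ m)

  mass-∷-∈ : ∀ {e l v} → e ∉ₗ l → v ∈ₑ e → mass (e ∷ l) v ≈ mass l v + x e
  mass-∷-∈ {e} {l} {v} e∉l v∈e = trans (mass-∷ v e∉l)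
    (+-congˡ (trans (*-congʳ (𝟙-yes (v ∈ₑ? e) v∈e)) (*-identityˡ (x e))))

  mass-∷-∉ : ∀ {e l v} → e ∉ₗ l → ¬ v ∈ₑ e → mass (e ∷ l) v ≈ mass l v
  mass-∷-∉ {e} {l} {v} e∉l v∉e = trans (mass-∷ v e∉l)
    (trans (+-congˡ (trans (*-congʳ (𝟙-no (v ∈ₑ? e) v∉e)) (zeroˡ (x e)))) (+-identityʳ _))

  -- Telescopes: for `e` at `v`, P(e) ≥ D = 1 - γ - γ m gives 1 - rate ≥ (D - γ x_e) / D, and D - γ
  -- x_e is the D of the longer list. The product starts from D = 1 - γ at the empty list.
  κ-at-vertex : ∀ {l} → Valid l → ∀ v → 1# - γ - γ * mass l v ≤ κ l (v ∈ₑ?_) * (1# - γ)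
  κ-at-vertex [] v = ≤-by (*-nonneg 0≤γ (mass-nonneg [] v))
    (solve 2 (λ g m → one :* (one :- g) := one :- g :- g :* m :+ g :* m) refl γ (mass [] v))
  κ-at-vertex {e ∷ l} (adm ∷ valid) v = cases (v ∈ₑ? e)
    where
    open Admissible adm
    y = rate l e
    m = mass l v
    K = κ l (v ∈ₑ?_)
    D = 1# - γ - γ * m
    cases : Dec (v ∈ₑ e) → 1# - γ - γ * mass (e ∷ l) v ≤ κ (e ∷ l) (v ∈ₑ?_) * (1# - γ)
    cases (yes v∈e) = begin
      1# - γ - γ * mass (e ∷ l) v               ≈⟨ +-congˡ (-‿cong (*-congˡ (mass-∷-∈ new v∈e))) ⟩
      1# - γ - γ * (m + x e)                    ≈⟨ solve 3 (λ g m X → one :- g :- g :* (m :+ X) := one :- g :- g :* m :- g :* X) refl γ m (x e) ⟩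
      D - γ * x e                               ≤⟨ ≤-by (0≤y-x (rate*≤ adm D≤ℙ)) (solve 3 (λ D y t → D :- y :* D := D :- t :+ (t :- y :* D)) refl D y (γ * x e)) ⟩
      D - y * D                                 ≈⟨ solve 2 (λ D y → D :- y :* D := (one :- y) :* D) refl D y ⟩
      (1# - y) * D                              ≤⟨ *-monoʳ-≤ (0≤y-x (rate≤1 adm)) (κ-at-vertex valid v) ⟩
      (1# - y) * (K * (1# - γ))                 ≈⟨ *-assoc (1# - y) K (1# - γ) ⟨
      (1# - y) * K * (1# - γ)                   ≈⟨ *-congʳ (κ-∷-yes (v ∈ₑ?_) {e} {l} v∈e) ⟨
      κ (e ∷ l) (v ∈ₑ?_) * (1# - γ)             ∎
      where
      D≤ℙ : D ≤ ℙ l (Addable? e)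
      D≤ℙ = ≤-trans (≤-by (*-nonneg 0≤γ (0≤x e)) refl) (ℙ-addable-lower valid new v∈e)
    cases (no v∉e) = begin
      1# - γ - γ * mass (e ∷ l) v               ≈⟨ +-congˡ (-‿cong (*-congˡ (mass-∷-∉ new v∉e))) ⟩
      D                                         ≤⟨ κ-at-vertex valid v ⟩
      K * (1# - γ)                              ≈⟨ *-congʳ (κ-∷-no (v ∈ₑ?_) {e} {l} v∉e) ⟨
      κ (e ∷ l) (v ∈ₑ?_) * (1# - γ)             ∎

  -- The probability, under independent choices, that f is the earliest edge
  -- at v that would be selected.
  ψ : List Edge → Vertex → Edge → Carrier
  ψ []      v f = 0#
  ψ (e ∷ l) v f = if does (f ≟ᶠ e) then rate l e * κ l (v ∈ₑ?_) else ψ l v f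

  ψ-here : ∀ {l e v} → ψ (e ∷ l) v e ≈ rate l e * κ l (v ∈ₑ?_)
  ψ-here {l} {e} = reflexive (if-yes (e ≟ᶠ e) ≡.refl)

  ψ-there : ∀ {l e f v} → f ≢ e → ψ (e ∷ l) v f ≈ ψ l v f
  ψ-there {l} {e} {f} f≢e = reflexive (if-no (f ≟ᶠ e) f≢e)

  ψ-nonneg : ∀ {l} → Valid l → ∀ v f → 0# ≤ ψ l v f
  ψ-nonneg []                  v f = ≤-refl
  ψ-nonneg {e ∷ l} (adm ∷ val) v f = if-cases (0# ≤_) (f ≟ᶠ e)
    (λ _ → *-nonneg (rate-nonneg adm) (κ-nonneg (v ∈ₑ?_) val)) (λ _ → ψ-nonneg val v f)

  -- Both sides are affine in m, so it suffices to compare them at m = 0 and m = 1.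
  private
    affine-bound : ∀ {m} → 0# ≤ m → m ≤ 1# → (1# - γ) * (1# - γ) * (1# - γ * m) ≤ 1# - γ - γ * m
    affine-bound {m} 0≤m m≤1 = ≤-by
      (+-nonneg (*-nonneg (0≤y-x m≤1) (*-nonneg 0≤γ 0≤1-γ)) (*-nonneg 0≤m (*-nonneg 0≤γ (0≤y-x γ[3-γ]≤1))))
      (solve 2 (λ g m → one :- g :- g :* m := (one :- g) :* (one :- g) :* (one :- g :* m)
        :+ ((one :- m) :* (g :* (one :- g)) :+ m :* (g :* (one :- g :* (one :+ two :- g))))) refl γ m)

  η : Carrier
  η = γ * (1# - γ)

  0≤η : 0# ≤ η
  0≤η = *-nonneg 0≤γ 0≤1-γ

  -- Let m be the mass at `v` before `f`. The upper bound on P gives rate ≥ γ x_f / (1 - γ m),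
  -- `κ-at-vertex` gives κ ≥ (1 - γ - γ m) / (1 - γ), and by `affine-bound` the product is at least
  -- γ (1 - γ) x_f.
  ψ-lower : ∀ {l v f} → Valid l → v ∈ₑ f → η * (x ↾ l) f ≤ ψ l v f
  ψ-lower {[]}    {v} {f} [] v∈f = ≤-reflexive (trans (*-congˡ (↾-outside {[]} (λ ()))) (zeroʳ η))
  ψ-lower {e ∷ l} {v} {f} (adm ∷ valid) v∈f = cases (f ≟ᶠ e)
    where
    open Admissible adm
    y = rate l e
    m = mass l v
    K = κ l (v ∈ₑ?_)
    cases : Dec (f ≡ e) → η * (x ↾ (e ∷ l)) f ≤ ψ (e ∷ l) v f
    cases (no f≢e) = begin
      η * (x ↾ (e ∷ l)) f     ≈⟨ *-congˡ (↾-there {l} f≢e) ⟩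
      η * (x ↾ l) f           ≤⟨ ψ-lower valid v∈f ⟩
      ψ l v f                 ≈⟨ ψ-there {l} {e} f≢e ⟨
      ψ (e ∷ l) v f           ∎
    cases (yes ≡.refl) = begin
      η * (x ↾ (e ∷ l)) e     ≈⟨ *-congˡ (↾-here {l}) ⟩
      η * x e                 ≤⟨ *-cancelʳ-≤ 0<q scaled ⟩
      y * K                   ≈⟨ ψ-here {l} {e} ⟨
      ψ (e ∷ l) v e           ∎
      where
      D = 1# - γ - γ * m
      q = (1# - γ) * (1# - γ * m)
      0≤D : 0# ≤ D
      0≤D = ≤-trans 0≤1-2γ (1-2γ≤ (mass≤1 l v))
      0<1-γm : 0# < 1# - γ * m
      0<1-γm = <-≤-trans 0<1-γ (≤-by (*-nonneg 0≤γ (0≤y-x (mass≤1 l v)))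
        (solve 2 (λ g m → one :- g :* m := one :- g :+ g :* (one :- m)) refl γ m))
      0<q : 0# < q
      0<q = *-pos 0<1-γ 0<1-γm
      scaled : η * x e * q ≤ y * K * q
      scaled = begin
        η * x e * q                                             ≈⟨ solve 3 (λ g X m → g :* (one :- g) :* X :* ((one :- g) :* (one :- g :* m))
                                                                     := g :* X :* ((one :- g) :* (one :- g) :* (one :- g :* m))) refl γ (x e) m ⟩
        γ * x e * ((1# - γ) * (1# - γ) * (1# - γ * m))          ≤⟨ *-monoʳ-≤ (*-nonneg 0≤γ (0≤x e)) (affine-bound (mass-nonneg l v) (mass≤1 l v)) ⟩
        γ * x e * D                                             ≤⟨ *-mono-≤ 0≤D (*-nonneg (rate-nonneg adm) (<⇒≤ 0<1-γm))
                                                                     (≤rate* adm (ℙ-addable-upper valid new v∈f)) (κ-at-vertex valid v) ⟩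
        y * (1# - γ * m) * (K * (1# - γ))                       ≈⟨ solve 4 (λ y a K b → y :* a :* (K :* b) := y :* K :* (b :* a)) refl y (1# - γ * m) K (1# - γ) ⟩
        y * K * q                                               ∎

  -- A polynomial just below (1 - 2γ) / (1 - γ), with 1 / (1 - γ) truncated to 1 + γ + γ². The
  -- factor 1 - γ of `η` then completes 1 - γ³, which is how `θ` arises.
  ρ : Carrier
  ρ = (1# - 2# * γ) * (1# + γ + γ * γ)

  0≤ρ : 0# ≤ ρ
  0≤ρ = *-nonneg 0≤1-2γ (+-nonneg (+-nonneg 0≤1 0≤γ) (*-nonneg 0≤γ 0≤γ))

  -- S is a bound on the x-mass at w of the edges arriving later.
  module _ {p} {C : Edge → Set p} (C? : ∀ e → Dec (C e)) {w : Vertex}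
    (C⇒w : ∀ {e : Edge} → C e → w ∈ₑ e) where
    mass-of : List Edge → Carrier
    mass-of l = sum (λ f → 𝟙 (C? f) * (x ↾ l) f)

    -- With T = 1 - 2γ + γ S, the mass at `w` before `e` is at most 1 - S - x_e, so P(e) ≥ T + γ x_e
    -- and 1 - rate ≥ T / (T + γ x_e). This denominator is the T for S + x_e, so the product
    -- telescopes. Edges outside `C` leave S as it is.
    κ-part : ∀ {l} → Valid l → ∀ S → 0# ≤ S → mass l w + S ≤ 1# →
      1# - 2# * γ + γ * S ≤ κ l C? * (1# - 2# * γ + γ * S + γ * mass-of l)
    κ-part [] S 0≤S bound = ≤-by (*-nonneg 0≤γ (sum-nonneg (λ f → *-nonneg (0≤𝟙 (C? f)) (↾-nonneg [] f))))
      (*-identityˡ _)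
    κ-part {e ∷ l} (adm ∷ valid) S 0≤S bound = cases (C? e)
      where
      open Admissible adm
      y = rate l e
      K = κ l C?
      M = mass-of l
      T = 1# - 2# * γ + γ * S
      cases : Dec (C e) → T ≤ κ (e ∷ l) C? * (T + γ * mass-of (e ∷ l))
      cases (yes h) = begin
        T                                                  ≤⟨ ≤-by (0≤y-x (rate*≤ adm T+γx≤ℙ))
                                                                (solve 3 (λ T t y → (one :- y) :* (T :+ t) := T :+ (t :- y :* (T :+ t))) refl T (γ * x e) y) ⟩
        (1# - y) * (T + γ * x e)                           ≈⟨ *-congˡ T+γx ⟩
        (1# - y) * (1# - 2# * γ + γ * (S + x e))           ≤⟨ *-monoʳ-≤ (0≤y-x (rate≤1 adm)) (κ-part valid (S + x e) (+-nonneg 0≤S (0≤x e)) bound′) ⟩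
        (1# - y) * (K * (1# - 2# * γ + γ * (S + x e) + γ * M))
                                                           ≈⟨ solve 6 (λ y K g S X M → (one :- y) :* (K :* (one :- two :* g :+ g :* (S :+ X) :+ g :* M))
                                                                := (one :- y) :* K :* (one :- two :* g :+ g :* S :+ g :* (M :+ X))) refl y K γ S (x e) M ⟩
        (1# - y) * K * (T + γ * (M + x e))                 ≈⟨ *-cong (κ-∷-yes C? {e} {l} h) (+-congˡ (*-congˡ M+x)) ⟨
        κ (e ∷ l) C? * (T + γ * mass-of (e ∷ l))           ∎
        where
        T+γx : T + γ * x e ≈ 1# - 2# * γ + γ * (S + x e)
        T+γx = solve 3 (λ g S X → one :- two :* g :+ g :* S :+ g :* X := one :- two :* g :+ g :* (S :+ X)) refl γ S (x e)
        bound′ : mass l w + (S + x e) ≤ 1#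
        bound′ = ≤-trans (≤-reflexive (trans (solve 3 (λ m S X → m :+ (S :+ X) := m :+ X :+ S) refl (mass l w) S (x e))
          (+-congʳ (sym (mass-∷-∈ new (C⇒w h)))))) bound
        M+x : mass-of (e ∷ l) ≈ M + x e
        M+x = trans (weighted-∷ (λ f → 𝟙 (C? f)) new) (+-congˡ (trans (*-congʳ (𝟙-yes (C? e) h)) (*-identityˡ (x e))))
        T+γx≤ℙ : T + γ * x e ≤ ℙ l (Addable? e)
        T+γx≤ℙ = ≤-trans
          (≤-by (+-nonneg (*-nonneg 0≤γ (0≤y-x bound′)) (*-nonneg 0≤γ (0≤x e)))
            (solve 4 (λ g S X m → one :- g :- g :* m :+ g :* X
              := one :- two :* g :+ g :* S :+ g :* X :+ (g :* (one :- (m :+ (S :+ X))) :+ g :* X)) refl γ S (x e) (mass l w)))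
          (ℙ-addable-lower valid new (C⇒w h))
      cases (no ¬h) = begin
        T                                             ≤⟨ κ-part valid S 0≤S (≤-trans (+-monoˡ-≤ S mass≤) bound) ⟩
        K * (T + γ * M)                               ≈⟨ *-cong (κ-∷-no C? {e} {l} ¬h) (+-congˡ (*-congˡ M≈)) ⟨
        κ (e ∷ l) C? * (T + γ * mass-of (e ∷ l))      ∎
        where
        mass≤ : mass l w ≤ mass (e ∷ l) w
        mass≤ = ≤-by (*-nonneg (0≤𝟙 (w ∈ₑ? e)) (0≤x e)) (mass-∷ w new)
        M≈ : mass-of (e ∷ l) ≈ M
        M≈ = trans (weighted-∷ (λ f → 𝟙 (C? f)) new) (trans (+-congˡ (trans (*-congʳ (𝟙-no (C? e) ¬h)) (zeroˡ (x e)))) (+-identityʳ M))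

    -- `κ-part` at S = 0, with M ≤ 1 - s, gives κ ≥ (1 - 2γ) / (1 - γ - γ s). That 1 / (1 - γ - γ s)
    -- is at least (1 + γ + γ²)(1 + s/2) is a polynomial inequality, whose difference of sides is a
    -- positive multiple of `slack`.
    κ-part-lower : ∀ {l} → Valid l → ∀ {s} → 0# ≤ s → s ≤ 1# → mass-of l + s ≤ 1# →
      ρ * (2# + s) ≤ 2# * κ l C?
    κ-part-lower {l} valid {s} 0≤s s≤1 M+s≤1 = *-cancelʳ-≤ 0<Q (begin
      ρ * (2# + s) * Q                                  ≤⟨ ≤-by (*-nonneg 0≤1-2γ slack)
                                                             (solve 2 (λ g s → two :* (one :- two :* g)
                                                                := (one :- two :* g) :* (one :+ g :+ g :* g) :* (two :+ s) :* (one :- g :- g :* s)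
                                                                :+ (one :- two :* g) :* (two :* (g :* g :* g) :+ (one :+ g :+ g :* g)
                                                                     :* (s :* ((one :+ two) :* g :- one) :+ g :* (s :* s)))) refl γ s) ⟩
      2# * (1# - 2# * γ)                                ≤⟨ *-monoʳ-≤ 0≤2 R-bound ⟩
      2# * (κ l C? * Q)                                 ≈⟨ *-assoc 2# (κ l C?) Q ⟨
      2# * κ l C? * Q                                   ∎)
      where
      Q = 1# - γ - γ * s
      0<Q : 0# < Q
      0<Q = <-≤-trans 0<1-2γ (1-2γ≤ s≤1)
      0≤2 : 0# ≤ 2#
      0≤2 = 0≤fromℕ 2
      slack : 0# ≤ 2# * (γ * γ * γ) + (1# + γ + γ * γ) * (s * ((1# + 2#) * γ - 1#) + γ * (s * s))
      slack = +-nonneg (*-nonneg 0≤2 (*-nonneg (*-nonneg 0≤γ 0≤γ) 0≤γ))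
        (*-nonneg (+-nonneg (+-nonneg 0≤1 0≤γ) (*-nonneg 0≤γ 0≤γ))
          (+-nonneg (*-nonneg 0≤s (0≤y-x 1≤3γ)) (*-nonneg 0≤γ (*-nonneg 0≤s 0≤s))))
      R-bound : 1# - 2# * γ ≤ κ l C? * Q
      R-bound = begin
        1# - 2# * γ                                             ≈⟨ solve 1 (λ g → one :- two :* g := one :- two :* g :+ g :* con (+ 0)) refl γ ⟩
        1# - 2# * γ + γ * 0#                                    ≤⟨ κ-part valid 0# ≤-refl (≤-trans (≤-reflexive (+-identityʳ (mass l w))) (mass≤1 l w)) ⟩
        κ l C? * (1# - 2# * γ + γ * 0# + γ * mass-of l)         ≤⟨ *-monoʳ-≤ (κ-nonneg C? valid) (≤-by (*-nonneg 0≤γ (0≤y-x M+s≤1))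
                                                                     (solve 3 (λ g s M → one :- g :- g :* s
                                                                        := one :- two :* g :+ g :* con (+ 0) :+ g :* M :+ g :* (one :- (M :+ s))) refl γ s (mass-of l))) ⟩
        κ l C? * Q                                              ∎

-- Two disjoint edges selected together.

module Pairs {c ℓ₁ ℓ₂} (ℝ : RealNumbers c ℓ₁ ℓ₂) (G : SimpleGraph)
  (x : SimpleGraph.Edge G → RealNumbers.Carrier ℝ) (x∈𝓕 : OCRS._∈𝓕 ℝ G x) where
  open RealNumbers ℝ
  open IntegerCoefficients ℝ
  open OrderedField ℝ
  open Constants ℝ
  open Indicators ℝ
  open SimpleGraph G
  open Matchings G
  open Greedy ℝ G x x∈𝓕
  open Marginals ℝ G x x∈𝓕
  open Survival ℝ G x x∈𝓕
  open SurvivalBounds ℝ G x x∈𝓕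
  open Solver using (solve; _:*_; _:=_)
  open ≤-Reasoning

  ℙ-nonneg : ∀ {p} {P : State → Set p} (P? : ∀ I → Dec (P I)) {l} → Valid l → 0# ≤ ℙ l P?
  ℙ-nonneg P? valid = 𝔼-nonneg valid (λ I _ → 0≤𝟙 (P? I))

  AllFree : Vertex → Vertex → Vertex → Vertex → State → Set
  AllFree u v w z I = Free u I × Free v I × Free w I × Free z I

  allFree? : ∀ u v w z I → Dec (AllFree u v w z I)
  allFree? u v w z I = Free? u I ×-dec Free? v I ×-dec Free? w I ×-dec Free? z I

  Touches : Vertex → Vertex → Vertex → Vertex → Edge → Set
  Touches u v w z e = u ∈ₑ e ⊎ v ∈ₑ e ⊎ w ∈ₑ e ⊎ z ∈ₑ e

  touches? : ∀ u v w z e → Dec (Touches u v w z e)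
  touches? u v w z e = (u ∈ₑ? e) ⊎-dec (v ∈ₑ? e) ⊎-dec (w ∈ₑ? e) ⊎-dec (z ∈ₑ? e)

  -- A vertex can become matched only through an edge at it that would be selected, so the event
  -- counted by `κ` forces all four vertices to be free.
  ℙ-allFree : ∀ u v w z {l} → Valid l → κ l (touches? u v w z) ≤ ℙ l (allFree? u v w z)
  ℙ-allFree u v w z [] = ≤-reflexive (sym (𝟙-yes (allFree? u v w z ⊥) (free , free , free , free)))
    where
    free : ∀ {v} → Free v ⊥
    free f f∈⊥ = contradiction f∈⊥ ∉⊥
  ℙ-allFree u v w z {e ∷ l} (adm ∷ valid) = cases (touches? u v w z e)
    where
    cases : Dec (Touches u v w z e) → κ (e ∷ l) (touches? u v w z) ≤ ℙ (e ∷ l) (allFree? u v w z)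
    cases (yes t) = begin
      κ (e ∷ l) (touches? u v w z)                      ≈⟨ κ-∷-yes (touches? u v w z) {e} {l} t ⟩
      (1# - rate l e) * κ l (touches? u v w z)          ≤⟨ *-monoʳ-≤ (0≤y-x (rate≤1 adm)) (ℙ-allFree u v w z valid) ⟩
      (1# - rate l e) * ℙ l (allFree? u v w z)          ≤⟨ ℙ-decay (allFree? u v w z) valid adm ⟩
      ℙ (e ∷ l) (allFree? u v w z)                      ∎
    cases (no ¬t) = begin
      κ (e ∷ l) (touches? u v w z)                      ≈⟨ κ-∷-no (touches? u v w z) {e} {l} ¬t ⟩
      κ l (touches? u v w z)                            ≤⟨ ℙ-allFree u v w z valid ⟩
      ℙ l (allFree? u v w z)                            ≤⟨ ℙ-stay (allFree? u v w z) valid adm (λ { I _ (fu , fv , fw , fz) _ →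
                                                             Free-∪ fu (¬t ∘ inj₁) , Free-∪ fv (¬t ∘ inj₂ ∘ inj₁)
                                                             , Free-∪ fw (¬t ∘ inj₂ ∘ inj₂ ∘ inj₁) , Free-∪ fz (¬t ∘ inj₂ ∘ inj₂ ∘ inj₂) }) ⟩
      ℙ (e ∷ l) (allFree? u v w z)                      ∎

  ends-free⇒addable : ∀ {v f I} → IsMatching I → v ∈ₑ f → Free v I → Free (other v f) I → Addable f I
  ends-free⇒addable {v} {f} {I} I-matching v∈f free-v free-other =
    free⇒addable I-matching (free (inj₁ ≡.refl)) (free (inj₂ ≡.refl))
    where
    free : ∀ {w} → w ∈ₑ f → Free w I
    free w∈f with ∈-other v∈f w∈f
    ... | inj₁ ≡.refl = free-v
    ... | inj₂ ≡.refl = free-other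

  -- Once an edge at v has been selected, further edges at v are harmless.
  Harmful₁ : (v z u w : Vertex) → Edge → Set
  Harmful₁ v z u w e = u ∈ₑ e ⊎ ((w ∈ₑ e ⊎ z ∈ₑ e) × ¬ v ∈ₑ e)

  harmful₁? : ∀ v z u w e → Dec (Harmful₁ v z u w e)
  harmful₁? v z u w e = (u ∈ₑ? e) ⊎-dec (((w ∈ₑ? e) ⊎-dec (z ∈ₑ? e)) ×-dec ¬? (v ∈ₑ? e))

  Selected₁ : Edge → (u w : Vertex) → State → Set
  Selected₁ g u w I = g ∈ I × Free u I × Free w I

  selected₁? : ∀ g u w I → Dec (Selected₁ g u w I)
  selected₁? g u w I = (g ∈? I) ×-dec Free? u I ×-dec Free? w I

  -- If `g` is the first edge at `v` that would be selected and no harmful edge would be, then both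
  -- ends of `g` are free when it arrives. Afterwards an edge from `v` to `w` is blocked by `g`, and
  -- the remaining edges at `u` and `w` are harmful.
  ℙ-selected₁ : ∀ {v g u w} → v ∈ₑ g → ¬ u ∈ₑ g → ¬ w ∈ₑ g → ∀ {l} → Valid l →
    ψ l v g * κ l (harmful₁? v (other v g) u w) ≤ ℙ l (selected₁? g u w)
  ℙ-selected₁ {v} {g} {u} {w} v∈g u∉g w∉g [] =
    ≤-trans (≤-reflexive (zeroˡ (κ [] (harmful₁? v (other v g) u w)))) (ℙ-nonneg (selected₁? g u w) [])
  ℙ-selected₁ {v} {g} {u} {w} v∈g u∉g w∉g {e ∷ l} (adm ∷ valid) = cases (g ≟ᶠ e)
    where
    open Admissible adm
    z = other v g
    y = rate l e
    H? = harmful₁? v z u w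
    S? = selected₁? g u w
    IH = ℙ-selected₁ v∈g u∉g w∉g valid
    cases : Dec (g ≡ e) → ψ (e ∷ l) v g * κ (e ∷ l) H? ≤ ℙ (e ∷ l) S?
    cases (yes ≡.refl) = begin
      ψ (e ∷ l) v e * κ (e ∷ l) H?                ≤⟨ *-monoʳ-≤ (ψ-nonneg (adm ∷ valid) v e) (κ-∷-≤ H? adm valid) ⟩
      ψ (e ∷ l) v e * κ l H?                      ≈⟨ *-congʳ (ψ-here {l} {e}) ⟩
      y * κ l (v ∈ₑ?_) * κ l H?                   ≈⟨ *-assoc y (κ l (v ∈ₑ?_)) (κ l H?) ⟩
      y * (κ l (v ∈ₑ?_) * κ l H?)                 ≤⟨ *-monoʳ-≤ (rate-nonneg adm) (κ-∪ (touches? u v w z) (v ∈ₑ?_) H? valid (λ f _ → split f (v ∈ₑ? f))) ⟩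
      y * κ l (touches? u v w z)                  ≤⟨ *-monoʳ-≤ (rate-nonneg adm) (ℙ-allFree u v w z valid) ⟩
      y * ℙ l (allFree? u v w z)                  ≤⟨ ℙ-select (allFree? u v w z) valid adm S? (λ { I (m , _) (fu , fv , fw , fz) →
                                                       ends-free⇒addable m v∈g fv fz , e∈∪⁅e⁆ e , Free-∪ fu u∉g , Free-∪ fw w∉g }) ⟩
      ℙ (e ∷ l) S?                                ∎
      where
      split : ∀ f → Dec (v ∈ₑ f) → Touches u v w z f → v ∈ₑ f ⊎ Harmful₁ v z u w f
      split f (yes v∈f) _                         = inj₁ v∈f
      split f (no v∉f) (inj₁ u∈f)                 = inj₂ (inj₁ u∈f)
      split f (no v∉f) (inj₂ (inj₁ v∈f))          = inj₁ v∈f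
      split f (no v∉f) (inj₂ (inj₂ w∈f⊎z∈f))      = inj₂ (inj₂ (w∈f⊎z∈f , v∉f))
    cases (no g≢e) = ≤-trans (≤-reflexive (*-congʳ (ψ-there {l} {e} g≢e))) (later (v ∈ₑ? e) (H? e))
      where
      harmless : ℙ l S? ≤ ℙ (e ∷ l) S? → ψ l v g * κ (e ∷ l) H? ≤ ℙ (e ∷ l) S?
      harmless stay = ≤-trans (*-monoʳ-≤ (ψ-nonneg valid v g) (κ-∷-≤ H? adm valid)) (≤-trans IH stay)
      later : Dec (v ∈ₑ e) → Dec (Harmful₁ v z u w e) → ψ l v g * κ (e ∷ l) H? ≤ ℙ (e ∷ l) S?
      -- On the event, `g` occupies `v`, so `e` cannot be added and nothing changes.
      later (yes v∈e) _ = harmless (ℙ-stay S? valid adm λ { I (_ , I⊆l) (g∈I , _) addable →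
        contradiction v∈g (addable⇒free (new ∘ I⊆l) addable v∈e g g∈I) })
      later (no v∉e) (yes h) = begin
        ψ l v g * κ (e ∷ l) H?               ≈⟨ *-congˡ (κ-∷-yes H? {e} {l} h) ⟩
        ψ l v g * ((1# - y) * κ l H?)        ≈⟨ solve 3 (λ a b c → a :* (b :* c) := b :* (a :* c)) refl (ψ l v g) (1# - y) (κ l H?) ⟩
        (1# - y) * (ψ l v g * κ l H?)        ≤⟨ *-monoʳ-≤ (0≤y-x (rate≤1 adm)) IH ⟩
        (1# - y) * ℙ l S?                    ≤⟨ ℙ-decay S? valid adm ⟩
        ℙ (e ∷ l) S?                         ∎
      later (no v∉e) (no ¬h) = harmless (ℙ-stay S? valid adm λ { I _ (g∈I , fu , fw) _ →
        ∈-∪⁅⁆⁺ g∈I , Free-∪ fu (¬h ∘ inj₁) , Free-∪ fw (λ w∈e → ¬h (inj₂ (inj₁ w∈e , v∉e))) })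

  Harmful₂ : (u v w z : Vertex) → Edge → Set
  Harmful₂ u v w z e = (w ∈ₑ e ⊎ z ∈ₑ e) × ¬ u ∈ₑ e × ¬ v ∈ₑ e

  harmful₂? : ∀ u v w z e → Dec (Harmful₂ u v w z e)
  harmful₂? u v w z e = ((w ∈ₑ? e) ⊎-dec (z ∈ₑ? e)) ×-dec ¬? (u ∈ₑ? e) ×-dec ¬? (v ∈ₑ? e)

  Selected₂ : (f g : Edge) → State → Set
  Selected₂ f g I = f ∈ I × g ∈ I

  selected₂? : ∀ f g I → Dec (Selected₂ f g I)
  selected₂? f g I = (f ∈? I) ×-dec (g ∈? I)

  -- When the later of the two edges arrives, the `κ` inside its `ψ` covers the earlier edges at its
  -- own vertex. Together with `Harmful₂` this covers `Harmful₁` for the other edge, which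
  -- `ℙ-selected₁` has selected by then.
  ℙ-selected₂ : ∀ {u v f g} → u ∈ₑ f → v ∈ₑ g → ¬ u ∈ₑ g → ¬ v ∈ₑ f → ¬ other u f ∈ₑ g → ¬ other v g ∈ₑ f →
    ∀ {l} → Valid l →
    ψ l u f * ψ l v g * κ l (harmful₂? u v (other u f) (other v g)) ≤ ℙ l (selected₂? f g)
  ℙ-selected₂ {u} {v} {f} {g} u∈f v∈g u∉g v∉f w∉g z∉f {[]} [] = ≤-trans
    (≤-reflexive (trans (*-congʳ (zeroˡ 0#)) (zeroˡ (κ [] (harmful₂? u v (other u f) (other v g)))))) (ℙ-nonneg (selected₂? f g) [])
  ℙ-selected₂ {u} {v} {f} {g} u∈f v∈g u∉g v∉f w∉g z∉f {e ∷ l} (adm ∷ valid) = cases (f ≟ᶠ e) (g ≟ᶠ e)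
    where
    w = other u f
    z = other v g
    y = rate l e
    H? = harmful₂? u v w z
    S? = selected₂? f g
    Hu? = harmful₁? v z u w
    Hv? = harmful₁? u w v z
    cases : Dec (f ≡ e) → Dec (g ≡ e) → ψ (e ∷ l) u f * ψ (e ∷ l) v g * κ (e ∷ l) H? ≤ ℙ (e ∷ l) S?
    cases (yes ≡.refl) (yes ≡.refl) = contradiction u∈f u∉g
    cases (yes ≡.refl) (no g≢e) = begin
      ψ (e ∷ l) u e * ψ (e ∷ l) v g * κ (e ∷ l) H?     ≤⟨ *-monoʳ-≤ (*-nonneg (ψ-nonneg (adm ∷ valid) u e) (ψ-nonneg (adm ∷ valid) v g)) (κ-∷-≤ H? adm valid) ⟩
      ψ (e ∷ l) u e * ψ (e ∷ l) v g * κ l H?           ≈⟨ *-congʳ (*-cong (ψ-here {l} {e}) (ψ-there {l} {e} g≢e)) ⟩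
      y * κ l (u ∈ₑ?_) * ψ l v g * κ l H?              ≈⟨ solve 4 (λ y k p h → y :* k :* p :* h := y :* (p :* (k :* h))) refl y (κ l (u ∈ₑ?_)) (ψ l v g) (κ l H?) ⟩
      y * (ψ l v g * (κ l (u ∈ₑ?_) * κ l H?))          ≤⟨ *-monoʳ-≤ (rate-nonneg adm) (*-monoʳ-≤ (ψ-nonneg valid v g)
                                                            (κ-∪ Hu? (u ∈ₑ?_) H? valid (λ h _ → split h (u ∈ₑ? h)))) ⟩
      y * (ψ l v g * κ l Hu?)                          ≤⟨ *-monoʳ-≤ (rate-nonneg adm) (ℙ-selected₁ v∈g u∉g w∉g valid) ⟩
      y * ℙ l (selected₁? g u w)                       ≤⟨ ℙ-select (selected₁? g u w) valid adm S? (λ { I (m , _) (g∈I , fu , fw) →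
                                                            ends-free⇒addable m u∈f fu fw , e∈∪⁅e⁆ e , ∈-∪⁅⁆⁺ g∈I }) ⟩
      ℙ (e ∷ l) S?                                     ∎
      where
      split : ∀ h → Dec (u ∈ₑ h) → Harmful₁ v z u w h → u ∈ₑ h ⊎ Harmful₂ u v w z h
      split h (yes u∈h) _                       = inj₁ u∈h
      split h (no u∉h)  (inj₁ u∈h)              = inj₁ u∈h
      split h (no u∉h)  (inj₂ (w∈h⊎z∈h , v∉h))  = inj₂ (w∈h⊎z∈h , u∉h , v∉h)
    cases (no f≢e) (yes ≡.refl) = begin
      ψ (e ∷ l) u f * ψ (e ∷ l) v e * κ (e ∷ l) H?     ≤⟨ *-monoʳ-≤ (*-nonneg (ψ-nonneg (adm ∷ valid) u f) (ψ-nonneg (adm ∷ valid) v e)) (κ-∷-≤ H? adm valid) ⟩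
      ψ (e ∷ l) u f * ψ (e ∷ l) v e * κ l H?           ≈⟨ *-congʳ (*-cong (ψ-there {l} {e} f≢e) (ψ-here {l} {e})) ⟩
      ψ l u f * (y * κ l (v ∈ₑ?_)) * κ l H?            ≈⟨ solve 4 (λ y k p h → p :* (y :* k) :* h := y :* (p :* (k :* h))) refl y (κ l (v ∈ₑ?_)) (ψ l u f) (κ l H?) ⟩
      y * (ψ l u f * (κ l (v ∈ₑ?_) * κ l H?))          ≤⟨ *-monoʳ-≤ (rate-nonneg adm) (*-monoʳ-≤ (ψ-nonneg valid u f)
                                                            (κ-∪ Hv? (v ∈ₑ?_) H? valid (λ h _ → split h (v ∈ₑ? h)))) ⟩
      y * (ψ l u f * κ l Hv?)                          ≤⟨ *-monoʳ-≤ (rate-nonneg adm) (ℙ-selected₁ u∈f v∉f z∉f valid) ⟩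
      y * ℙ l (selected₁? f v z)                       ≤⟨ ℙ-select (selected₁? f v z) valid adm S? (λ { I (m , _) (f∈I , fv , fz) →
                                                            ends-free⇒addable m v∈g fv fz , ∈-∪⁅⁆⁺ f∈I , e∈∪⁅e⁆ e }) ⟩
      ℙ (e ∷ l) S?                                     ∎
      where
      split : ∀ h → Dec (v ∈ₑ h) → Harmful₁ u w v z h → v ∈ₑ h ⊎ Harmful₂ u v w z h
      split h (yes v∈h) _                            = inj₁ v∈h
      split h (no v∉h)  (inj₁ v∈h)                   = inj₁ v∈h
      split h (no v∉h)  (inj₂ (inj₁ z∈h , u∉h))      = inj₂ (inj₂ z∈h , u∉h , v∉h)
      split h (no v∉h)  (inj₂ (inj₂ w∈h , u∉h))      = inj₂ (inj₁ w∈h , u∉h , v∉h)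
    cases (no f≢e) (no g≢e) = begin
      ψ (e ∷ l) u f * ψ (e ∷ l) v g * κ (e ∷ l) H?     ≈⟨ *-congʳ (*-cong (ψ-there {l} {e} f≢e) (ψ-there {l} {e} g≢e)) ⟩
      ψ l u f * ψ l v g * κ (e ∷ l) H?                 ≤⟨ *-monoʳ-≤ (*-nonneg (ψ-nonneg valid u f) (ψ-nonneg valid v g)) (κ-∷-≤ H? adm valid) ⟩
      ψ l u f * ψ l v g * κ l H?                       ≤⟨ ℙ-selected₂ u∈f v∈g u∉g v∉f w∉g z∉f valid ⟩
      ℙ l S?                                           ≤⟨ ℙ-stay S? valid adm (λ { I _ (f∈I , g∈I) _ → ∈-∪⁅⁆⁺ f∈I , ∈-∪⁅⁆⁺ g∈I }) ⟩
      ℙ (e ∷ l) S?                                     ∎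

-- A weighted count of pairs without a common neighbour.

module Overlaps {c ℓ₁ ℓ₂} (ℝ : RealNumbers c ℓ₁ ℓ₂) where
  open RealNumbers ℝ
  open IntegerCoefficients ℝ
  open OrderedField ℝ
  open Indicators ℝ
  open Solver using (solve; _:+_; _:*_; _:-_; :-_; _:=_)
  open ≤-Reasoning

  0≤2 : 0# ≤ 2#
  0≤2 = 0≤fromℕ 2

  sum-neg : ∀ {n} (f : Fin n → Carrier) → sum (λ i → - f i) ≈ - sum f
  sum-neg f = trans (sum-cong-≋ (λ i → solve 1 (λ t → :- t := :- one :* t) refl (f i)))
    (trans (sym (*-distribˡ-sum (- 1#) f)) (solve 1 (λ t → :- one :* t := :- t) refl (sum f)))

  sum-point : ∀ {n} (v : Fin n) (F : Fin n → Carrier) → sum (λ w → 𝟙 (v ≟ᶠ w) * F w) ≈ F v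
  sum-point v F = trans
    (sum-single (λ w → 𝟙 (v ≟ᶠ w) * F w) v (λ w w≢v → trans (*-congʳ (𝟙-no (v ≟ᶠ w) (w≢v ∘ ≡.sym))) (zeroˡ (F w))))
    (trans (*-congʳ (𝟙-yes (v ≟ᶠ v) ≡.refl)) (*-identityˡ (F v)))

  module _ {n m : ℕ} (a : Fin n → Carrier) (α : Fin n → Fin m) where
    fibre : Fin m → Carrier
    fibre w = sum (λ f → a f * 𝟙 (α f ≟ᶠ w))

    sum-fibres : ∀ F → sum (λ f → a f * F (α f)) ≈ sum (λ w → fibre w * F w)
    sum-fibres F = begin-equality
      sum (λ f → a f * F (α f))                                 ≈⟨ sum-cong-≋ (λ f → *-congˡ (sum-point (α f) F)) ⟨
      sum (λ f → a f * sum (λ w → 𝟙 (α f ≟ᶠ w) * F w))          ≈⟨ sum-cong-≋ (λ f → *-distribˡ-sum (a f) (λ w → 𝟙 (α f ≟ᶠ w) * F w)) ⟩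
      sum (λ f → sum (λ w → a f * (𝟙 (α f ≟ᶠ w) * F w)))        ≈⟨ ∑-comm (λ f w → a f * (𝟙 (α f ≟ᶠ w) * F w)) ⟩
      sum (λ w → sum (λ f → a f * (𝟙 (α f ≟ᶠ w) * F w)))        ≈⟨ sum-cong-≋ (λ w → sum-cong-≋ (λ f → *-assoc (a f) (𝟙 (α f ≟ᶠ w)) (F w))) ⟨
      sum (λ w → sum (λ f → a f * 𝟙 (α f ≟ᶠ w) * F w))          ≈⟨ sum-cong-≋ (λ w → *-distribʳ-sum (F w) (λ f → a f * 𝟙 (α f ≟ᶠ w))) ⟨
      sum (λ w → fibre w * F w)                                 ∎

    sum-fibre : sum fibre ≈ sum a
    sum-fibre = begin-equality
      sum fibre                     ≈⟨ sum-cong-≋ (λ w → *-identityʳ (fibre w)) ⟨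
      sum (λ w → fibre w * 1#)      ≈⟨ sum-fibres (λ _ → 1#) ⟨
      sum (λ f → a f * 1#)          ≈⟨ sum-cong-≋ (λ f → *-identityʳ (a f)) ⟩
      sum a                         ∎

    fibre-nonneg : (∀ f → 0# ≤ a f) → ∀ w → 0# ≤ fibre w
    fibre-nonneg 0≤a w = sum-nonneg (λ f → *-nonneg (0≤a f) (0≤𝟙 (α f ≟ᶠ w)))

  module _ {n m : ℕ} (a b : Fin n → Carrier) (α β : Fin n → Fin m) where
    private
      p q : Fin m → Carrier
      p = fibre a α
      q = fibre b β

    S : Fin m → Carrier
    S w = p w + q w

    -- The weight is twice the constant and linear part of (1 + S/2)(1 + S/2), taken at `α f` and
    -- `β g`. Being additive, it lets the double sum collapse to sums over `w`.
    disjoint-pairs : Carrier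
    disjoint-pairs = sum (λ f → sum (λ g →
      a f * b g * ((1# - 𝟙 (α f ≟ᶠ β g)) * (2# + S (α f) + S (β g)))))

    private
      A B PS QS L : Carrier
      A = sum a
      B = sum b
      PS = sum (λ w → p w * S w)
      QS = sum (λ w → q w * S w)
      L = sum (λ w → 2# * (p w * q w) * (1# + S w))

      row : Fin m → Carrier
      row w = (2# + S w) * B + QS - q w * (2# + S w + S w)

      disjoint-row : ∀ f → sum (λ g → a f * b g * ((1# - 𝟙 (α f ≟ᶠ β g)) * (2# + S (α f) + S (β g)))) ≈ a f * row (α f)
      disjoint-row f = begin-equality
        sum (λ g → a f * b g * ((1# - ε g) * (c₀ + S (β g))))
          ≈⟨ sum-cong-≋ (λ g → solve 5 (λ a b ε c s → a :* b :* ((one :- ε) :* (c :+ s)) := a :* (c :* b :+ b :* s :+ :- (b :* (ε :* (c :+ s)))))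
               refl (a f) (b g) (ε g) c₀ (S (β g))) ⟩
        sum (λ g → a f * (c₀ * b g + b g * S (β g) + - (b g * (ε g * (c₀ + S (β g))))))
          ≈⟨ *-distribˡ-sum (a f) (λ g → c₀ * b g + b g * S (β g) + - (b g * (ε g * (c₀ + S (β g))))) ⟨
        a f * sum (λ g → c₀ * b g + b g * S (β g) + - (b g * (ε g * (c₀ + S (β g)))))
          ≈⟨ *-congˡ (trans (∑-distrib-+ (λ g → c₀ * b g + b g * S (β g)) (λ g → - (b g * (ε g * (c₀ + S (β g))))))
               (+-cong (trans (∑-distrib-+ (λ g → c₀ * b g) (λ g → b g * S (β g)))
                 (+-cong (sym (*-distribˡ-sum c₀ b)) (sum-fibres b β S)))
                 (trans (sum-neg (λ g → b g * (ε g * (c₀ + S (β g))))) (-‿cong meeting)))) ⟩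
        a f * row (α f)   ∎
        where
        c₀ = 2# + S (α f)
        ε : Fin n → Carrier
        ε g = 𝟙 (α f ≟ᶠ β g)
        meeting : sum (λ g → b g * (ε g * (c₀ + S (β g)))) ≈ q (α f) * (c₀ + S (α f))
        meeting = begin-equality
          sum (λ g → b g * (ε g * (c₀ + S (β g))))              ≈⟨ sum-fibres b β (λ w → 𝟙 (α f ≟ᶠ w) * (c₀ + S w)) ⟩
          sum (λ w → q w * (𝟙 (α f ≟ᶠ w) * (c₀ + S w)))         ≈⟨ sum-cong-≋ (λ w → solve 3 (λ q i t → q :* (i :* t) := i :* (q :* t)) refl (q w) (𝟙 (α f ≟ᶠ w)) (c₀ + S w)) ⟩
          sum (λ w → 𝟙 (α f ≟ᶠ w) * (q w * (c₀ + S w)))         ≈⟨ sum-point (α f) (λ w → q w * (c₀ + S w)) ⟩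
          q (α f) * (c₀ + S (α f))                              ∎

      disjoint-pairs≈ : disjoint-pairs ≈ 2# * A * B + B * PS + A * QS - L
      disjoint-pairs≈ = begin-equality
        disjoint-pairs                                ≈⟨ sum-cong-≋ disjoint-row ⟩
        sum (λ f → a f * row (α f))                   ≈⟨ sum-fibres a α row ⟩
        sum (λ w → p w * row w)                       ≈⟨ sum-cong-≋ (λ w → solve 4 (λ p q B Q → p :* ((two :+ (p :+ q)) :* B :+ Q :- q :* (two :+ (p :+ q) :+ (p :+ q)))
                                                           := (two :* B :+ Q) :* p :+ B :* (p :* (p :+ q)) :+ :- (two :* (p :* q) :* (one :+ (p :+ q)))) refl (p w) (q w) B QS) ⟩
        sum (λ w → (2# * B + QS) * p w + B * (p w * S w) + - (2# * (p w * q w) * (1# + S w)))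
                                                      ≈⟨ trans (∑-distrib-+ (λ w → (2# * B + QS) * p w + B * (p w * S w)) (λ w → - (2# * (p w * q w) * (1# + S w))))
                                                           (+-cong (trans (∑-distrib-+ (λ w → (2# * B + QS) * p w) (λ w → B * (p w * S w)))
                                                             (+-cong (trans (sym (*-distribˡ-sum (2# * B + QS) p)) (*-congˡ (sum-fibre a α)))
                                                                     (sym (*-distribˡ-sum B (λ w → p w * S w)))))
                                                             (sum-neg (λ w → 2# * (p w * q w) * (1# + S w)))) ⟩
        (2# * B + QS) * A + B * PS + - L              ≈⟨ solve 5 (λ A B P Q L → (two :* B :+ Q) :* A :+ B :* P :+ :- L := two :* A :* B :+ B :* P :+ A :* Q :- L) refl A B PS QS L ⟩
        2# * A * B + B * PS + A * QS - L              ∎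

    -- The loss from pairs meeting at w, at most 2 p q (1 + S) with S = p + q,
    -- is compensated by the gain S² from the terms S in the weights.
    disjoint-pairs-lower : (∀ f → 0# ≤ a f) → (∀ g → 0# ≤ b g) → sum a ≤ 1# → sum b ≤ 1# → (∀ w → S w ≤ 1#) →
      2# * (1# - 2# * ((1# - sum a) + (1# - sum b))) ≤ disjoint-pairs
    disjoint-pairs-lower 0≤a 0≤b A≤1 B≤1 S≤1 = ≤-trans
      -- Expansion around A = B = 1, where the surplus is `PS` + `QS` - `L`. A unit of missing mass
      -- costs at most 4: two from 2 A B, and at most two from the other products because `PS` +
      -- `QS` ≤ 2.
      (≤-by (+-nonneg (+-nonneg (*-nonneg 0≤2 (*-nonneg 0≤1-A 0≤1-B)) (+-nonneg (*-nonneg 0≤1-A 0≤PS) (*-nonneg 0≤1-B 0≤QS)))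
              (+-nonneg (0≤y-x L≤W) (*-nonneg (+-nonneg 0≤1-A 0≤1-B) (0≤y-x W≤2))))
        (solve 5 (λ A B P Q L → two :* A :* B :+ B :* P :+ A :* Q :- L
          := two :* (one :- two :* ((one :- A) :+ (one :- B)))
             :+ (two :* ((one :- A) :* (one :- B)) :+ ((one :- A) :* P :+ (one :- B) :* Q)
                :+ ((P :+ Q :- L) :+ ((one :- A) :+ (one :- B)) :* (two :- (P :+ Q))))) refl A B PS QS L))
      (≤-reflexive (sym disjoint-pairs≈))
      where
      0≤p : ∀ w → 0# ≤ p w
      0≤p = fibre-nonneg a α 0≤a
      0≤q : ∀ w → 0# ≤ q w
      0≤q = fibre-nonneg b β 0≤b
      0≤S : ∀ w → 0# ≤ S w
      0≤S w = +-nonneg (0≤p w) (0≤q w)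
      0≤1-A : 0# ≤ 1# - A
      0≤1-A = 0≤y-x A≤1
      0≤1-B : 0# ≤ 1# - B
      0≤1-B = 0≤y-x B≤1
      0≤PS : 0# ≤ PS
      0≤PS = sum-nonneg (λ w → *-nonneg (0≤p w) (0≤S w))
      0≤QS : 0# ≤ QS
      0≤QS = sum-nonneg (λ w → *-nonneg (0≤q w) (0≤S w))
      W≈ : sum (λ w → p w * S w + q w * S w) ≈ PS + QS
      W≈ = ∑-distrib-+ (λ w → p w * S w) (λ w → q w * S w)
      L≤W : L ≤ PS + QS
      L≤W = ≤-trans (sum-mono loss≤gain) (≤-reflexive W≈)
        where
        loss≤gain : ∀ w → 2# * (p w * q w) * (1# + S w) ≤ p w * S w + q w * S w
        -- As 4 p q = S² - (p - q)², twice the loss is at most S² (1 + S), and S ≤ 1 bounds this by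
        -- 2 S².
        loss≤gain w = *-cancelʳ-≤ (0<suc 1) (≤-by
          (+-nonneg (*-nonneg (*-nonneg (0≤S w) (0≤S w)) (0≤y-x (S≤1 w))) (*-nonneg (0≤x² (p w - q w)) (+-nonneg 0≤1 (0≤S w))))
          (solve 2 (λ p q → (p :* (p :+ q) :+ q :* (p :+ q)) :* two
             := two :* (p :* q) :* (one :+ (p :+ q)) :* two
                :+ ((p :+ q) :* (p :+ q) :* (one :- (p :+ q)) :+ (p :- q) :* (p :- q) :* (one :+ (p :+ q)))) refl (p w) (q w)))
      W≤2 : PS + QS ≤ 2#
      W≤2 = begin
        PS + QS                                     ≈⟨ W≈ ⟨
        sum (λ w → p w * S w + q w * S w)           ≤⟨ sum-mono (λ w → +-mono-≤ (≤-trans (*-monoʳ-≤ (0≤p w) (S≤1 w)) (≤-reflexive (*-identityʳ (p w))))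
                                                                       (≤-trans (*-monoʳ-≤ (0≤q w) (S≤1 w)) (≤-reflexive (*-identityʳ (q w))))) ⟩
        sum (λ w → p w + q w)                       ≈⟨ ∑-distrib-+ p q ⟩
        sum p + sum q                               ≈⟨ +-cong (sum-fibre a α) (sum-fibre b β) ⟩
        A + B                                       ≤⟨ +-mono-≤ A≤1 B≤1 ⟩
        1# + 1#                                     ≈⟨ solve 0 (one :+ one := two) refl ⟩
        2#                                          ∎

-- Lower bound on "both endpoints matched", and P(e) ≥ γ.

module Correlation {c ℓ₁ ℓ₂} (ℝ : RealNumbers c ℓ₁ ℓ₂) (G : SimpleGraph)
  (x : SimpleGraph.Edge G → RealNumbers.Carrier ℝ) (x∈𝓕 : OCRS._∈𝓕 ℝ G x) where
  open RealNumbers ℝ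
  open IntegerCoefficients ℝ
  open OrderedField ℝ
  open Constants ℝ
  open Indicators ℝ
  open Overlaps ℝ
  open SimpleGraph G
  open Matchings G
  open Greedy ℝ G x x∈𝓕
  open Marginals ℝ G x x∈𝓕
  open Survival ℝ G x x∈𝓕
  open SurvivalBounds ℝ G x x∈𝓕
  open Pairs ℝ G x x∈𝓕
  open Solver using (solve; _:+_; _:*_; _:-_; :-_; _:=_; con)
  open ≤-Reasoning

  ηρ≈θ : η * ρ ≈ θ
  ηρ≈θ = solve 1 (λ g → g :* (one :- g) :* ((one :- two :* g) :* (one :+ g :+ g :* g))
    := g :* (one :- two :* g) :* (one :- g :* g :* g)) refl γ

  module _ {l : List Edge} (valid : Valid l) {u v : Vertex}
    (separate : ∀ {f : Edge} → f ∈ₗ l → u ∈ₑ f → ¬ v ∈ₑ f) where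
    private
      X : Edge → Carrier
      X = x ↾ l
      a b : Edge → Carrier
      a f = 𝟙 (u ∈ₑ? f) * X f
      b g = 𝟙 (v ∈ₑ? g) * X g
      σ : Vertex → Carrier
      σ = S a b (other u) (other v)

      0≤a : ∀ f → 0# ≤ a f
      0≤a f = *-nonneg (0≤𝟙 (u ∈ₑ? f)) (↾-nonneg l f)
      0≤b : ∀ g → 0# ≤ b g
      0≤b g = *-nonneg (0≤𝟙 (v ∈ₑ? g)) (↾-nonneg l g)
      0≤σ : ∀ w → 0# ≤ σ w
      0≤σ w = +-nonneg (fibre-nonneg a (other u) 0≤a w) (fibre-nonneg b (other v) 0≤b w)

    Away : Vertex → Edge → Set
    Away w e = w ∈ₑ e × ¬ u ∈ₑ e × ¬ v ∈ₑ e

    away? : ∀ w e → Dec (Away w e)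
    away? w e = (w ∈ₑ? e) ×-dec ¬? (u ∈ₑ? e) ×-dec ¬? (v ∈ₑ? e)

    -- An arrived edge at `w` is counted at most once: as avoiding `u` and `v`, or in `σ` as coming
    -- from `u`, or as coming from `v`. By `separate` no edge contains both `u` and `v`.
    away+σ≤1 : ∀ w → mass-of (away? w) proj₁ l + σ w ≤ 1#
    away+σ≤1 w = begin
      sum (λ f → away f * X f) + (sum (λ f → a f * 𝟙 (other u f ≟ᶠ w)) + sum (λ f → b f * 𝟙 (other v f ≟ᶠ w)))
        ≈⟨ trans (∑-distrib-+ (λ f → away f * X f) (λ f → a f * 𝟙 (other u f ≟ᶠ w) + b f * 𝟙 (other v f ≟ᶠ w)))
             (+-congˡ (∑-distrib-+ (λ f → a f * 𝟙 (other u f ≟ᶠ w)) (λ f → b f * 𝟙 (other v f ≟ᶠ w)))) ⟨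
      sum (λ f → away f * X f + (a f * 𝟙 (other u f ≟ᶠ w) + b f * 𝟙 (other v f ≟ᶠ w)))
        ≤⟨ sum-mono (λ f → ≤-trans (≤-reflexive (solve 6 (λ A U V P Q X → A :* X :+ (U :* X :* P :+ V :* X :* Q) := (A :+ (U :* P :+ V :* Q)) :* X) refl
             (away f) (𝟙 (u ∈ₑ? f)) (𝟙 (v ∈ₑ? f)) (𝟙 (other u f ≟ᶠ w)) (𝟙 (other v f ≟ᶠ w)) (X f)))
             (bound f (f ∈ₗ? l))) ⟩
      mass l w
        ≤⟨ mass≤1 l w ⟩
      1# ∎
      where
      away coefficient : Edge → Carrier
      away f = 𝟙 (away? w f)
      coefficient f = away f + (𝟙 (u ∈ₑ? f) * 𝟙 (other u f ≟ᶠ w) + 𝟙 (v ∈ₑ? f) * 𝟙 (other v f ≟ᶠ w))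
      neighbour : ∀ {u} f → u ∈ₑ f → 𝟙 (other u f ≟ᶠ w) ≤ 𝟙 (w ∈ₑ? f)
      neighbour {u} f u∈f = ≤𝟙-by (other u f ≟ᶠ w) (w ∈ₑ? f) (λ { ≡.refl → other∈ u∈f })
      coefficient≤ : ∀ f → f ∈ₗ l → Dec (u ∈ₑ f) → Dec (v ∈ₑ f) → coefficient f ≤ 𝟙 (w ∈ₑ? f)
      coefficient≤ f f∈l (yes u∈f) (yes v∈f) = contradiction v∈f (separate f∈l u∈f)
      coefficient≤ f f∈l (yes u∈f) (no v∉f) = ≤-trans (≤-reflexive (trans
        (+-cong (𝟙-no (away? w f) (λ (_ , u∉f , _) → u∉f u∈f)) (+-cong (*-congʳ (𝟙-yes (u ∈ₑ? f) u∈f)) (*-congʳ (𝟙-no (v ∈ₑ? f) v∉f))))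
        (solve 2 (λ p q → con (+ 0) :+ (one :* p :+ con (+ 0) :* q) := p) refl (𝟙 (other u f ≟ᶠ w)) (𝟙 (other v f ≟ᶠ w)))))
        (neighbour f u∈f)
      coefficient≤ f f∈l (no u∉f) (yes v∈f) = ≤-trans (≤-reflexive (trans
        (+-cong (𝟙-no (away? w f) (λ (_ , _ , v∉f) → v∉f v∈f)) (+-cong (*-congʳ (𝟙-no (u ∈ₑ? f) u∉f)) (*-congʳ (𝟙-yes (v ∈ₑ? f) v∈f))))
        (solve 2 (λ p q → con (+ 0) :+ (con (+ 0) :* p :+ one :* q) := q) refl (𝟙 (other u f ≟ᶠ w)) (𝟙 (other v f ≟ᶠ w)))))
        (neighbour f v∈f)
      coefficient≤ f f∈l (no u∉f) (no v∉f) = ≤-trans (≤-reflexive (trans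
        (+-congˡ (+-cong (*-congʳ (𝟙-no (u ∈ₑ? f) u∉f)) (*-congʳ (𝟙-no (v ∈ₑ? f) v∉f))))
        (solve 3 (λ A p q → A :+ (con (+ 0) :* p :+ con (+ 0) :* q) := A) refl (away f) (𝟙 (other u f ≟ᶠ w)) (𝟙 (other v f ≟ᶠ w)))))
        (≤𝟙-by (away? w f) (w ∈ₑ? f) proj₁)
      bound : ∀ f → Dec (f ∈ₗ l) → coefficient f * X f ≤ 𝟙 (w ∈ₑ? f) * X f
      bound f (yes f∈l) = *-monoˡ-≤ (↾-nonneg l f) (coefficient≤ f f∈l (u ∈ₑ? f) (v ∈ₑ? f))
      bound f (no f∉l)  = ≤-reflexive (trans (trans (*-congˡ (↾-outside {l} f∉l)) (zeroʳ (coefficient f)))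
        (sym (trans (*-congˡ (↾-outside {l} f∉l)) (zeroʳ (𝟙 (w ∈ₑ? f))))))

    σ≤1 : ∀ w → σ w ≤ 1#
    σ≤1 w = ≤-trans (≤-by (sum-nonneg (λ f → *-nonneg (0≤𝟙 (away? w f)) (↾-nonneg l f)))
      (+-comm (mass-of (away? w) proj₁ l) (σ w))) (away+σ≤1 w)

    κ-away : ∀ w → ρ * (2# + σ w) ≤ 2# * κ l (away? w)
    κ-away w = κ-part-lower (away? w) proj₁ valid (0≤σ w) (σ≤1 w) (away+σ≤1 w)

    ℙ-pair-∈ : ∀ {f g} → f ∈ₗ l → g ∈ₗ l → u ∈ₑ f → v ∈ₑ g → other u f ≢ other v g →
      θ * θ * (X f * X g * (2# + σ (other u f) + σ (other v g))) ≤ 2# * ℙ l (selected₂? f g)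
    ℙ-pair-∈ {f} {g} f∈l g∈l u∈f v∈g w≢z = *-cancelʳ-≤ (0<suc 1) (begin
      θ * θ * (X f * X g * (2# + σ w + σ z)) * 2#
        -- (2 + s)(2 + r) ≥ 2 (2 + s + r): the product s r is given up to obtain the additive
        -- weights of `disjoint-pairs`.
        ≤⟨ ≤-by (*-nonneg (*-nonneg (0≤x² θ) (*-nonneg (↾-nonneg l f) (↾-nonneg l g))) (*-nonneg (0≤σ w) (0≤σ z)))
             (solve 5 (λ t X Y s r → t :* t :* (X :* Y :* ((two :+ s) :* (two :+ r)))
                := t :* t :* (X :* Y :* (two :+ s :+ r)) :* two :+ t :* t :* (X :* Y) :* (s :* r)) refl θ (X f) (X g) (σ w) (σ z)) ⟩
      θ * θ * (X f * X g * ((2# + σ w) * (2# + σ z)))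
        ≈⟨ *-congʳ (*-cong ηρ≈θ ηρ≈θ) ⟨
      η * ρ * (η * ρ) * (X f * X g * ((2# + σ w) * (2# + σ z)))
        ≈⟨ solve 6 (λ e r X Y s t → e :* r :* (e :* r) :* (X :* Y :* (s :* t)) := e :* X :* (e :* Y) :* (r :* s :* (r :* t))) refl
             η ρ (X f) (X g) (2# + σ w) (2# + σ z) ⟩
      η * X f * (η * X g) * (ρ * (2# + σ w) * (ρ * (2# + σ z)))
        ≤⟨ *-mono-≤ (*-nonneg (0≤ρ2 w) (0≤ρ2 z)) (*-nonneg (ψ-nonneg valid u f) (ψ-nonneg valid v g))
             (*-mono-≤ (*-nonneg 0≤η (↾-nonneg l g)) (ψ-nonneg valid u f) (ψ-lower valid u∈f) (ψ-lower valid v∈g))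
             (*-mono-≤ (0≤ρ2 z) (*-nonneg 0≤2 (κ-nonneg (away? w) valid)) (κ-away w) (κ-away z)) ⟩
      ψ l u f * ψ l v g * (2# * κ l (away? w) * (2# * κ l (away? z)))
        ≈⟨ solve 3 (λ p R R′ → p :* (two :* R :* (two :* R′)) := two :* (p :* (R :* R′)) :* two) refl (ψ l u f * ψ l v g) (κ l (away? w)) (κ l (away? z)) ⟩
      2# * (ψ l u f * ψ l v g * (κ l (away? w) * κ l (away? z))) * 2#
        ≤⟨ *-monoˡ-≤ 0≤2 (*-monoʳ-≤ 0≤2 (*-monoʳ-≤ (*-nonneg (ψ-nonneg valid u f) (ψ-nonneg valid v g))
             (κ-∪ (harmful₂? u v w z) (away? w) (away? z) valid
               (λ { e _ (inj₁ w∈e , u∉e , v∉e) → inj₁ (w∈e , u∉e , v∉e) ; e _ (inj₂ z∈e , u∉e , v∉e) → inj₂ (z∈e , u∉e , v∉e) })))) ⟩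
      2# * (ψ l u f * ψ l v g * κ l (harmful₂? u v w z)) * 2#
        ≤⟨ *-monoˡ-≤ 0≤2 (*-monoʳ-≤ 0≤2 (ℙ-selected₂ u∈f v∈g u∉g v∉f w∉g z∉f valid)) ⟩
      2# * ℙ l (selected₂? f g) * 2# ∎)
      where
      w = other u f
      z = other v g
      0≤ρ2 : ∀ w → 0# ≤ ρ * (2# + σ w)
      0≤ρ2 w = *-nonneg 0≤ρ (+-nonneg 0≤2 (0≤σ w))
      v∉f : ¬ v ∈ₑ f
      v∉f = separate f∈l u∈f
      u∉g : ¬ u ∈ₑ g
      u∉g u∈g = separate g∈l u∈g v∈g
      -- If `w` were `v`, then `f` would join `u` to `v`, against `separate`; the other end of `g`
      -- is ruled out by `w≢z`.
      w∉g : ¬ w ∈ₑ g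
      w∉g w∈g = [ (λ w≡v → v∉f (≡.subst (_∈ₑ f) w≡v (other∈ u∈f))) , w≢z ]′ (∈-other v∈g w∈g)
      z∉f : ¬ z ∈ₑ f
      z∉f z∈f = [ (λ z≡u → u∉g (≡.subst (_∈ₑ g) z≡u (other∈ v∈g))) , w≢z ∘ ≡.sym ]′ (∈-other u∈f z∈f)

    ℙ-pair : ∀ f g →
      θ * θ * (a f * b g * ((1# - 𝟙 (other u f ≟ᶠ other v g)) * (2# + σ (other u f) + σ (other v g))))
      ≤ 2# * (𝟙 (u ∈ₑ? f) * 𝟙 (v ∈ₑ? g) * ℙ l (selected₂? f g))
    ℙ-pair f g = cases (f ∈ₗ? l) (g ∈ₗ? l) (u ∈ₑ? f) (v ∈ₑ? g) (w ≟ᶠ z)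
      where
      w = other u f
      z = other v g
      r = 2# + σ w + σ z
      U = 𝟙 (u ∈ₑ? f)
      V = 𝟙 (v ∈ₑ? g)
      ε = 𝟙 (w ≟ᶠ z)
      LHS RHS : Carrier
      LHS = θ * θ * (U * X f * (V * X g) * ((1# - ε) * r))
      RHS = 2# * (U * V * ℙ l (selected₂? f g))
      0≤RHS : 0# ≤ RHS
      0≤RHS = *-nonneg 0≤2 (*-nonneg (*-nonneg (0≤𝟙 (u ∈ₑ? f)) (0≤𝟙 (v ∈ₑ? g))) (ℙ-nonneg (selected₂? f g) valid))
      vanishing : ∀ {t} → LHS ≈ t * 0# → LHS ≤ RHS
      vanishing {t} eq = ≤-trans (≤-reflexive (trans eq (zeroʳ t))) 0≤RHS
      cases : Dec (f ∈ₗ l) → Dec (g ∈ₗ l) → Dec (u ∈ₑ f) → Dec (v ∈ₑ g) → Dec (w ≡ z) → LHS ≤ RHS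
      cases (no f∉l) _ _ _ _ = vanishing {θ * θ * (U * (V * X g) * ((1# - ε) * r))} (trans
        (solve 7 (λ t U X V Y e r → t :* t :* (U :* X :* (V :* Y) :* (e :* r)) := t :* t :* (U :* (V :* Y) :* (e :* r)) :* X) refl θ U (X f) V (X g) (1# - ε) r)
        (*-congˡ (↾-outside {l} f∉l)))
      cases _ (no g∉l) _ _ _ = vanishing {θ * θ * (U * X f * V * ((1# - ε) * r))} (trans
        (solve 7 (λ t U X V Y e r → t :* t :* (U :* X :* (V :* Y) :* (e :* r)) := t :* t :* (U :* X :* V :* (e :* r)) :* Y) refl θ U (X f) V (X g) (1# - ε) r)
        (*-congˡ (↾-outside {l} g∉l)))
      cases _ _ (no u∉f) _ _ = vanishing {θ * θ * (X f * (V * X g) * ((1# - ε) * r))} (trans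
        (solve 7 (λ t U X V Y e r → t :* t :* (U :* X :* (V :* Y) :* (e :* r)) := t :* t :* (X :* (V :* Y) :* (e :* r)) :* U) refl θ U (X f) V (X g) (1# - ε) r)
        (*-congˡ (𝟙-no (u ∈ₑ? f) u∉f)))
      cases _ _ _ (no v∉g) _ = vanishing {θ * θ * (U * X f * X g * ((1# - ε) * r))} (trans
        (solve 7 (λ t U X V Y e r → t :* t :* (U :* X :* (V :* Y) :* (e :* r)) := t :* t :* (U :* X :* Y :* (e :* r)) :* V) refl θ U (X f) V (X g) (1# - ε) r)
        (*-congˡ (𝟙-no (v ∈ₑ? g) v∉g)))
      cases _ _ _ _ (yes w≡z) = vanishing {θ * θ * (U * X f * (V * X g) * r)} (trans
        (solve 7 (λ t U X V Y e r → t :* t :* (U :* X :* (V :* Y) :* (e :* r)) := t :* t :* (U :* X :* (V :* Y) :* r) :* e) refl θ U (X f) V (X g) (1# - ε) r)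
        (*-congˡ (trans (+-congˡ (-‿cong (𝟙-yes (w ≟ᶠ z) w≡z))) (-‿inverseʳ 1#))))
      cases (yes f∈l) (yes g∈l) (yes u∈f) (yes v∈g) (no w≢z) = begin
        LHS                                      ≈⟨ *-congˡ (*-cong (*-cong (*-congʳ U≈1) (*-congʳ V≈1)) (*-congʳ (+-congˡ (-‿cong (𝟙-no (w ≟ᶠ z) w≢z))))) ⟩
        θ * θ * (1# * X f * (1# * X g) * ((1# - 0#) * r))
                                                 ≈⟨ solve 4 (λ t X Y r → t :* t :* (one :* X :* (one :* Y) :* ((one :- con (+ 0)) :* r)) := t :* t :* (X :* Y :* r)) refl θ (X f) (X g) r ⟩
        θ * θ * (X f * X g * r)                  ≤⟨ ℙ-pair-∈ f∈l g∈l u∈f v∈g w≢z ⟩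
        2# * ℙ l (selected₂? f g)                ≈⟨ *-congˡ (*-identityˡ (ℙ l (selected₂? f g))) ⟨
        2# * (1# * ℙ l (selected₂? f g))         ≈⟨ *-congˡ (*-congʳ (trans (*-cong U≈1 V≈1) (*-identityˡ 1#))) ⟨
        RHS                                      ∎
        where
        U≈1 : U ≈ 1#
        U≈1 = 𝟙-yes (u ∈ₑ? f) u∈f
        V≈1 : V ≈ 1#
        V≈1 = 𝟙-yes (v ∈ₑ? g) v∈g

    both-matched-pairs : both-matched l u v ≈ sum (λ f → sum (λ g → 𝟙 (u ∈ₑ? f) * 𝟙 (v ∈ₑ? g) * ℙ l (selected₂? f g)))
    both-matched-pairs = begin-equality
      𝔼 l (λ I → matched u I * matched v I)
        ≈⟨ 𝔼-cong l (λ I → trans (*-distribʳ-sum (matched v I) (λ f → U f * 𝟙 (f ∈? I)))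
             (sum-cong-≋ (λ f → *-distribˡ-sum (U f * 𝟙 (f ∈? I)) (λ g → V g * 𝟙 (g ∈? I))))) ⟩
      𝔼 l (λ I → sum (λ f → sum (λ g → U f * 𝟙 (f ∈? I) * (V g * 𝟙 (g ∈? I)))))
        ≈⟨ trans (𝔼-sum l (λ f I → sum (λ g → U f * 𝟙 (f ∈? I) * (V g * 𝟙 (g ∈? I)))))
             (sum-cong-≋ (λ f → 𝔼-sum l (λ g I → U f * 𝟙 (f ∈? I) * (V g * 𝟙 (g ∈? I))))) ⟩
      sum (λ f → sum (λ g → 𝔼 l (λ I → U f * 𝟙 (f ∈? I) * (V g * 𝟙 (g ∈? I)))))
        ≈⟨ sum-cong-≋ (λ f → sum-cong-≋ (λ g → trans (𝔼-cong l (λ I → trans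
             (solve 4 (λ U i V j → U :* i :* (V :* j) := U :* V :* (i :* j)) refl (U f) (𝟙 (f ∈? I)) (V g) (𝟙 (g ∈? I)))
             (*-congˡ (sym (𝟙-× (f ∈? I) (g ∈? I))))))
             (𝔼-* l (U f * V g) (λ I → 𝟙 (selected₂? f g I))))) ⟩
      sum (λ f → sum (λ g → U f * V g * ℙ l (selected₂? f g))) ∎
      where
      U V : Edge → Carrier
      U f = 𝟙 (u ∈ₑ? f)
      V g = 𝟙 (v ∈ₑ? g)

    both-matched-lower : θ * θ * (1# - 2# * ((1# - mass l u) + (1# - mass l v))) ≤ both-matched l u v
    both-matched-lower = *-cancelʳ-≤ (0<suc 1) (begin
      θ * θ * t * 2#                                   ≈⟨ solve 2 (λ k t → k :* t :* two := k :* (two :* t)) refl (θ * θ) t ⟩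
      θ * θ * (2# * t)                                 ≤⟨ *-monoʳ-≤ (0≤x² θ) (disjoint-pairs-lower a b (other u) (other v) 0≤a 0≤b (mass≤1 l u) (mass≤1 l v) σ≤1) ⟩
      θ * θ * disjoint-pairs a b (other u) (other v)   ≈⟨ trans (*-distribˡ-sum (θ * θ) (λ f → sum (λ g → T f g)))
                                                            (sum-cong-≋ (λ f → *-distribˡ-sum (θ * θ) (T f))) ⟩
      sum (λ f → sum (λ g → θ * θ * T f g))            ≤⟨ sum-mono (λ f → sum-mono (λ g → ℙ-pair f g)) ⟩
      sum (λ f → sum (λ g → 2# * P f g))               ≈⟨ trans (*-distribˡ-sum 2# (λ f → sum (λ g → P f g)))
                                                            (sum-cong-≋ (λ f → *-distribˡ-sum 2# (P f))) ⟨
      2# * sum (λ f → sum (λ g → P f g))               ≈⟨ *-congˡ both-matched-pairs ⟨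
      2# * both-matched l u v                          ≈⟨ *-comm 2# (both-matched l u v) ⟩
      both-matched l u v * 2#                          ∎)
      where
      t : Carrier
      t = 1# - 2# * ((1# - mass l u) + (1# - mass l v))
      T P : Edge → Edge → Carrier
      T f g = a f * b g * ((1# - 𝟙 (other u f ≟ᶠ other v g)) * (2# + σ (other u f) + σ (other v g)))
      P f g = 𝟙 (u ∈ₑ? f) * 𝟙 (v ∈ₑ? g) * ℙ l (selected₂? f g)

  -- The step that closes the induction. With k = θ² and masses a, b at the endpoints, the surplus
  -- of the bound over `γ` is k - (3γ - 1) at a = b = 1, and each unit of missing mass adds γ - 2k.
  admissible : ∀ {e l} → Valid l → e ∉ₗ l → Admissible e l
  admissible {e} {l} valid e∉l = record { new = e∉l ; γ≤ℙ = begin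
    γ                                                 ≤⟨ ≤-by (+-nonneg (0≤y-x 3γ-1≤θ²) (*-nonneg (+-nonneg (0≤y-x (mass≤1 l u)) (0≤y-x (mass≤1 l v))) (0≤y-x 2θ²≤γ)))
                                                           (solve 4 (λ g k a b → one :- g :* a :- g :* b :+ k :* (one :- two :* ((one :- a) :+ (one :- b)))
                                                              := g :+ (k :- ((one :+ two) :* g :- one) :+ ((one :- a) :+ (one :- b)) :* (g :- two :* k))) refl γ (θ * θ) (mass l u) (mass l v)) ⟩
    1# - γ * mass l u - γ * mass l v + θ * θ * (1# - 2# * ((1# - mass l u) + (1# - mass l v)))
                                                      ≤⟨ +-mono-≤ ≤-refl (both-matched-lower valid separate) ⟩
    1# - γ * mass l u - γ * mass l v + both-matched l u v
                                                      ≈⟨ ℙ-addable valid e∉l ⟨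
    ℙ l (Addable? e)                                  ∎ }
    where
    u = src e
    v = tgt e
    -- In a simple graph only `e` joins its endpoints, and `e` has not arrived.
    separate : ∀ {f} → f ∈ₗ l → u ∈ₑ f → ¬ v ∈ₑ f
    separate f∈l u∈f v∈f with same-ends (loopless e) (inj₁ ≡.refl) (inj₂ ≡.refl) u∈f v∈f
    ... | ≡.refl = e∉l f∈l

-- Expectations in finite coin-flip experiments.

module Expectation {c ℓ₁ ℓ₂} (ℝ : RealNumbers c ℓ₁ ℓ₂) where
  open RealNumbers ℝ
  open IntegerCoefficients ℝ
  open Probability ℝ
  open Solver using (solve; _:+_; _:*_; _:-_; _:=_)
  open OrderedField ℝ
  open ≤-Reasoning

  private
    variable
      A B : Set

  mean : Random A → (A → Carrier) → Carrier
  mean (return a) F = F a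
  mean (coin p k) F = p * mean (k true) F + (1# - p) * mean (k false) F

  Pr≈mean : (X : Random A) (P : A → Bool) → Pr X P ≈ mean X (λ a → if P a then 1# else 0#)
  Pr≈mean (return a) P = refl
  Pr≈mean (coin p k) P = +-cong (*-congˡ (Pr≈mean (k true) P)) (*-congˡ (Pr≈mean (k false) P))

  mean-bind : (X : Random A) (f : A → Random B) (F : B → Carrier) → mean (X >>= f) F ≈ mean X (λ a → mean (f a) F)
  mean-bind (return a) f F = refl
  mean-bind (coin p k) f F = +-cong (*-congˡ (mean-bind (k true) f F)) (*-congˡ (mean-bind (k false) f F))

  mean-cong-surely : ∀ {P : A → Set} {F H} (X : Random A) → Surely P X → (∀ a → P a → F a ≈ H a) → mean X F ≈ mean X H
  mean-cong-surely (return a) Pa  F≈H = F≈H a Pa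
  mean-cong-surely (coin p k) Pkb F≈H = +-cong (*-congˡ (mean-cong-surely (k true) (Pkb true) F≈H))
                                               (*-congˡ (mean-cong-surely (k false) (Pkb false) F≈H))

  surely-all : ∀ {P : A → Set} (X : Random A) → (∀ a → P a) → Surely P X
  surely-all (return a) Pa = Pa a
  surely-all (coin p k) Pa = λ b → surely-all (k b) Pa

  surely-bind : ∀ {P : A → Set} {Q : B → Set} (X : Random A) (f : A → Random B) →
    Surely P X → (∀ a → P a → Surely Q (f a)) → Surely Q (X >>= f)
  surely-bind (return a) f Pa  Qf = Qf a Pa
  surely-bind (coin p k) f Pkb Qf = λ b → surely-bind (k b) f (Pkb b) Qf

  mean-cong : ∀ {F H} (X : Random A) → (∀ a → F a ≈ H a) → mean X F ≈ mean X H
  mean-cong (return a) F≈H = F≈H a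
  mean-cong (coin p k) F≈H = +-cong (*-congˡ (mean-cong (k true) F≈H)) (*-congˡ (mean-cong (k false) F≈H))

  mean-const : (X : Random A) (t : Carrier) → mean X (λ _ → t) ≈ t
  mean-const (return a) t = refl
  mean-const (coin p k) t = trans (+-cong (*-congˡ (mean-const (k true) t)) (*-congˡ (mean-const (k false) t)))
    (solve 2 (λ p t → p :* t :+ (one :- p) :* t := t) refl p t)

  mean-mix : (X : Random A) (p : Carrier) (F H : A → Carrier) →
    mean X (λ a → p * F a + (1# - p) * H a) ≈ p * mean X F + (1# - p) * mean X H
  mean-mix (return a) p F H = refl
  mean-mix (coin q k) p F H = trans (+-cong (*-congˡ (mean-mix (k true) p F H)) (*-congˡ (mean-mix (k false) p F H)))
    (solve 6 (λ p q a b c d → q :* (p :* a :+ (one :- p) :* b) :+ (one :- q) :* (p :* c :+ (one :- p) :* d)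
      := p :* (q :* a :+ (one :- q) :* c) :+ (one :- p) :* (q :* b :+ (one :- q) :* d)) refl
      p q (mean (k true) F) (mean (k true) H) (mean (k false) F) (mean (k false) H))

  module _ {n : ℕ} (w : Fin (suc n) → Carrier) (F : Subset (suc n) → Carrier) where
    private
      tails : Random (Subset n)
      tails = randomSubset (w ∘ suc)

    mean-randomSubset : mean (randomSubset w) F ≈
      w zero * mean tails (λ R → F (true ∷ R)) + (1# - w zero) * mean tails (λ R → F (false ∷ R))
    mean-randomSubset = +-cong (*-congˡ (mean-bind tails (λ R → return (true ∷ R)) F))
                               (*-congˡ (mean-bind tails (λ R → return (false ∷ R)) F))

  -- Redrawing one coordinate with an independent coin of the same bias preserves the law of the
  -- set. It isolates the activity of the arriving edge in `deferred`.
  resample : ∀ {n} (w : Fin n → Carrier) k F → mean (randomSubset w) F ≈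
    w k * mean (randomSubset w) (λ R → F (R [ k ]≔ true)) + (1# - w k) * mean (randomSubset w) (λ R → F (R [ k ]≔ false))
  resample {suc n} w zero F = begin-equality
    mean (randomSubset w) F                                  ≈⟨ mean-randomSubset w F ⟩
    p * T + (1# - p) * U                                     ≈⟨ solve 3 (λ p T U → p :* T :+ (one :- p) :* U
                                                                  := p :* (p :* T :+ (one :- p) :* T) :+ (one :- p) :* (p :* U :+ (one :- p) :* U)) refl p T U ⟩
    p * (p * T + (1# - p) * T) + (1# - p) * (p * U + (1# - p) * U)
                                                             ≈⟨ +-cong (*-congˡ (mean-randomSubset w (λ R → F (R [ zero ]≔ true))))
                                                                       (*-congˡ (mean-randomSubset w (λ R → F (R [ zero ]≔ false)))) ⟨
    p * mean (randomSubset w) (λ R → F (R [ zero ]≔ true)) + (1# - p) * mean (randomSubset w) (λ R → F (R [ zero ]≔ false)) ∎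
    where
    p = w zero
    T = mean (randomSubset (w ∘ suc)) (λ R → F (true ∷ R))
    U = mean (randomSubset (w ∘ suc)) (λ R → F (false ∷ R))
  resample {suc n} w (suc k) F = begin-equality
    mean (randomSubset w) F                                  ≈⟨ mean-randomSubset w F ⟩
    p * mean X (λ R → F (true ∷ R)) + (1# - p) * mean X (λ R → F (false ∷ R))
                                                             ≈⟨ +-cong (*-congˡ (resample (w ∘ suc) k (λ R → F (true ∷ R))))
                                                                       (*-congˡ (resample (w ∘ suc) k (λ R → F (false ∷ R)))) ⟩
    p * (q * M true true + (1# - q) * M true false) + (1# - p) * (q * M false true + (1# - q) * M false false)
                                                             ≈⟨ solve 6 (λ p q a b c d → p :* (q :* a :+ (one :- q) :* b) :+ (one :- p) :* (q :* c :+ (one :- q) :* d)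
                                                                  := q :* (p :* a :+ (one :- p) :* c) :+ (one :- q) :* (p :* b :+ (one :- p) :* d)) refl
                                                                  p q (M true true) (M true false) (M false true) (M false false) ⟩
    q * (p * M true true + (1# - p) * M false true) + (1# - q) * (p * M true false + (1# - p) * M false false)
                                                             ≈⟨ +-cong (*-congˡ (mean-randomSubset w (λ R → F (R [ suc k ]≔ true))))
                                                                       (*-congˡ (mean-randomSubset w (λ R → F (R [ suc k ]≔ false)))) ⟨
    q * mean (randomSubset w) (λ R → F (R [ suc k ]≔ true)) + (1# - q) * mean (randomSubset w) (λ R → F (R [ suc k ]≔ false)) ∎
    where
    p = w zero
    q = w (suc k)
    X = randomSubset (w ∘ suc)
    M : Bool → Bool → Carrier
    M b b′ = mean X (λ R → F (b ∷ (R [ k ]≔ b′)))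

module _ {n : ℕ} {f e : Fin n} (R : Subset n) (b : Bool) where
  ∈-[]≔ : f ≢ e → does (f ∈? (R [ e ]≔ b)) ≡ does (f ∈? R)
  ∈-[]≔ f≢e = does-⇔ (mk⇔
    (λ f∈ → lookup⇒[]= f R (≡.trans (≡.sym (lookup∘update′ f≢e R b)) ([]=⇒lookup f∈)))
    (λ f∈R → lookup⇒[]= f (R [ e ]≔ b) (≡.trans (lookup∘update′ f≢e R b) ([]=⇒lookup f∈R))))
    (f ∈? (R [ e ]≔ b)) (f ∈? R)

-- The online algorithm and its analysis.

module Scheme {c ℓ₁ ℓ₂} (ℝ : RealNumbers c ℓ₁ ℓ₂) (G : SimpleGraph)
  (x : SimpleGraph.Edge G → RealNumbers.Carrier ℝ) (x∈𝓕 : OCRS._∈𝓕 ℝ G x) where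
  open RealNumbers ℝ
  open IntegerCoefficients ℝ
  open OrderedField ℝ
  open Constants ℝ
  open Indicators ℝ
  open SimpleGraph G
  open Matchings G
  open Probability ℝ
  open OCRS ℝ G
  open Expectation ℝ
  open Greedy ℝ G x x∈𝓕
  open Marginals ℝ G x x∈𝓕
  open Correlation ℝ G x x∈𝓕
  open DecUnique (_≟ᶠ_ {#E}) using (unique?)
  open Solver using (solve; _:+_; _:*_; _:-_; _:=_; con)
  open ≤-Reasoning

  unique⇒∉ : ∀ {e : Edge} {l} → Unique (e ∷ l) → e ∉ₗ l
  unique⇒∉ (e≢ ∷ _) e∈l = All.lookup e≢ e∈l ≡.refl

  unique⇒valid : ∀ {l} → Unique l → Valid l
  unique⇒valid []               = []
  unique⇒valid u@(_ ∷ l-unique) = admissible (unique⇒valid l-unique) (unique⇒∉ u) ∷ unique⇒valid l-unique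

  unique⇒admissible : ∀ {e l} → Unique (e ∷ l) → Admissible e l
  unique⇒admissible u@(_ ∷ l-unique) = admissible (unique⇒valid l-unique) (unique⇒∉ u)

  unique-ʳ++ : ∀ es {l : List Edge} → Unique (es ʳ++ l) → Unique l
  unique-ʳ++ []       u = u
  unique-ʳ++ (e ∷ es) u = AllPairs.tail (unique-ʳ++ es u)

  fresh-ʳ++ : ∀ es {l : List Edge} {e} → Unique (es ʳ++ l) → e ∈ₗ l → e ∉ₗ es
  fresh-ʳ++ (f ∷ es) u e∈l (here ≡.refl) = unique⇒∉ (unique-ʳ++ es u) e∈l
  fresh-ʳ++ (f ∷ es) u e∈l (there e∈es)  = fresh-ʳ++ es u (there e∈l) e∈es

  -- The scheme reads only the order of arrivals from the history. Hence the three histories that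
  -- can follow an arrival lead to the same later acceptance probabilities, as the recursion in
  -- `deferred` requires.
  arrived : History → List Edge
  arrived = map Arrival.edge

  -- Histories with repeated edges never occur.
  scheme : OnlineAlgorithm
  scheme = record
    { accept   = λ h e → if does (unique? (e ∷ arrived h)) then attenuation (arrived h) e else 0#
    ; accept≥0 = λ h e → if-cases (0# ≤_) (unique? (e ∷ arrived h))
        (λ u → 0≤γ/p (Admissible.γ≤ℙ (unique⇒admissible u))) (λ _ → ≤-refl)
    ; accept≤1 = λ h e → if-cases (_≤ 1#) (unique? (e ∷ arrived h))
        (λ u → γ/p≤1 (Admissible.γ≤ℙ (unique⇒admissible u))) (λ _ → 0≤1)
    }
  open OnlineAlgorithm scheme

  surely-run : ∀ R h I es → I ⊆ R → IsMatching I → Surely (λ J → J ⊆ R × IsMatching J) (run scheme R h I es)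
  surely-run R h I []       I⊆R I-matching = I⊆R , I-matching
  surely-run R h I (e ∷ es) I⊆R I-matching = if-cases (Surely (λ J → J ⊆ R × IsMatching J))
    -- `does` of this decision computes to the conjunction tested by `run`, so `if-cases` fits the
    -- unfolded goal.
    ((e ∈? R) ×-dec Addable? e I)
    (λ { (e∈R , addable) true  → surely-run R (arrival e true true ∷ h) (I ∪ ⁅ e ⁆) es
           (λ f∈ → [ I⊆R , (λ { ≡.refl → e∈R }) ]′ (∈-∪⁅⁆⁻ f∈)) addable
       ; _               false → surely-run R (arrival e true false ∷ h) I es I⊆R I-matching })
    (λ _ → surely-run R (arrival e (does (e ∈? R)) false ∷ h) I es I⊆R I-matching)

  module _ (F : State → Carrier) where
    runMean : Subset #E → History → State → List Edge → Carrier
    runMean R h I es = mean (run scheme R h I es) F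

    run-cong : ∀ R R′ h I es → (∀ f → f ∈ₗ es → does (f ∈? R) ≡ does (f ∈? R′)) → runMean R h I es ≈ runMean R′ h I es
    run-cong R R′ h I []       same = refl
    run-cong R R′ h I (e ∷ es) same = branch (same e (here ≡.refl)) (does (isMatching? (I ∪ ⁅ e ⁆)))
      where
      -- One unfolding of `run` with both tests as parameters, so that the tests for `R` and `R′`
      -- can be identified before either is evaluated.
      next : Subset #E → Bool → Bool → Random State
      next R r m = if r ∧ m
        then coin (accept h e) (λ b → run scheme R (arrival e true b ∷ h) (if b then I ∪ ⁅ e ⁆ else I) es)
        else run scheme R (arrival e r false ∷ h) I es
      rest : ∀ h J → runMean R h J es ≈ runMean R′ h J es
      rest h J = run-cong R R′ h J es (λ f f∈es → same f (there f∈es))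
      branch : ∀ {r r′} → r ≡ r′ → ∀ m → mean (next R r m) F ≈ mean (next R′ r′ m) F
      branch {true}  ≡.refl true  = +-cong (*-congˡ (rest (arrival e true true ∷ h) (I ∪ ⁅ e ⁆))) (*-congˡ (rest (arrival e true false ∷ h) I))
      branch {true}  ≡.refl false = rest (arrival e true false ∷ h) I
      branch {false} ≡.refl m     = rest (arrival e false false ∷ h) I

    run-active : ∀ R h I e es → e ∈ R → runMean R h I (e ∷ es) ≈
      mix (accept h e) (does (Addable? e I)) (runMean R (arrival e true true ∷ h) (I ∪ ⁅ e ⁆) es) (runMean R (arrival e true false ∷ h) I es)
    run-active R h I e es e∈R = branch (dec-true (e ∈? R) e∈R) (does (isMatching? (I ∪ ⁅ e ⁆)))
      where
      branch : ∀ {r} → r ≡ true → ∀ m →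
        mean (if r ∧ m
          then coin (accept h e) (λ b → run scheme R (arrival e true b ∷ h) (if b then I ∪ ⁅ e ⁆ else I) es)
          else run scheme R (arrival e r false ∷ h) I es) F ≈
        mix (accept h e) m (runMean R (arrival e true true ∷ h) (I ∪ ⁅ e ⁆) es) (runMean R (arrival e true false ∷ h) I es)
      branch ≡.refl true  = refl
      branch ≡.refl false = refl

    run-inactive : ∀ R h I e es → e ∉ R → runMean R h I (e ∷ es) ≈ runMean R (arrival e false false ∷ h) I es
    run-inactive R h I e es e∉R = branch (dec-false (e ∈? R) e∉R) (does (isMatching? (I ∪ ⁅ e ⁆)))
      where
      branch : ∀ {r} → r ≡ false → ∀ m →
        mean (if r ∧ m
          then coin (accept h e) (λ b → run scheme R (arrival e true b ∷ h) (if b then I ∪ ⁅ e ⁆ else I) es)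
          else run scheme R (arrival e r false ∷ h) I es) F ≈
        runMean R (arrival e false false ∷ h) I es
      branch ≡.refl m = refl

    -- The value with `l` arrived and `es` to come. `run` proceeds from the earliest edge and `𝔼`
    -- unwinds from the latest; moving one edge from `es` to `l` is a single unfolding of `𝔼`, so
    -- every step of `𝔼-forward` is definitional.
    forward : List Edge → List Edge → State → Carrier
    forward l []       I = F I
    forward l (e ∷ es) I = step (rate l e) e (forward (e ∷ l) es) I

    𝔼-forward : ∀ l es → 𝔼 l (forward l es) ≈ 𝔼 (es ʳ++ l) F
    𝔼-forward l []       = refl
    𝔼-forward l (e ∷ es) = 𝔼-forward (e ∷ l) es

    realization : Random (Subset #E)
    realization = randomSubset x

    accept≈ : ∀ h e → Unique (e ∷ arrived h) → accept h e ≈ attenuation (arrived h) e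
    accept≈ h e u = reflexive (if-yes (unique? (e ∷ arrived h)) u)

    mean-realization-mix : ∀ y b (H K : Subset #E → Carrier) →
      mean realization (λ R → mix y b (H R) (K R)) ≈ mix y b (mean realization H) (mean realization K)
    mean-realization-mix y true  H K = mean-mix realization y H K
    mean-realization-mix y false H K = refl

    -- Two independent coins, activity with bias p and acceptance with bias y, act as one coin with
    -- bias p y; this is the product in `rate`.
    mix-thin : ∀ p y b s r → p * mix y b s r + (1# - p) * r ≈ mix (p * y) b s r
    mix-thin p y true  = solve 4 (λ p y s r → p :* (y :* s :+ (one :- y) :* r) :+ (one :- p) :* r
      := p :* y :* s :+ (one :- p :* y) :* r) refl p y
    mix-thin p y false = solve 3 (λ p s r → p :* r :+ (one :- p) :* r := r) refl p

    -- Principle of deferred decisions: whether e is active may be decided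
    -- when e arrives.
    deferred : ∀ es h I → Unique (es ʳ++ arrived h) → mean realization (λ R → runMean R h I es) ≈ forward (arrived h) es I
    deferred []       h I u = mean-const realization (F I)
    deferred (e ∷ es) h I u = begin-equality
      mean realization (λ R → runMean R h I (e ∷ es))
        ≈⟨ resample x e (λ R → runMean R h I (e ∷ es)) ⟩
      x e * mean realization (λ R → runMean (R [ e ]≔ true) h I (e ∷ es)) + (1# - x e) * mean realization (λ R → runMean (R [ e ]≔ false) h I (e ∷ es))
        ≈⟨ +-cong (*-congˡ (mean-cong realization active)) (*-congˡ (mean-cong realization inactive)) ⟩
      x e * mean realization (λ R → mix (accept h e) b (runMean R h₁ (I ∪ ⁅ e ⁆) es) (runMean R h₂ I es)) + (1# - x e) * mean realization (λ R → runMean R h₃ I es)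
        ≈⟨ +-cong (*-congˡ (trans (mean-realization-mix (accept h e) b (λ R → runMean R h₁ (I ∪ ⁅ e ⁆) es) (λ R → runMean R h₂ I es))
             (mix-cong b (accept≈ h e (unique-ʳ++ es u)) (deferred es h₁ (I ∪ ⁅ e ⁆) u) (deferred es h₂ I u))))
             (*-congˡ (deferred es h₃ I u)) ⟩
      x e * mix (attenuation (arrived h) e) b (next (I ∪ ⁅ e ⁆)) (next I) + (1# - x e) * next I
        ≈⟨ mix-thin (x e) (attenuation (arrived h) e) b (next (I ∪ ⁅ e ⁆)) (next I) ⟩
      forward (arrived h) (e ∷ es) I ∎
      where
      b = does (Addable? e I)
      h₁ h₂ h₃ : History
      h₁ = arrival e true true ∷ h
      h₂ = arrival e true false ∷ h
      h₃ = arrival e false false ∷ h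
      next : State → Carrier
      next = forward (e ∷ arrived h) es
      e∉es : e ∉ₗ es
      e∉es = fresh-ʳ++ es u (here ≡.refl)
      irrelevant : ∀ R b h J → runMean (R [ e ]≔ b) h J es ≈ runMean R h J es
      irrelevant R b h J = run-cong (R [ e ]≔ b) R h J es
        (λ f f∈es → ∈-[]≔ {f = f} {e} R b (λ { ≡.refl → e∉es f∈es }))
      active : ∀ R → runMean (R [ e ]≔ true) h I (e ∷ es) ≈ mix (accept h e) b (runMean R h₁ (I ∪ ⁅ e ⁆) es) (runMean R h₂ I es)
      active R = trans (run-active (R [ e ]≔ true) h I e es ([]≔-updates R e))
        (mix-cong b refl (irrelevant R true h₁ (I ∪ ⁅ e ⁆)) (irrelevant R true h₂ I))
      inactive : ∀ R → runMean (R [ e ]≔ false) h I (e ∷ es) ≈ runMean R h₃ I es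
      inactive R = trans (run-inactive (R [ e ]≔ false) h I e es
        (λ e∈ → contradiction ([]=-injective e∈ ([]≔-updates R e)) (λ ()))) (irrelevant R false h₃ I)

  module _ {σ : List Edge} (σ↭ : σ ↭ allFin #E) where
    private
      τ : List Edge
      τ = reverse σ

      τ-unique : Unique τ
      τ-unique = SetoidPermutation.Unique-resp-↭ (≡-setoid #E) (↭⇒↭ₛ (↭-sym (↭-trans (↭-reverse σ) σ↭))) (allFin⁺ #E)

      ∈τ : ∀ e → e ∈ₗ τ
      ∈τ e = ∈-resp-↭ (↭-sym (↭-trans (↭-reverse σ) σ↭)) (∈-allFin e)

    surely-outcome : Surely (λ (R , I) → (I ⊆ R) × IsMatching I) (outcome scheme x σ)
    surely-outcome = surely-bind {P = λ _ → ⊤} (randomSubset x) _ (surely-all (randomSubset x) (λ _ → tt))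
      λ R _ → surely-bind (run scheme R [] ⊥ σ) _
        (surely-run R [] ⊥ σ (λ f∈⊥ → contradiction f∈⊥ ∉⊥) ⊥-matching) (λ I ok → ok)

    mean-outcome : ∀ F → mean (outcome scheme x σ) F ≈
      mean (randomSubset x) (λ R → mean (run scheme R [] ⊥ σ) (λ I → F (R , I)))
    mean-outcome F = trans (mean-bind (randomSubset x) (λ R → run scheme R [] ⊥ σ >>= λ I → return (R , I)) F)
      (mean-cong (randomSubset x) (λ R → mean-bind (run scheme R [] ⊥ σ) (λ I → return (R , I)) F))

    Pr-active : ∀ e → Pr (outcome scheme x σ) (∈R e) ≈ x e
    Pr-active e = begin-equality
      Pr (outcome scheme x σ) (∈R e)                                      ≈⟨ Pr≈mean (outcome scheme x σ) (∈R e) ⟩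
      mean (outcome scheme x σ) (λ (R , _) → 𝟙 (e ∈? R))                  ≈⟨ mean-outcome (λ (R , _) → 𝟙 (e ∈? R)) ⟩
      mean (randomSubset x) (λ R → mean (run scheme R [] ⊥ σ) (λ _ → 𝟙 (e ∈? R)))
                                                                          ≈⟨ mean-cong (randomSubset x) (λ R → mean-const (run scheme R [] ⊥ σ) (𝟙 (e ∈? R))) ⟩
      mean (randomSubset x) (λ R → 𝟙 (e ∈? R))                            ≈⟨ resample x e (λ R → 𝟙 (e ∈? R)) ⟩
      x e * mean (randomSubset x) (λ R → 𝟙 (e ∈? (R [ e ]≔ true))) + (1# - x e) * mean (randomSubset x) (λ R → 𝟙 (e ∈? (R [ e ]≔ false)))
                                                                          ≈⟨ +-cong (*-congˡ (trans (mean-cong (randomSubset x) in-true) (mean-const (randomSubset x) 1#)))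
                                                                                    (*-congˡ (trans (mean-cong (randomSubset x) in-false) (mean-const (randomSubset x) 0#))) ⟩
      x e * 1# + (1# - x e) * 0#                                          ≈⟨ solve 1 (λ p → p :* one :+ (one :- p) :* con (+ 0) := p) refl (x e) ⟩
      x e                                                                 ∎
      where
      in-true : ∀ R → 𝟙 (e ∈? (R [ e ]≔ true)) ≈ 1#
      in-true R = 𝟙-yes (e ∈? (R [ e ]≔ true)) ([]≔-updates R e)
      in-false : ∀ R → 𝟙 (e ∈? (R [ e ]≔ false)) ≈ 0#
      in-false R = 𝟙-no (e ∈? (R [ e ]≔ false))
        (λ e∈ → contradiction ([]=-injective e∈ ([]≔-updates R e)) (λ ()))

    Pr-selected : ∀ e → Pr (outcome scheme x σ) (λ a → ∈I e a ∧ ∈R e a) ≈ γ * x e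
    Pr-selected e = begin-equality
      Pr (outcome scheme x σ) (λ a → ∈I e a ∧ ∈R e a)                     ≈⟨ Pr≈mean (outcome scheme x σ) (λ a → ∈I e a ∧ ∈R e a) ⟩
      mean (outcome scheme x σ) (λ (R , I) → 𝟙 ((e ∈? I) ×-dec (e ∈? R))) ≈⟨ mean-cong-surely (outcome scheme x σ) surely-outcome (λ (R , I) (I⊆R , _) →
                                                                               𝟙-⇔ ((e ∈? I) ×-dec (e ∈? R)) (e ∈? I) proj₁ (λ e∈I → e∈I , I⊆R e∈I)) ⟩
      mean (outcome scheme x σ) (λ (_ , I) → 𝟙 (e ∈? I))                  ≈⟨ mean-outcome (λ (_ , I) → 𝟙 (e ∈? I)) ⟩
      mean (randomSubset x) (λ R → mean (run scheme R [] ⊥ σ) (λ I → 𝟙 (e ∈? I)))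
                                                                          ≈⟨ deferred (λ I → 𝟙 (e ∈? I)) σ [] ⊥ τ-unique ⟩
      forward (λ I → 𝟙 (e ∈? I)) [] σ ⊥                                   ≈⟨ 𝔼-forward (λ I → 𝟙 (e ∈? I)) [] σ ⟩
      ℙ τ (e ∈?_)                                                         ≈⟨ ℙ-∈ (unique⇒valid τ-unique) e ⟩
      γ * (x ↾ τ) e                                                       ≈⟨ *-congˡ (trans (*-congʳ (𝟙-yes (e ∈ₗ? τ) (∈τ e))) (*-identityˡ (x e))) ⟩
      γ * x e                                                             ∎

    selectable : ∀ e → 0# < x e →
      Σ[ 0<Pr ∈ 0# < Pr (outcome scheme x σ) (∈R e) ] 0·337 ≤ Pr[ ∈I e ∣ ∈R e ] (outcome scheme x σ) 0<Pr
    selectable e 0<x = 0<Pr , ≤-reflexive (begin-equality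
      0·337                                                               ≡⟨ γ≡0·337 ⟨
      γ                                                                   ≈⟨ *-identityʳ γ ⟨
      γ * 1#                                                              ≈⟨ *-congˡ (*-recipʳ Q 0<Pr) ⟨
      γ * (Q * recip Q 0<Pr)                                              ≈⟨ *-assoc γ Q (recip Q 0<Pr) ⟨
      γ * Q * recip Q 0<Pr                                                ≈⟨ *-congʳ (trans (*-congˡ (Pr-active e)) (sym (Pr-selected e))) ⟩
      Pr[ ∈I e ∣ ∈R e ] (outcome scheme x σ) 0<Pr                         ∎)
      where
      Q = Pr (outcome scheme x σ) (∈R e)
      0<Pr : 0# < Q
      0<Pr = <-respʳ-≈ (sym (Pr-active e)) 0<x

theorem5p3 : ∀ {c ℓ₁ ℓ₂} (ℝ : RealNumbers c ℓ₁ ℓ₂) (G : SimpleGraph) →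
    let open RealNumbers ℝ
        open SimpleGraph G
        open Probability ℝ
        open OCRS ℝ G
    in (x : Edge → Carrier) → x ∈𝓕 →
       Σ[ 𝒜 ∈ OnlineAlgorithm ]
         (∀ (σ : List Edge) → σ ↭ allFin #E →
            Surely (λ (R , I) → (I ⊆ R) × IsMatching I) (outcome 𝒜 x σ)
          × (∀ e → 0# < x e →
               Σ[ 0<Pr ∈ 0# < Pr (outcome 𝒜 x σ) (∈R e) ]
                 0·337 ≤ Pr[ ∈I e ∣ ∈R e ] (outcome 𝒜 x σ) 0<Pr))
theorem5p3 ℝ G x x∈𝓕 = scheme , λ σ σ↭ → surely-outcome σ↭ , selectable σ↭
  where open Scheme ℝ G x x∈𝓕
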